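{- Let $G$ be a finite simple graph of order $n$ and size $m$. If $m\leq 0.0851\,n^2$ and $G$ is $2$-connected, then $\mathrm{nRel}(G;p)$ has at least two distinct points of inflection in $(0,1)$ (points at which the second derivative changes sign).
   Context: For a graph $G$ on $n$ vertices, a connected set is a nonempty vertex subset $C$ such that the induced subgraph $G[C]$ is connected. The node reliability of $G$ is the polynomial \[ \mathrm{nRel}(G;p)=\sum_{C}p^{|C|}(1-p)^{n-|C|}, \] the sum over all connected sets $C$ of $G$. The size of $G$ is its number of edges. -}

module Defs where

open import Algebra.Bundles using (CommutativeRing)
import Algebra.Properties.CommutativeSemigroup as CommutativeSemigroupProperties
import Algebra.Properties.Ring as RingProperties
open import Data.Fin as Fin using (Fin)
import Data.Fin.Properties as Fin
open import Data.Fin.Subset using (Subset; inside; outside; _∈_; Nonempty; ∁; ∣_∣)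
open import Data.Fin.Subset.Properties using (_∈?_; nonempty?)
open import Data.Integer as ℤ using (ℤ; 0ℤ; 1ℤ; -1ℤ)
open import Data.List using (List; []; _∷_; _++_; map; foldr; filter; length; allFin; cartesianProduct)
open import Data.List.Membership.Propositional using () renaming (_∈_ to _∈ᴸ_)
open import Data.List.Membership.Propositional.Properties using (∈-allFin)
open import Data.List.Relation.Unary.Any using (here; there)
open import Data.Nat as ℕ using (ℕ; zero; suc; _∸_)
import Data.Nat.Properties as ℕ
open import Data.Product using (∃-syntax; _×_; _,_)
open import Data.Rational as ℚ using (ℚ; 0ℚ; 1ℚ)
import Data.Rational.Properties as ℚ
open import Data.Sum using (_⊎_; inj₁; inj₂)
open import Data.Vec using ([]; _∷_)
open import Level using (0ℓ)
open import Relation.Binary.Core using (Rel)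
open import Relation.Binary.Definitions using (Decidable; Symmetric; Irreflexive)
open import Relation.Binary.Construct.Closure.ReflexiveTransitive using (Star; ε; _◅_; _◅◅_)
open import Relation.Binary.PropositionalEquality using (_≡_; refl; sym; cong; cong₂; subst; module ≡-Reasoning)
open import Relation.Nullary using (Dec)
open import Relation.Nullary.Decidable using (map′; _×-dec_; _⊎-dec_; _→-dec_)

------------------------------------------------------------------------
-- Graphs

record Graph (n : ℕ) : Set₁ where
  field
    Adj    : Rel (Fin n) 0ℓ
    adj?   : Decidable Adj
    symm   : Symmetric Adj
    irrefl : Irreflexive _≡_ Adj

open Graph public

size : ∀ {n} → Graph n → ℕ
size {n} G = length (filter (λ (u , v) → (u Fin.<? v) ×-dec adj? G u v)
                            (cartesianProduct (allFin n) (allFin n)))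

-- Adjacency in the induced subgraph G[C].
InducedAdj : ∀ {n} → Graph n → Subset n → Rel (Fin n) 0ℓ
InducedAdj G C u v = u ∈ C × v ∈ C × Adj G u v

ConnectedSet : ∀ {n} → Graph n → Subset n → Set
ConnectedSet G C = Nonempty C × (∀ u v → u ∈ C → v ∈ C → Star (InducedAdj G C) u v)

KConnected : ∀ {n} → ℕ → Graph n → Set
KConnected {n} k G = k ℕ.< n × (∀ (X : Subset n) → ∣ X ∣ ℕ.< k → ConnectedSet G (∁ X))

-- Reachability for a decidable relation on Fin n is decidable, by Warshall's
-- algorithm: Via L u v says that v is reachable from u with all intermediate
-- vertices in L.
module _ {n : ℕ} {R : Rel (Fin n) 0ℓ} (R? : Decidable R) where

  private
    Via : List (Fin n) → Rel (Fin n) 0ℓ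
    Via []      u v = u ≡ v ⊎ R u v
    Via (w ∷ L) u v = Via L u v ⊎ (Via L u w × Via L w v)

    via? : ∀ L → Decidable (Via L)
    via? []      u v = (u Fin.≟ v) ⊎-dec R? u v
    via? (w ∷ L) u v = via? L u v ⊎-dec (via? L u w ×-dec via? L w v)

    sound : ∀ L {u v} → Via L u v → Star R u v
    sound []      (inj₁ refl)    = ε
    sound []      (inj₂ r)       = r ◅ ε
    sound (w ∷ L) (inj₁ p)       = sound L p
    sound (w ∷ L) (inj₂ (p , q)) = sound L p ◅◅ sound L q

    base : ∀ L {u v} → u ≡ v ⊎ R u v → Via L u v
    base []      p = p
    base (w ∷ L) p = inj₁ (base L p)

    toHead : ∀ w L {u} → Via (w ∷ L) u w → Via L u w
    toHead w L (inj₁ p)       = p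
    toHead w L (inj₂ (p , _)) = p

    fromHead : ∀ w L {v} → Via (w ∷ L) w v → Via L w v
    fromHead w L (inj₁ p)       = p
    fromHead w L (inj₂ (_ , p)) = p

    join : ∀ L {u w v} → w ∈ᴸ L → Via L u w → Via L w v → Via L u v
    join (x ∷ L) (here refl) p q = inj₂ (toHead x L p , fromHead x L q)
    join (x ∷ L) (there w∈L) (inj₁ p)       (inj₁ q)       = inj₁ (join L w∈L p q)
    join (x ∷ L) (there w∈L) (inj₁ p)       (inj₂ (q , r)) = inj₂ (join L w∈L p q , r)
    join (x ∷ L) (there w∈L) (inj₂ (p , q)) (inj₁ r)       = inj₂ (p , join L w∈L q r)
    join (x ∷ L) (there w∈L) (inj₂ (p , _)) (inj₂ (_ , q)) = inj₂ (p , q)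

    complete : ∀ {u v} → Star R u v → Via (allFin n) u v
    complete ε        = base (allFin n) (inj₁ refl)
    complete (r ◅ rs) = join (allFin n) (∈-allFin _) (base (allFin n) (inj₂ r)) (complete rs)

  star? : Decidable (Star R)
  star? u v = map′ (sound (allFin n)) complete (via? (allFin n) u v)

inducedAdj? : ∀ {n} (G : Graph n) C → Decidable (InducedAdj G C)
inducedAdj? G C u v = (u ∈? C) ×-dec ((v ∈? C) ×-dec adj? G u v)

connectedSet? : ∀ {n} (G : Graph n) (C : Subset n) → Dec (ConnectedSet G C)
connectedSet? G C = nonempty? C ×-dec
  Fin.all? (λ u → Fin.all? (λ v →
    (u ∈? C) →-dec ((v ∈? C) →-dec star? (inducedAdj? G C) u v)))

subsets : ∀ n → List (Subset n)
subsets zero    = [] ∷ []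
subsets (suc n) = map (inside ∷_) (subsets n) ++ map (outside ∷_) (subsets n)

connectedSets : ∀ {n} → Graph n → List (Subset n)
connectedSets {n} G = filter (connectedSet? G) (subsets n)

------------------------------------------------------------------------
-- Integer polynomials in one variable, as coefficient lists with the constant
-- term first (trailing zeros are allowed).

Poly : Set
Poly = List ℤ

infixl 6 _⊞_
infixl 7 _⊠_
infixr 8 _↑_

_⊞_ : Poly → Poly → Poly
[]       ⊞ bs       = bs
(a ∷ as) ⊞ []       = a ∷ as
(a ∷ as) ⊞ (b ∷ bs) = (a ℤ.+ b) ∷ (as ⊞ bs)

_⊠_ : Poly → Poly → Poly
[]       ⊠ bs = []
(a ∷ as) ⊠ bs = map (a ℤ.*_) bs ⊞ (0ℤ ∷ (as ⊠ bs))

_↑_ : Poly → ℕ → Poly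
P ↑ zero  = 1ℤ ∷ []
P ↑ suc k = P ⊠ (P ↑ k)

-- (a + p Q)′ = Q + p Q′
derivative : Poly → Poly
derivative []       = []
derivative (a ∷ as) = as ⊞ (0ℤ ∷ derivative as)

𝐩 1-𝐩 : Poly
𝐩   = 0ℤ ∷ 1ℤ ∷ []
1-𝐩 = 1ℤ ∷ -1ℤ ∷ []

nRel : ∀ {n} → Graph n → Poly
nRel {n} G = foldr _⊞_ []
  (map (λ C → (𝐩 ↑ ∣ C ∣) ⊠ (1-𝐩 ↑ (n ∸ ∣ C ∣))) (connectedSets G))

------------------------------------------------------------------------
-- Real numbers, as Cauchy sequences of rationals.  Two sequences represent the
-- same real when neither is less than the other; _<_ and _#_ respect this.

Cauchy : (ℕ → ℚ) → Set
Cauchy x = ∀ e → 0ℚ ℚ.< e →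
  ∃[ N ] ∀ i j → N ℕ.≤ i → N ℕ.≤ j → ℚ.∣ x i ℚ.- x j ∣ ℚ.≤ e

record ℝ : Set where
  constructor mkℝ
  field
    seq    : ℕ → ℚ
    cauchy : Cauchy seq

open ℝ public

infix  4 _<_ _#_
infixl 6 _+_
infixl 7 _*_

_<_ : ℝ → ℝ → Set
x < y = ∃[ d ] 0ℚ ℚ.< d × ∃[ N ] ∀ i → N ℕ.≤ i → seq x i ℚ.+ d ℚ.≤ seq y i

-- Apartness: the constructive form of x ≠ y.
_#_ : ℝ → ℝ → Set
x # y = x < y ⊎ y < x

fromℚ : ℚ → ℝ
fromℚ q = mkℝ (λ _ → q) λ e 0<e → 0 , λ _ _ _ _ →
  subst (ℚ._≤ e) (cong ℚ.∣_∣ (sym (ℚ.+-inverseʳ q))) (ℚ.<⇒≤ 0<e)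

fromℤ : ℤ → ℝ
fromℤ a = fromℚ (a ℚ./ 1)

0ℝ 1ℝ : ℝ
0ℝ = fromℚ 0ℚ
1ℝ = fromℚ 1ℚ

private
  open CommutativeSemigroupProperties
    (CommutativeRing.*-commutativeSemigroup ℚ.+-*-commutativeRing) using (x∙yz≈y∙xz)
  open CommutativeSemigroupProperties
    (CommutativeRing.+-commutativeSemigroup ℚ.+-*-commutativeRing) using (interchange)
  open RingProperties ℚ.+-*-ring using (x[y-z]≈xy-xz; [y-z]x≈yx-zx)

  cancel : ∀ a b → a ≡ (a ℚ.- b) ℚ.+ b
  cancel a b = begin
    a                        ≡⟨ ℚ.+-identityʳ a ⟨
    a ℚ.+ 0ℚ                 ≡⟨ cong (a ℚ.+_) (ℚ.+-inverseˡ b) ⟨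
    a ℚ.+ (ℚ.- b ℚ.+ b)      ≡⟨ ℚ.+-assoc a (ℚ.- b) b ⟨
    (a ℚ.- b) ℚ.+ b          ∎
    where open ≡-Reasoning

  sum-diff : ∀ a b c d → (a ℚ.+ b) ℚ.- (c ℚ.+ d) ≡ (a ℚ.- c) ℚ.+ (b ℚ.- d)
  sum-diff a b c d = begin
    (a ℚ.+ b) ℚ.- (c ℚ.+ d)          ≡⟨ cong ((a ℚ.+ b) ℚ.+_) (ℚ.neg-distrib-+ c d) ⟩
    (a ℚ.+ b) ℚ.+ (ℚ.- c ℚ.+ ℚ.- d)  ≡⟨ interchange a b (ℚ.- c) (ℚ.- d) ⟩
    (a ℚ.- c) ℚ.+ (b ℚ.- d)          ∎
    where open ≡-Reasoning

  prod-diff : ∀ a b c d → a ℚ.* b ℚ.- c ℚ.* d ≡ a ℚ.* (b ℚ.- d) ℚ.+ (a ℚ.- c) ℚ.* d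
  prod-diff a b c d = begin
    a ℚ.* b ℚ.- c ℚ.* d
      ≡⟨ cong (ℚ._- c ℚ.* d) (cancel (a ℚ.* b) (a ℚ.* d)) ⟩
    (a ℚ.* b ℚ.- a ℚ.* d ℚ.+ a ℚ.* d) ℚ.- c ℚ.* d
      ≡⟨ ℚ.+-assoc (a ℚ.* b ℚ.- a ℚ.* d) (a ℚ.* d) (ℚ.- (c ℚ.* d)) ⟩
    (a ℚ.* b ℚ.- a ℚ.* d) ℚ.+ (a ℚ.* d ℚ.- c ℚ.* d)
      ≡⟨ cong₂ ℚ._+_ (x[y-z]≈xy-xz a b d) ([y-z]x≈yx-zx d a c) ⟨
    a ℚ.* (b ℚ.- d) ℚ.+ (a ℚ.- c) ℚ.* d ∎
    where open ≡-Reasoning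

  double : ∀ d → d ℚ.+ d ≡ (1ℚ ℚ.+ 1ℚ) ℚ.* d
  double d = begin
    d ℚ.+ d                  ≡⟨ cong₂ ℚ._+_ (ℚ.*-identityˡ d) (ℚ.*-identityˡ d) ⟨
    1ℚ ℚ.* d ℚ.+ 1ℚ ℚ.* d    ≡⟨ ℚ.*-distribʳ-+ d 1ℚ 1ℚ ⟨
    (1ℚ ℚ.+ 1ℚ) ℚ.* d        ∎
    where open ≡-Reasoning

  collect : ∀ a b d → a ℚ.* d ℚ.+ d ℚ.* b ≡ (a ℚ.+ b) ℚ.* d
  collect a b d = begin
    a ℚ.* d ℚ.+ d ℚ.* b      ≡⟨ cong (a ℚ.* d ℚ.+_) (ℚ.*-comm d b) ⟩
    a ℚ.* d ℚ.+ b ℚ.* d      ≡⟨ ℚ.*-distribʳ-+ d a b ⟨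
    (a ℚ.+ b) ℚ.* d          ∎
    where open ≡-Reasoning

  scale : ∀ K → 1ℚ ℚ.≤ K → ∀ e → 0ℚ ℚ.< e → ∃[ d ] 0ℚ ℚ.< d × K ℚ.* d ≡ e
  scale K 1≤K e 0<e = e ℚ.* ℚ.1/ K , pos , eq
    where
    instance
      K>0 : ℚ.Positive K
      K>0 = ℚ.positive (ℚ.<-≤-trans (ℚ.positive⁻¹ 1ℚ) 1≤K)
      K≢0 : ℚ.NonZero K
      K≢0 = ℚ.pos⇒nonZero K
      K⁻¹>0 : ℚ.Positive (ℚ.1/ K)
      K⁻¹>0 = ℚ.1/pos⇒pos K
    pos : 0ℚ ℚ.< e ℚ.* ℚ.1/ K
    pos = subst (ℚ._< e ℚ.* ℚ.1/ K) (ℚ.*-zeroˡ (ℚ.1/ K)) (ℚ.*-monoˡ-<-pos (ℚ.1/ K) 0<e)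
    eq : K ℚ.* (e ℚ.* ℚ.1/ K) ≡ e
    eq = begin
      K ℚ.* (e ℚ.* ℚ.1/ K)  ≡⟨ x∙yz≈y∙xz K e (ℚ.1/ K) ⟩
      e ℚ.* (K ℚ.* ℚ.1/ K)  ≡⟨ cong (e ℚ.*_) (ℚ.*-inverseʳ K) ⟩
      e ℚ.* 1ℚ              ≡⟨ ℚ.*-identityʳ e ⟩
      e                     ∎
      where
      open ≡-Reasoning

  bounded : ∀ x → Cauchy x → ∃[ B ] 1ℚ ℚ.≤ B × ∃[ N ] ∀ i → N ℕ.≤ i → ℚ.∣ x i ∣ ℚ.≤ B
  bounded x cx with cx 1ℚ (ℚ.positive⁻¹ 1ℚ)
  ... | N , close = 1ℚ ℚ.+ ℚ.∣ x N ∣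
                  , ℚ.≤-trans (ℚ.≤-reflexive (sym (ℚ.+-identityʳ 1ℚ)))
                              (ℚ.+-monoʳ-≤ 1ℚ (ℚ.0≤∣p∣ (x N)))
                  , N , bound
    where
    open ℚ.≤-Reasoning
    bound : ∀ i → N ℕ.≤ i → ℚ.∣ x i ∣ ℚ.≤ 1ℚ ℚ.+ ℚ.∣ x N ∣
    bound i N≤i = begin
      ℚ.∣ x i ∣                        ≡⟨ cong ℚ.∣_∣ (cancel (x i) (x N)) ⟩
      ℚ.∣ (x i ℚ.- x N) ℚ.+ x N ∣      ≤⟨ ℚ.∣p+q∣≤∣p∣+∣q∣ (x i ℚ.- x N) (x N) ⟩
      ℚ.∣ x i ℚ.- x N ∣ ℚ.+ ℚ.∣ x N ∣  ≤⟨ ℚ.+-monoˡ-≤ ℚ.∣ x N ∣ (close i N N≤i ℕ.≤-refl) ⟩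
      1ℚ ℚ.+ ℚ.∣ x N ∣                 ∎

  *-mono-abs : ∀ p q {a b} → ℚ.∣ p ∣ ℚ.≤ a → ℚ.∣ q ∣ ℚ.≤ b → ℚ.∣ p ℚ.* q ∣ ℚ.≤ a ℚ.* b
  *-mono-abs p q {a} {b} p≤a q≤b = begin
    ℚ.∣ p ℚ.* q ∣        ≡⟨ ℚ.∣p*q∣≡∣p∣*∣q∣ p q ⟩
    ℚ.∣ p ∣ ℚ.* ℚ.∣ q ∣  ≤⟨ ℚ.*-monoʳ-≤-nonNeg ℚ.∣ q ∣ {{ℚ.∣-∣-nonNeg q}} p≤a ⟩
    a ℚ.* ℚ.∣ q ∣        ≤⟨ ℚ.*-monoˡ-≤-nonNeg a {{ℚ.nonNegative (ℚ.≤-trans (ℚ.0≤∣p∣ p) p≤a)}} q≤b ⟩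
    a ℚ.* b              ∎
    where open ℚ.≤-Reasoning

  +-cauchy : ∀ x y → Cauchy x → Cauchy y → Cauchy (λ i → x i ℚ.+ y i)
  +-cauchy x y cx cy e 0<e with scale (1ℚ ℚ.+ 1ℚ) (ℚ.≤ᵇ⇒≤ _) e 0<e
  ... | d , 0<d , 2d≡e with cx d 0<d | cy d 0<d
  ... | M , closeˣ | N , closeʸ = M ℕ.⊔ N , λ i j ≤i ≤j → begin
      ℚ.∣ (x i ℚ.+ y i) ℚ.- (x j ℚ.+ y j) ∣
        ≡⟨ cong ℚ.∣_∣ (sum-diff (x i) (y i) (x j) (y j)) ⟩
      ℚ.∣ (x i ℚ.- x j) ℚ.+ (y i ℚ.- y j) ∣
        ≤⟨ ℚ.∣p+q∣≤∣p∣+∣q∣ (x i ℚ.- x j) (y i ℚ.- y j) ⟩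
      ℚ.∣ x i ℚ.- x j ∣ ℚ.+ ℚ.∣ y i ℚ.- y j ∣
        ≤⟨ ℚ.+-mono-≤ (closeˣ i j (ℕ.m⊔n≤o⇒m≤o M N ≤i) (ℕ.m⊔n≤o⇒m≤o M N ≤j))
                      (closeʸ i j (ℕ.m⊔n≤o⇒n≤o M N ≤i) (ℕ.m⊔n≤o⇒n≤o M N ≤j)) ⟩
      d ℚ.+ d
        ≡⟨ double d ⟩
      (1ℚ ℚ.+ 1ℚ) ℚ.* d
        ≡⟨ 2d≡e ⟩
      e ∎
    where
    open ℚ.≤-Reasoning

  *-cauchy : ∀ x y → Cauchy x → Cauchy y → Cauchy (λ i → x i ℚ.* y i)
  *-cauchy x y cx cy e 0<e with bounded x cx | bounded y cy
  ... | A , 1≤A , K , ∣x∣≤A | B , 1≤B , L , ∣y∣≤B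
    with scale (A ℚ.+ B) (ℚ.≤-trans (ℚ.≤ᵇ⇒≤ _) (ℚ.+-mono-≤ 1≤A 1≤B)) e 0<e
  ... | d , 0<d , Kd≡e with cx d 0<d | cy d 0<d
  ... | M , closeˣ | N , closeʸ = (K ℕ.⊔ L) ℕ.⊔ (M ℕ.⊔ N) , λ i j ≤i ≤j →
    let KL≤i = ℕ.m⊔n≤o⇒m≤o (K ℕ.⊔ L) (M ℕ.⊔ N) ≤i
        KL≤j = ℕ.m⊔n≤o⇒m≤o (K ℕ.⊔ L) (M ℕ.⊔ N) ≤j
        MN≤i = ℕ.m⊔n≤o⇒n≤o (K ℕ.⊔ L) (M ℕ.⊔ N) ≤i
        MN≤j = ℕ.m⊔n≤o⇒n≤o (K ℕ.⊔ L) (M ℕ.⊔ N) ≤j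
    in begin
      ℚ.∣ x i ℚ.* y i ℚ.- x j ℚ.* y j ∣
        ≡⟨ cong ℚ.∣_∣ (prod-diff (x i) (y i) (x j) (y j)) ⟩
      ℚ.∣ x i ℚ.* (y i ℚ.- y j) ℚ.+ (x i ℚ.- x j) ℚ.* y j ∣
        ≤⟨ ℚ.∣p+q∣≤∣p∣+∣q∣ (x i ℚ.* (y i ℚ.- y j)) ((x i ℚ.- x j) ℚ.* y j) ⟩
      ℚ.∣ x i ℚ.* (y i ℚ.- y j) ∣ ℚ.+ ℚ.∣ (x i ℚ.- x j) ℚ.* y j ∣
        ≤⟨ ℚ.+-mono-≤
             (*-mono-abs (x i) (y i ℚ.- y j) (∣x∣≤A i (ℕ.m⊔n≤o⇒m≤o K L KL≤i))
               (closeʸ i j (ℕ.m⊔n≤o⇒n≤o M N MN≤i) (ℕ.m⊔n≤o⇒n≤o M N MN≤j)))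
             (*-mono-abs (x i ℚ.- x j) (y j)
               (closeˣ i j (ℕ.m⊔n≤o⇒m≤o M N MN≤i) (ℕ.m⊔n≤o⇒m≤o M N MN≤j))
               (∣y∣≤B j (ℕ.m⊔n≤o⇒n≤o K L KL≤j))) ⟩
      A ℚ.* d ℚ.+ d ℚ.* B
        ≡⟨ collect A B d ⟩
      (A ℚ.+ B) ℚ.* d
        ≡⟨ Kd≡e ⟩
      e ∎
    where
    open ℚ.≤-Reasoning

_+_ : ℝ → ℝ → ℝ
x + y = mkℝ (λ i → seq x i ℚ.+ seq y i) (+-cauchy (seq x) (seq y) (cauchy x) (cauchy y))

_*_ : ℝ → ℝ → ℝ
x * y = mkℝ (λ i → seq x i ℚ.* seq y i) (*-cauchy (seq x) (seq y) (cauchy x) (cauchy y))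

eval : Poly → ℝ → ℝ
eval P x = foldr (λ a r → fromℤ a + x * r) 0ℝ P

------------------------------------------------------------------------
-- Points of inflection

NegativeOn PositiveOn : Poly → ℝ → ℝ → Set
NegativeOn P a b = ∀ x → a < x → x < b → eval P x < 0ℝ
PositiveOn P a b = ∀ x → a < x → x < b → 0ℝ < eval P x

ChangesSignAt : Poly → ℝ → Set
ChangesSignAt P c = ∃[ a ] ∃[ b ] a < c × c < b ×
  ((NegativeOn P a c × PositiveOn P c b) ⊎ (PositiveOn P a c × NegativeOn P c b))

InflectionPoint : Poly → ℝ → Set
InflectionPoint P c = ChangesSignAt (derivative (derivative P)) c

{-# OPTIONS --safe #-}

-- Write f for the node reliability, N = n − 1, and B(k, p) =
-- k(k − 1) − 2kNp + nNp², so that p²(1 − p)² f″(p) is the sum of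
-- pᵏ(1 − p)ⁿ⁻ᵏ B(k, p) over the connected sets, k being the size of the set.
-- The same sum over all sets vanishes, because the weights pᵏ(1 − p)ⁿ⁻ᵏ add
-- up to 1.
--
-- At p = 1/(2N) only k = 1 makes B negative, and at 1 − 1/(2N) only k = n − 1.
-- Sets of these sizes are connected, so all disconnected sets contribute
-- nonnegatively, the empty set positively, and f″ < 0 at both points.
-- At p = 3/N, B is negative only for 2 ≤ k ≤ 5.  A connected set of size k
-- spans at least k − 1 edges, so there are at most m C(n − 2, k − 2) / (k − 1)
-- of them, and for m ≤ 0.0851 n² the n singletons outweigh them: f″ > 0.
--
-- It remains to find, constructively, a point of strict sign change of f″
-- between rationals where f″ has opposite signs.  Every nonzero polynomial P
-- divides a power of a square-free S.  On a short interval S is bounded away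
-- from 0 or strictly monotone, so of any two points x < y of [a, b] one can
-- decide that P is bounded away from 0 on [a, x] or that it is on [y, b].
-- Trisection then converges to the desired point.
module Submission where

-- At p = c/N the bracket is B(k, p) = k² - (2c + 1)k + c² + c²/N, so the choice of c fixes its sign
-- pattern. For c = 1/2 it is k(k - 2) plus a positive term, which singles out k = 1, and the
-- symmetry B(n - k, p) = B(k, 1 - p) gives the point near 1. For c = 3 the singletons have become
-- positive, with B = 3 + 9/N, while for N > 9 the negative sizes form a short range that does not
-- grow with n. The smaller graphs are excluded by the n - 1 edges of a spanning tree.
--
-- The obstacle in the last step is multiplicity. Near a multiple root of f″ both value and slope
-- are small, so estimates at rational points do not show on which side of the root a point lies.
-- For a square-free S an identity A S + B S′ = 1 rules this out uniformly on [0, 1]. Every decision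
-- is then a comparison of rationals, and real numbers occur only as limits of the nested intervals.

-- Rational inequalities and the embedding of the natural numbers.

module Arithmetic where

  open import Data.Integer as ℤ using (+_)
  import Data.Integer.Properties as ℤ
  open import Data.Nat as ℕ using (ℕ; suc)
  import Data.Nat.Properties as ℕ
  open import Data.Product using (∃-syntax; _×_; _,_)
  open import Data.Rational
  open import Data.Rational.Properties
  import Data.Rational.Unnormalised as ℚᵘ
  import Data.Rational.Unnormalised.Properties as ℚᵘ
  open import Data.Sum using (inj₁; inj₂)
  open import Level using (0ℓ)
  open import Relation.Binary.PropositionalEquality
  open import Relation.Nullary.Decidable using (dec⇒maybe)
  open import Tactic.RingSolver using (solve-∀)
  open import Tactic.RingSolver.Core.AlmostCommutativeRing using (AlmostCommutativeRing; fromCommutativeRing)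

  ℚ-ring : AlmostCommutativeRing 0ℓ 0ℓ
  ℚ-ring = fromCommutativeRing +-*-commutativeRing λ x → dec⇒maybe (0ℚ ≟ x)

  0≤1 : 0ℚ ≤ 1ℚ
  0≤1 = ≤ᵇ⇒≤ _

  0<1 : 0ℚ < 1ℚ
  0<1 = positive⁻¹ 1ℚ

  -- Most inequalities below are certified by naming the remainder `r`: the ring solver proves the
  -- equation, and closure of signs under sums and products proves 0 ≤ r.
  ≤-offset : ∀ {a b r} → b ≡ a + r → 0ℚ ≤ r → a ≤ b
  ≤-offset {a} {b} {r} eq 0≤r = begin
    a       ≡⟨ +-identityʳ a ⟨
    a + 0ℚ  ≤⟨ +-monoʳ-≤ a 0≤r ⟩
    a + r   ≡⟨ eq ⟨
    b       ∎
    where open ≤-Reasoning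

  <-offset : ∀ {a b r} → b ≡ a + r → 0ℚ < r → a < b
  <-offset {a} {b} {r} eq 0<r = begin-strict
    a       ≡⟨ +-identityʳ a ⟨
    a + 0ℚ  <⟨ +-monoʳ-< a 0<r ⟩
    a + r   ≡⟨ eq ⟨
    b       ∎
    where open ≤-Reasoning

  0≤q-p : ∀ {p q} → p ≤ q → 0ℚ ≤ q - p
  0≤q-p {p} {q} p≤q = begin
    0ℚ     ≡⟨ +-inverseʳ p ⟨
    p - p  ≤⟨ +-monoˡ-≤ (- p) p≤q ⟩
    q - p  ∎
    where open ≤-Reasoning

  0<q-p : ∀ {p q} → p < q → 0ℚ < q - p
  0<q-p {p} {q} p<q = begin-strict
    0ℚ     ≡⟨ +-inverseʳ p ⟨
    p - p  <⟨ +-monoˡ-< (- p) p<q ⟩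
    q - p  ∎
    where open ≤-Reasoning

  +-nonNeg : ∀ {p q} → 0ℚ ≤ p → 0ℚ ≤ q → 0ℚ ≤ p + q
  +-nonNeg = +-mono-≤

  +-pos : ∀ {p q} → 0ℚ < p → 0ℚ < q → 0ℚ < p + q
  +-pos = +-mono-<

  +-pos-nonNeg : ∀ {p q} → 0ℚ < p → 0ℚ ≤ q → 0ℚ < p + q
  +-pos-nonNeg = +-mono-<-≤

  *-nonNeg : ∀ {p q} → 0ℚ ≤ p → 0ℚ ≤ q → 0ℚ ≤ p * q
  *-nonNeg {p} {q} 0≤p 0≤q =
    nonNegative⁻¹ (p * q) {{nonNeg*nonNeg⇒nonNeg p {{nonNegative 0≤p}} q {{nonNegative 0≤q}}}}

  *-pos : ∀ {p q} → 0ℚ < p → 0ℚ < q → 0ℚ < p * q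
  *-pos {p} {q} 0<p 0<q =
    positive⁻¹ (p * q) {{pos*pos⇒pos p {{positive 0<p}} q {{positive 0<q}}}}

  *-monoˡ : ∀ {r p q} → 0ℚ ≤ r → p ≤ q → r * p ≤ r * q
  *-monoˡ {r} 0≤r = *-monoˡ-≤-nonNeg r {{nonNegative 0≤r}}

  *-monoʳ : ∀ {r p q} → 0ℚ ≤ r → p ≤ q → p * r ≤ q * r
  *-monoʳ {r} 0≤r = *-monoʳ-≤-nonNeg r {{nonNegative 0≤r}}

  *-mono : ∀ {p q r s} → 0ℚ ≤ p → 0ℚ ≤ s → p ≤ q → r ≤ s → p * r ≤ q * s
  *-mono 0≤p 0≤s p≤q r≤s = ≤-trans (*-monoˡ 0≤p r≤s) (*-monoʳ 0≤s p≤q)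

  divide : ∀ {K e} → 0ℚ < K → 0ℚ < e → ∃[ d ] 0ℚ < d × K * d ≡ e
  divide {K} {e} 0<K 0<e = e * 1/ K
    , *-pos 0<e (positive⁻¹ (1/ K) {{1/pos⇒pos K}})
    , trans (rearrange K e (1/ K)) (trans (cong (e *_) (*-inverseʳ K)) (*-identityʳ e))
    where
    instance
      K>0 : Positive K
      K>0 = positive 0<K
      K≢0 : NonZero K
      K≢0 = pos⇒nonZero K
    rearrange : ∀ k x y → k * (x * y) ≡ x * (k * y)
    rearrange = solve-∀ ℚ-ring

  *-cancelˡ-≤ : ∀ {r p q} → 0ℚ < r → r * p ≤ r * q → p ≤ q
  *-cancelˡ-≤ {r} 0<r = *-cancelˡ-≤-pos r {{positive 0<r}}

  *-cancelˡ-≡ : ∀ {r p q} → 0ℚ < r → r * p ≡ r * q → p ≡ q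
  *-cancelˡ-≡ 0<r rp≡rq =
    ≤-antisym (*-cancelˡ-≤ 0<r (≤-reflexive rp≡rq)) (*-cancelˡ-≤ 0<r (≤-reflexive (sym rp≡rq)))

  pos-cancelˡ : ∀ {r p} → 0ℚ < r → 0ℚ < r * p → 0ℚ < p
  pos-cancelˡ {r} {p} 0<r 0<rp =
    *-cancelˡ-<-nonNeg r {{nonNegative (<⇒≤ 0<r)}} (subst (_< r * p) (sym (*-zeroʳ r)) 0<rp)

  p≤∣p∣ : ∀ p → p ≤ ∣ p ∣
  p≤∣p∣ p with ≤-total 0ℚ p
  ... | inj₁ 0≤p = ≤-reflexive (sym (0≤p⇒∣p∣≡p 0≤p))
  ... | inj₂ p≤0 = ≤-trans p≤0 (0≤∣p∣ p)

  -p≤∣p∣ : ∀ p → - p ≤ ∣ p ∣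
  -p≤∣p∣ p = subst (- p ≤_) (∣-p∣≡∣p∣ p) (p≤∣p∣ (- p))

  ∣∣-intro : ∀ {p q} → p ≤ q → - p ≤ q → ∣ p ∣ ≤ q
  ∣∣-intro {p} p≤q -p≤q with ∣p∣≡p∨∣p∣≡-p p
  ... | inj₁ eq = subst (_≤ _) (sym eq) p≤q
  ... | inj₂ eq = subst (_≤ _) (sym eq) -p≤q

  ∣∣-+ : ∀ {p q a b} → ∣ p ∣ ≤ a → ∣ q ∣ ≤ b → ∣ p + q ∣ ≤ a + b
  ∣∣-+ {p} {q} p≤a q≤b = ≤-trans (∣p+q∣≤∣p∣+∣q∣ p q) (+-mono-≤ p≤a q≤b)

  ∣∣-* : ∀ {p q a b} → ∣ p ∣ ≤ a → ∣ q ∣ ≤ b → ∣ p * q ∣ ≤ a * b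
  ∣∣-* {p} {q} p≤a q≤b = subst (_≤ _) (sym (∣p*q∣≡∣p∣*∣q∣ p q))
    (*-mono (0≤∣p∣ p) (≤-trans (0≤∣p∣ q) q≤b) p≤a q≤b)

  ∣∣-pos : ∀ {p} → p ≢ 0ℚ → 0ℚ < ∣ p ∣
  ∣∣-pos {p} p≢0 = ≰⇒> λ ∣p∣≤0 → p≢0 (∣p∣≡0⇒p≡0 p (≤-antisym ∣p∣≤0 (0≤∣p∣ p)))

  i/1+j/1 : ∀ i j → (i ℤ.+ j) / 1 ≡ i / 1 + j / 1
  i/1+j/1 i j = toℚᵘ-injective (begin
    toℚᵘ ((i ℤ.+ j) / 1)                       ≈⟨ toℚᵘ-fromℚᵘ (ℚᵘ.mkℚᵘ (i ℤ.+ j) 0) ⟩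
    ℚᵘ.mkℚᵘ (i ℤ.+ j) 0                        ≈⟨ ℚᵘ.*≡* (cong (ℤ._* + 1) (cong₂ ℤ._+_ (sym (ℤ.*-identityʳ i)) (sym (ℤ.*-identityʳ j)))) ⟩
    ℚᵘ.mkℚᵘ i 0 ℚᵘ.+ ℚᵘ.mkℚᵘ j 0               ≈⟨ ℚᵘ.+-cong (toℚᵘ-fromℚᵘ (ℚᵘ.mkℚᵘ i 0)) (toℚᵘ-fromℚᵘ (ℚᵘ.mkℚᵘ j 0)) ⟨
    toℚᵘ (i / 1) ℚᵘ.+ toℚᵘ (j / 1)             ≈⟨ toℚᵘ-homo-+ (i / 1) (j / 1) ⟨
    toℚᵘ (i / 1 + j / 1)                       ∎)
    where open ℚᵘ.≃-Reasoning

  i/1*j/1 : ∀ i j → (i ℤ.* j) / 1 ≡ i / 1 * (j / 1)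
  i/1*j/1 i j = toℚᵘ-injective (begin
    toℚᵘ ((i ℤ.* j) / 1)                       ≈⟨ toℚᵘ-fromℚᵘ (ℚᵘ.mkℚᵘ (i ℤ.* j) 0) ⟩
    ℚᵘ.mkℚᵘ i 0 ℚᵘ.* ℚᵘ.mkℚᵘ j 0               ≈⟨ ℚᵘ.*-cong (toℚᵘ-fromℚᵘ (ℚᵘ.mkℚᵘ i 0)) (toℚᵘ-fromℚᵘ (ℚᵘ.mkℚᵘ j 0)) ⟨
    toℚᵘ (i / 1) ℚᵘ.* toℚᵘ (j / 1)             ≈⟨ toℚᵘ-homo-* (i / 1) (j / 1) ⟨
    toℚᵘ (i / 1 * (j / 1))                     ∎)
    where open ℚᵘ.≃-Reasoning

  opaque
    -- Opaque, so that the type checker does not unfold it to a normalised fraction; elsewhere it is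
    -- reached only through the laws of this block.
    ι : ℕ → ℚ
    ι n = + n / 1

    ι≡ : ∀ n → ι n ≡ + n / 1
    ι≡ n = refl

    ι-0 : ι 0 ≡ 0ℚ
    ι-0 = refl

    ι-1 : ι 1 ≡ 1ℚ
    ι-1 = refl

    ι-+ : ∀ m n → ι (m ℕ.+ n) ≡ ι m + ι n
    ι-+ m n = i/1+j/1 (+ m) (+ n)

    ι-* : ∀ m n → ι (m ℕ.* n) ≡ ι m * ι n
    ι-* m n = trans (cong (_/ 1) (ℤ.pos-* m n)) (i/1*j/1 (+ m) (+ n))

    ι-suc : ∀ n → ι (suc n) ≡ 1ℚ + ι n
    ι-suc = ι-+ 1

    0≤ι : ∀ n → 0ℚ ≤ ι n
    0≤ι n = nonNegative⁻¹ (ι n) {{normalize-nonNeg n 1}}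

    0<ι : ∀ n → 0ℚ < ι (suc n)
    0<ι n = positive⁻¹ (ι (suc n)) {{normalize-pos (suc n) 1}}

    ι-mono-≤ : ∀ {m n} → m ℕ.≤ n → ι m ≤ ι n
    ι-mono-≤ {m} {n} m≤n = ≤-offset (trans (cong ι (sym (ℕ.m+[n∸m]≡n m≤n))) (ι-+ m (n ℕ.∸ m))) (0≤ι (n ℕ.∸ m))

    ι-mono-< : ∀ {m n} → m ℕ.< n → ι m < ι n
    ι-mono-< {m} {n} m<n = <-≤-trans (<-offset (trans (ι-suc m) (+-comm 1ℚ (ι m))) 0<1) (ι-mono-≤ m<n)

    ι-cancel-≤ : ∀ {m n} → ι m ≤ ι n → m ℕ.≤ n
    ι-cancel-≤ {m} {n} ιm≤ιn = ℕ.≮⇒≥ λ n<m → <-irrefl refl (<-≤-trans (ι-mono-< n<m) ιm≤ιn)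

    archimedean : ∀ q → ∃[ n ] q ≤ ι n
    archimedean q@record{} = ℤ.∣ ↥ q ∣ , toℚᵘ-cancel-≤ (ℚᵘ.≤-respʳ-≃ (ℚᵘ.≃-sym (toℚᵘ-fromℚᵘ (ℚᵘ.mkℚᵘ (+ ℤ.∣ ↥ q ∣) 0)))
      (ℚᵘ.*≤* (begin
        ↥ q ℤ.* + 1              ≡⟨ ℤ.*-identityʳ (↥ q) ⟩
        ↥ q                      ≤⟨ i≤∣i∣ (↥ q) ⟩
        + ℤ.∣ ↥ q ∣              ≡⟨ ℤ.*-identityʳ (+ ℤ.∣ ↥ q ∣) ⟨
        + ℤ.∣ ↥ q ∣ ℤ.* + 1      ≤⟨ ℤ.*-monoˡ-≤-nonNeg (+ ℤ.∣ ↥ q ∣) {+ 1} {↧ q} (ℤ.+≤+ (ℕ.s≤s ℕ.z≤n)) ⟩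
        + ℤ.∣ ↥ q ∣ ℤ.* ↧ q      ∎)))
      where
      open ℤ.≤-Reasoning
      i≤∣i∣ : ∀ i → i ℤ.≤ + ℤ.∣ i ∣
      i≤∣i∣ (+ n)      = ℤ.≤-refl
      i≤∣i∣ ℤ.-[1+ n ] = ℤ.-≤+

  archimedean-* : ∀ {w} q → 0ℚ < w → ∃[ n ] q ≤ ι n * w
  archimedean-* {w} q 0<w =
    let v , 0<v , wv≡1 = divide 0<w 0<1
        n , qv≤n       = archimedean (q * v)
    in n , ≤-trans (≤-reflexive (sym (trans (rearrange q v w) (trans (cong (q *_) wv≡1) (*-identityʳ q)))))
                   (*-monoʳ (<⇒≤ 0<w) qv≤n)
    where
    rearrange : ∀ q v w → q * v * w ≡ q * (w * v)
    rearrange = solve-∀ ℚ-ring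

open Arithmetic

-- Formal polynomial expressions, their derivatives and Taylor's formula.

module Expressions where

  open import Data.Product using (∃-syntax; _×_; _,_; proj₁; proj₂)
  open import Data.Rational
  open import Data.Rational.Properties
  open import Relation.Binary.PropositionalEquality
  open import Relation.Nullary using (yes; no; contradiction)
  open import Tactic.RingSolver using (solve-∀)
  open import Algebra.Properties.Group +-0-group using () renaming (∙-cancelˡ to +-cancelˡ)

  infixl 6 _:+_
  infixl 7 _:*_

  -- Polynomials are handled as formal expressions, so that products and their
  -- derivatives need no normalisation; equality is pointwise on ℚ.
  data Expr : Set where
    var       : Expr
    con       : ℚ → Expr
    _:+_ _:*_ : Expr → Expr → Expr

  ⟦_⟧ : Expr → ℚ → ℚ
  ⟦ var ⟧    x = x
  ⟦ con a ⟧  x = a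
  ⟦ f :+ g ⟧ x = ⟦ f ⟧ x + ⟦ g ⟧ x
  ⟦ f :* g ⟧ x = ⟦ f ⟧ x * ⟦ g ⟧ x

  infix 4 _≈_

  _≈_ : Expr → Expr → Set
  f ≈ g = ∀ x → ⟦ f ⟧ x ≡ ⟦ g ⟧ x

  D : Expr → Expr
  D var      = con 1ℚ
  D (con a)  = con 0ℚ
  D (f :+ g) = D f :+ D g
  D (f :* g) = D f :* g :+ f :* D g

  -- The second-order remainder of Taylor's formula. The clause for products is what remains of the
  -- product of two expansions once the terms of order 0 and 1 are removed and h² is divided out.
  remainder : Expr → ℚ → ℚ → ℚ
  remainder var      x h = 0ℚ
  remainder (con a)  x h = 0ℚ
  remainder (f :+ g) x h = remainder f x h + remainder g x h
  remainder (f :* g) x h =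
    ⟦ f ⟧ x * remainder g x h + ⟦ D f ⟧ x * (⟦ D g ⟧ x + h * remainder g x h)
    + remainder f x h * (⟦ g ⟧ x + h * (⟦ D g ⟧ x + h * remainder g x h))

  taylor : ∀ f x h → ⟦ f ⟧ (x + h) ≡ ⟦ f ⟧ x + h * (⟦ D f ⟧ x + h * remainder f x h)
  taylor var x h = lemma x h
    where
    lemma : ∀ x h → x + h ≡ x + h * (1ℚ + h * 0ℚ)
    lemma = solve-∀ ℚ-ring
  taylor (con a) x h = lemma a h
    where
    lemma : ∀ a h → a ≡ a + h * (0ℚ + h * 0ℚ)
    lemma = solve-∀ ℚ-ring
  taylor (f :+ g) x h = trans (cong₂ _+_ (taylor f x h) (taylor g x h))
    (lemma (⟦ f ⟧ x) (⟦ D f ⟧ x) (remainder f x h) (⟦ g ⟧ x) (⟦ D g ⟧ x) (remainder g x h) h)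
    where
    lemma : ∀ a a′ r b b′ s h →
      a + h * (a′ + h * r) + (b + h * (b′ + h * s)) ≡ a + b + h * (a′ + b′ + h * (r + s))
    lemma = solve-∀ ℚ-ring
  taylor (f :* g) x h = trans (cong₂ _*_ (taylor f x h) (taylor g x h))
    (lemma (⟦ f ⟧ x) (⟦ D f ⟧ x) (remainder f x h) (⟦ g ⟧ x) (⟦ D g ⟧ x) (remainder g x h) h)
    where
    lemma : ∀ a a′ r b b′ s h →
      (a + h * (a′ + h * r)) * (b + h * (b′ + h * s)) ≡
      a * b + h * (a′ * b + a * b′ + h * (a * s + a′ * (b′ + h * s) + r * (b + h * (b′ + h * s))))
    lemma = solve-∀ ℚ-ring

  Bounded : ℚ → (ℚ → ℚ → ℚ) → Set
  Bounded M F = ∃[ C ] ∀ x h → ∣ x ∣ ≤ M → ∣ h ∣ ≤ M → ∣ F x h ∣ ≤ C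

  module _ {M : ℚ} where

    bounded-const : ∀ a → Bounded M λ _ _ → a
    bounded-const a = ∣ a ∣ , λ _ _ _ _ → ≤-refl

    bounded-h : Bounded M λ _ h → h
    bounded-h = M , λ _ _ _ h≤M → h≤M

    bounded-+ : ∀ {F G} → Bounded M F → Bounded M G → Bounded M λ x h → F x h + G x h
    bounded-+ (A , F≤A) (B , G≤B) = A + B , λ x h x≤M h≤M → ∣∣-+ (F≤A x h x≤M h≤M) (G≤B x h x≤M h≤M)

    bounded-* : ∀ {F G} → Bounded M F → Bounded M G → Bounded M λ x h → F x h * G x h
    bounded-* {F} {G} (A , F≤A) (B , G≤B) = A * B , λ x h x≤M h≤M →
      ∣∣-* {F x h} {G x h} (F≤A x h x≤M h≤M) (G≤B x h x≤M h≤M)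

    bounded-⟦⟧ : ∀ f → Bounded M λ x _ → ⟦ f ⟧ x
    bounded-⟦⟧ var      = M , λ _ _ x≤M _ → x≤M
    bounded-⟦⟧ (con a)  = bounded-const a
    bounded-⟦⟧ (f :+ g) = bounded-+ (bounded-⟦⟧ f) (bounded-⟦⟧ g)
    bounded-⟦⟧ (f :* g) = bounded-* (bounded-⟦⟧ f) (bounded-⟦⟧ g)

    bounded-remainder : ∀ f → Bounded M (remainder f)
    bounded-remainder var      = bounded-const 0ℚ
    bounded-remainder (con a)  = bounded-const 0ℚ
    bounded-remainder (f :+ g) = bounded-+ (bounded-remainder f) (bounded-remainder g)
    bounded-remainder (f :* g) =
      bounded-+ (bounded-+ (bounded-* (bounded-⟦⟧ f) (bounded-remainder g))
                           (bounded-* (bounded-⟦⟧ (D f)) slope))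
                (bounded-* (bounded-remainder f) (bounded-+ (bounded-⟦⟧ g) (bounded-* bounded-h slope)))
      where
      slope = bounded-+ (bounded-⟦⟧ (D g)) (bounded-* bounded-h (bounded-remainder g))

  -- If d were nonzero, h = |d| / (2C) would give |d| ≤ |d| / 2. This h is admissible: the
  -- hypothesis at h = 1 yields |d| ≤ C, hence h ≤ 1.
  vanishing : ∀ {d C} → (∀ h → 0ℚ < h → h ≤ 1ℚ → ∣ d ∣ ≤ h * C) → d ≡ 0ℚ
  vanishing {d} {C} small with d ≟ 0ℚ
  ... | yes d≡0 = d≡0
  ... | no  d≢0 = contradiction (≤-<-trans ∣d∣≤½∣d∣ ½∣d∣<∣d∣) (<-irrefl refl)
    where
    0<∣d∣ : 0ℚ < ∣ d ∣
    0<∣d∣ = ∣∣-pos d≢0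
    ∣d∣≤C : ∣ d ∣ ≤ C
    ∣d∣≤C = ≤-trans (small 1ℚ 0<1 ≤-refl) (≤-reflexive (*-identityˡ C))
    0<C : 0ℚ < C
    0<C = <-≤-trans 0<∣d∣ ∣d∣≤C
    0<½∣d∣ : 0ℚ < ½ * ∣ d ∣
    0<½∣d∣ = *-pos (positive⁻¹ ½) 0<∣d∣
    halves : ∀ a → a ≡ ½ * a + ½ * a
    halves = solve-∀ ℚ-ring
    ½∣d∣<∣d∣ : ½ * ∣ d ∣ < ∣ d ∣
    ½∣d∣<∣d∣ = <-offset (halves ∣ d ∣) 0<½∣d∣
    ratio : ∃[ h ] 0ℚ < h × C * h ≡ ½ * ∣ d ∣
    ratio = divide 0<C 0<½∣d∣
    h = proj₁ ratio
    Ch≡ = proj₂ (proj₂ ratio)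
    h≤1 : h ≤ 1ℚ
    h≤1 = *-cancelˡ-≤ 0<C (≤-trans (≤-reflexive Ch≡) (≤-trans (<⇒≤ ½∣d∣<∣d∣)
            (≤-trans ∣d∣≤C (≤-reflexive (sym (*-identityʳ C))))))
    ∣d∣≤½∣d∣ : ∣ d ∣ ≤ ½ * ∣ d ∣
    ∣d∣≤½∣d∣ = ≤-trans (small h (proj₁ (proj₂ ratio)) h≤1) (≤-reflexive (trans (*-comm h C) Ch≡))

  -- `D` acts on syntax, whereas `≈` is pointwise. Comparing the two Taylor expansions at x and
  -- cancelling h shows that the derivatives differ by h times a bounded quantity, for every small h
  -- > 0.
  D-cong : ∀ {f g} → f ≈ g → D f ≈ D g
  D-cong {f} {g} f≈g x = p-q≡0⇒p≡q (vanishing (λ h 0<h h≤1 → slopes h 0<h h≤1))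
    where
    M = 1ℚ + ∣ x ∣
    p-q≡0⇒p≡q : ∀ {p q} → p - q ≡ 0ℚ → p ≡ q
    p-q≡0⇒p≡q {p} {q} eq = trans (lemma p q) (trans (cong (_+ q) eq) (+-identityˡ q))
      where
      lemma : ∀ p q → p ≡ p - q + q
      lemma = solve-∀ ℚ-ring
    bound : Bounded M λ x h → - 1ℚ * remainder f x h + remainder g x h
    bound = bounded-+ (bounded-* (bounded-const (- 1ℚ)) (bounded-remainder f)) (bounded-remainder g)
    slopes : ∀ h → 0ℚ < h → h ≤ 1ℚ → ∣ ⟦ D f ⟧ x - ⟦ D g ⟧ x ∣ ≤ h * proj₁ bound
    slopes h 0<h h≤1 = ≤-trans (≤-reflexive (cong ∣_∣ eq))
      (∣∣-* {h} (≤-reflexive (0≤p⇒∣p∣≡p (<⇒≤ 0<h)))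
        (proj₂ bound x h (≤-offset (+-comm 1ℚ ∣ x ∣) 0≤1)
          (≤-trans (≤-reflexive (0≤p⇒∣p∣≡p (<⇒≤ 0<h))) (≤-trans h≤1 (≤-offset refl (0≤∣p∣ x))))))
      where
      a = ⟦ D f ⟧ x
      b = ⟦ D g ⟧ x
      r = remainder f x h
      s = remainder g x h
      cancelled : a + h * r ≡ b + h * s
      cancelled = *-cancelˡ-≡ 0<h (+-cancelˡ (⟦ f ⟧ x) _ _ (begin
        ⟦ f ⟧ x + h * (a + h * r)  ≡⟨ taylor f x h ⟨
        ⟦ f ⟧ (x + h)              ≡⟨ f≈g (x + h) ⟩
        ⟦ g ⟧ (x + h)              ≡⟨ taylor g x h ⟩
        ⟦ g ⟧ x + h * (b + h * s)  ≡⟨ cong (_+ h * (b + h * s)) (f≈g x) ⟨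
        ⟦ f ⟧ x + h * (b + h * s)  ∎))
        where open ≡-Reasoning
      lemma₁ : ∀ a b h r → a - b ≡ a + h * r - b - h * r
      lemma₁ = solve-∀ ℚ-ring
      lemma₂ : ∀ b h r s → b + h * s - b - h * r ≡ h * (- 1ℚ * r + s)
      lemma₂ = solve-∀ ℚ-ring
      eq : a - b ≡ h * (- 1ℚ * r + s)
      eq = trans (lemma₁ a b h r) (trans (cong (λ t → t - b - h * r) cancelled) (lemma₂ b h r s))

open Expressions

-- Coefficient vectors, division with remainder and ideal generators.

module Division where

  open import Data.Nat as ℕ using (ℕ; zero; suc)
  import Data.Nat.Properties as ℕ
  open import Data.Product using (∃-syntax; _×_; _,_; proj₁; proj₂)
  open import Data.Rational
  open import Data.Rational.Properties
  open import Data.Sum using (_⊎_; inj₁; inj₂)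
  open import Data.Vec using (Vec; []; _∷_)
  open import Induction.WellFounded using (Acc; acc)
  open import Relation.Binary.PropositionalEquality
  open import Relation.Nullary using (yes; no)
  open import Tactic.RingSolver using (solve-∀)

  infixr 8 _:^_

  _:^_ : Expr → ℕ → Expr
  f :^ zero  = con 1ℚ
  f :^ suc k = f :* (f :^ k)

  :^-+ : ∀ f j k → f :^ (j ℕ.+ k) ≈ f :^ j :* f :^ k
  :^-+ f zero    k x = sym (*-identityˡ _)
  :^-+ f (suc j) k x = trans (cong (⟦ f ⟧ x *_) (:^-+ f j k x)) (sym (*-assoc (⟦ f ⟧ x) _ _))

  :^-distrib-* : ∀ f g k → (f :* g) :^ k ≈ f :^ k :* g :^ k
  :^-distrib-* f g zero    x = sym (*-identityˡ 1ℚ)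
  :^-distrib-* f g (suc k) x = trans (cong (⟦ f ⟧ x * ⟦ g ⟧ x *_) (:^-distrib-* f g k x))
    (lemma (⟦ f ⟧ x) (⟦ g ⟧ x) (⟦ f :^ k ⟧ x) (⟦ g :^ k ⟧ x))
    where
    lemma : ∀ a b c d → a * b * (c * d) ≡ a * c * (b * d)
    lemma = solve-∀ ℚ-ring

  :^-cong : ∀ {f g} k → f ≈ g → f :^ k ≈ g :^ k
  :^-cong zero    f≈g x = refl
  :^-cong (suc k) f≈g x = cong₂ _*_ (f≈g x) (:^-cong k f≈g x)

  poly monic : ∀ {n} → Vec ℚ n → Expr

  poly []      = con 0ℚ
  poly (a ∷ v) = con a :+ var :* poly v

  -- monic v has the leading term xⁿ in addition to the coefficients in v.
  monic []      = con 1ℚ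
  monic (a ∷ v) = con a :+ var :* monic v

  Normal : Expr → Set
  Normal f = ∃[ n ] ∃[ v ] f ≈ poly {n} v

  poly-+ : ∀ {m n} (v : Vec ℚ m) (w : Vec ℚ n) → Normal (poly v :+ poly w)
  poly-+ []      w  = _ , w , λ x → +-identityˡ (⟦ poly w ⟧ x)
  poly-+ (a ∷ v) [] = _ , a ∷ v , λ x → +-identityʳ (a + x * ⟦ poly v ⟧ x)
  poly-+ (a ∷ v) (b ∷ w) =
    let _ , u , eq = poly-+ v w
    in _ , a + b ∷ u , λ x → trans (lemma a b x (⟦ poly v ⟧ x) (⟦ poly w ⟧ x))
                                   (cong (λ t → a + b + x * t) (eq x))
    where
    lemma : ∀ a b x v w → a + x * v + (b + x * w) ≡ a + b + x * (v + w)
    lemma = solve-∀ ℚ-ring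

  poly-scale : ∀ {n} c (v : Vec ℚ n) → Normal (con c :* poly v)
  poly-scale c []      = _ , [] , λ x → *-zeroʳ c
  poly-scale c (a ∷ v) =
    let _ , u , eq = poly-scale c v
    in _ , c * a ∷ u , λ x → trans (lemma c a x (⟦ poly v ⟧ x)) (cong (λ t → c * a + x * t) (eq x))
    where
    lemma : ∀ c a x v → c * (a + x * v) ≡ c * a + x * (c * v)
    lemma = solve-∀ ℚ-ring

  poly-* : ∀ {m n} (v : Vec ℚ m) (w : Vec ℚ n) → Normal (poly v :* poly w)
  poly-* []      w = _ , [] , λ x → *-zeroˡ (⟦ poly w ⟧ x)
  poly-* (a ∷ v) w =
    let _ , s , eqₛ = poly-scale a w
        _ , p , eqₚ = poly-* v w
        _ , u , eq  = poly-+ s (0ℚ ∷ p)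
    in _ , u , λ x → begin
         (a + x * ⟦ poly v ⟧ x) * ⟦ poly w ⟧ x                      ≡⟨ lemma a x (⟦ poly v ⟧ x) (⟦ poly w ⟧ x) ⟩
         a * ⟦ poly w ⟧ x + (0ℚ + x * (⟦ poly v ⟧ x * ⟦ poly w ⟧ x))  ≡⟨ cong₂ (λ r t → r + (0ℚ + x * t)) (eqₛ x) (eqₚ x) ⟩
         ⟦ poly s ⟧ x + ⟦ poly (0ℚ ∷ p) ⟧ x                         ≡⟨ eq x ⟩
         ⟦ poly u ⟧ x                                               ∎
    where
    open ≡-Reasoning
    lemma : ∀ a x v w → (a + x * v) * w ≡ a * w + (0ℚ + x * (v * w))
    lemma = solve-∀ ℚ-ring

  normalise : ∀ f → Normal f
  normalise var      = _ , 0ℚ ∷ 1ℚ ∷ [] , lemma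
    where
    lemma : ∀ x → x ≡ 0ℚ + x * (1ℚ + x * 0ℚ)
    lemma = solve-∀ ℚ-ring
  normalise (con a)  = _ , a ∷ [] , lemma a
    where
    lemma : ∀ a x → a ≡ a + x * 0ℚ
    lemma = solve-∀ ℚ-ring
  normalise (f :+ g) =
    let _ , v , eqᶠ = normalise f
        _ , w , eqᵍ = normalise g
        _ , u , eq  = poly-+ v w
    in _ , u , λ x → trans (cong₂ _+_ (eqᶠ x) (eqᵍ x)) (eq x)
  normalise (f :* g) =
    let _ , v , eqᶠ = normalise f
        _ , w , eqᵍ = normalise g
        _ , u , eq  = poly-* v w
    in _ , u , λ x → trans (cong₂ _*_ (eqᶠ x) (eqᵍ x)) (eq x)

  -- The inverse of the leading coefficient is carried along so that later steps need not divide.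
  -- The bound m < n is the drop in degree that the search for an ideal generator recurses on.
  ScaledMonic : ∀ {n} → Vec ℚ n → Set
  ScaledMonic {n} v =
    ∃[ c ] ∃[ c⁻¹ ] c⁻¹ * c ≡ 1ℚ × ∃[ m ] m ℕ.< n × ∃[ w ] poly v ≈ con c :* monic {m} w

  strip : ∀ {n} (v : Vec ℚ n) → poly v ≈ con 0ℚ ⊎ ScaledMonic v
  strip []      = inj₁ λ x → refl
  strip (a ∷ v) = extend (strip v)
    where
    lemma₁ : ∀ c i a x w → a + x * (c * w) ≡ c * (a * i + x * w) + a * (1ℚ - i * c)
    lemma₁ = solve-∀ ℚ-ring
    lemma₂ : ∀ a x → a + x * 0ℚ ≡ a * 1ℚ
    lemma₂ = solve-∀ ℚ-ring
    lemma₃ : ∀ p a → p + a * (1ℚ - 1ℚ) ≡ p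
    lemma₃ = solve-∀ ℚ-ring
    extend : poly v ≈ con 0ℚ ⊎ ScaledMonic v → poly (a ∷ v) ≈ con 0ℚ ⊎ ScaledMonic (a ∷ v)
    extend (inj₂ (c , i , ic≡1 , m , m<n , w , eq)) =
      inj₂ (c , i , ic≡1 , suc m , ℕ.s≤s m<n , a * i ∷ w , λ x → begin
        a + x * ⟦ poly v ⟧ x                                          ≡⟨ cong (λ t → a + x * t) (eq x) ⟩
        a + x * (c * ⟦ monic w ⟧ x)                                   ≡⟨ lemma₁ c i a x (⟦ monic w ⟧ x) ⟩
        c * (a * i + x * ⟦ monic w ⟧ x) + a * (1ℚ - i * c)            ≡⟨ cong (λ t → c * (a * i + x * ⟦ monic w ⟧ x) + a * (1ℚ - t)) ic≡1 ⟩
        c * (a * i + x * ⟦ monic w ⟧ x) + a * (1ℚ - 1ℚ)               ≡⟨ lemma₃ _ a ⟩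
        c * (a * i + x * ⟦ monic w ⟧ x)                               ∎)
      where open ≡-Reasoning
    extend (inj₁ v≈0) with a ≟ 0ℚ
    ... | yes a≡0 = inj₁ λ x → trans (cong₂ (λ s t → s + x * t) a≡0 (v≈0 x)) (trans (+-identityˡ _) (*-zeroʳ x))
    ... | no  a≢0 = inj₂ (a , (1/ a) {{≢-nonZero a≢0}} , *-inverseˡ a {{≢-nonZero a≢0}} , 0 , ℕ.s≤s ℕ.z≤n , [] ,
                          λ x → trans (cong (λ t → a + x * t) (v≈0 x)) (lemma₂ a x))

  -- One step of long division: `t` is the top coefficient of `w`, and subtracting `t` times
  -- `monic G` removes it.
  reduce : ∀ {n} (w : Vec ℚ (suc n)) (G : Vec ℚ n) →
    ∃[ t ] ∃[ r ] poly w ≈ con t :* monic G :+ poly {n} r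
  reduce (t ∷ []) []      = t , [] , lemma t
    where
    lemma : ∀ t x → t + x * 0ℚ ≡ t * 1ℚ + 0ℚ
    lemma = solve-∀ ℚ-ring
  reduce (a ∷ w)  (b ∷ G) =
    let t , r , eq = reduce w G
    in t , a - t * b ∷ r , λ x → trans (cong (λ p → a + x * p) (eq x))
                                       (lemma a b t x (⟦ monic G ⟧ x) (⟦ poly r ⟧ x))
    where
    lemma : ∀ a b t x g r → a + x * (t * g + r) ≡ t * (b + x * g) + (a - t * b + x * r)
    lemma = solve-∀ ℚ-ring

  monic-minus-monic : ∀ {n} (P G : Vec ℚ n) → ∃[ r ] monic P ≈ con 1ℚ :* monic G :+ poly {n} r
  monic-minus-monic []      []      = [] , λ x → refl
  monic-minus-monic (a ∷ P) (b ∷ G) =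
    let r , eq = monic-minus-monic P G
    in a - b ∷ r , λ x → trans (cong (λ p → a + x * p) (eq x)) (lemma a b x (⟦ monic G ⟧ x) (⟦ poly r ⟧ x))
    where
    lemma : ∀ a b x g r → a + x * (1ℚ * g + r) ≡ 1ℚ * (b + x * g) + (a - b + x * r)
    lemma = solve-∀ ℚ-ring

  -- A monic dividend has a monic quotient of known degree k. The recursion that builds radicals
  -- descends into this quotient, so its degree has to be visible in the type.
  divideMonic : ∀ k {g n} → k ℕ.+ g ≡ n → (P : Vec ℚ n) (G : Vec ℚ g) →
    ∃[ q ] ∃[ r ] monic P ≈ monic {k} q :* monic G :+ poly {g} r
  divideMonic zero    refl P       G = let r , eq = monic-minus-monic P G in [] , r , eq
  divideMonic (suc k) refl (a ∷ P) G =
    let q , r , eq  = divideMonic k refl P G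
        t , s , eq′ = reduce (a ∷ r) G
    in t ∷ q , s , λ x →
       trans (cong (λ p → a + x * p) (eq x))
      (trans (lemma₁ a x (⟦ monic q ⟧ x) (⟦ monic G ⟧ x) (⟦ poly r ⟧ x))
      (trans (cong (x * (⟦ monic q ⟧ x * ⟦ monic G ⟧ x) +_) (eq′ x))
             (lemma₂ t x (⟦ monic q ⟧ x) (⟦ monic G ⟧ x) (⟦ poly s ⟧ x))))
    where
    lemma₁ : ∀ a x q g r → a + x * (q * g + r) ≡ x * (q * g) + (a + x * r)
    lemma₁ = solve-∀ ℚ-ring
    lemma₂ : ∀ t x q g s → x * (q * g) + (t * g + s) ≡ (t + x * q) * g + s
    lemma₂ = solve-∀ ℚ-ring

  dividePoly : ∀ {n g} (P : Vec ℚ n) (G : Vec ℚ g) →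
    ∃[ q ] ∃[ r ] poly P ≈ q :* monic G :+ poly {g} r
  dividePoly {g = g} [] G = con 0ℚ , zeros g , λ x → sym (trans (cong₂ _+_ (*-zeroˡ (⟦ monic G ⟧ x)) (zeros≈0 g x)) (+-identityˡ 0ℚ))
    where
    zeros : ∀ n → Vec ℚ n
    zeros zero    = []
    zeros (suc n) = 0ℚ ∷ zeros n
    zeros≈0 : ∀ n → poly (zeros n) ≈ con 0ℚ
    zeros≈0 zero    x = refl
    zeros≈0 (suc n) x = trans (cong (λ t → 0ℚ + x * t) (zeros≈0 n x)) (trans (+-identityˡ _) (*-zeroʳ x))
  dividePoly (a ∷ P) G =
    let q , r , eq  = dividePoly P G
        t , s , eq′ = reduce (a ∷ r) G
    in con t :+ var :* q , s , λ x →
       trans (cong (λ p → a + x * p) (eq x))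
      (trans (lemma₁ a x (⟦ q ⟧ x) (⟦ monic G ⟧ x) (⟦ poly r ⟧ x))
      (trans (cong (x * (⟦ q ⟧ x * ⟦ monic G ⟧ x) +_) (eq′ x))
             (lemma₂ t x (⟦ q ⟧ x) (⟦ monic G ⟧ x) (⟦ poly s ⟧ x))))
    where
    lemma₁ : ∀ a x q g r → a + x * (q * g + r) ≡ x * (q * g) + (a + x * r)
    lemma₁ = solve-∀ ℚ-ring
    lemma₂ : ∀ t x q g s → x * (q * g) + (t * g + s) ≡ (t + x * q) * g + s
    lemma₂ = solve-∀ ℚ-ring

  InIdeal : Expr → Expr → Expr → Set
  InIdeal P Q G = ∃[ X ] ∃[ Y ] G ≈ X :* P :+ Y :* Q

  -- An element of minimal degree of the ideal (P, Q) divides P and Q: otherwise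
  -- the remainder of a division by it has smaller degree.
  idealGenerator : ∀ {n m} (P : Vec ℚ n) (Q : Vec ℚ m) {g} (G : Vec ℚ g) → Acc ℕ._<_ g →
    g ℕ.≤ n → InIdeal (monic P) (poly Q) (monic G) →
    ∃[ g′ ] g′ ℕ.≤ g × ∃[ G′ ] InIdeal (monic P) (poly Q) (monic {g′} G′) ×
    (∃[ k ] k ℕ.+ g′ ≡ n × ∃[ q ] monic P ≈ monic {k} q :* monic G′) ×
    (∃[ q ] poly Q ≈ q :* monic G′)
  idealGenerator {n} P Q {g} G (acc rec) g≤n ideal@(X , Y , eqᴳ) =
    test (strip r) (strip s)
    where
    k = n ℕ.∸ g
    divP = divideMonic k (ℕ.m∸n+n≡m g≤n) P G
    divQ = dividePoly Q G
    q = proj₁ divP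
    r = proj₁ (proj₂ divP)
    p = proj₁ divQ
    s = proj₁ (proj₂ divQ)

    Goal = ∃[ g′ ] g′ ℕ.≤ g × ∃[ G′ ] InIdeal (monic P) (poly Q) (monic {g′} G′) ×
      (∃[ k ] k ℕ.+ g′ ≡ n × ∃[ q ] monic P ≈ monic {k} q :* monic G′) ×
      (∃[ q ] poly Q ≈ q :* monic G′)

    continue : ∀ {v : Vec ℚ g} {A B} → poly v ≈ A :* monic P :+ B :* poly Q → ScaledMonic v → Goal
    continue {v} {A} {B} eqᵛ (c , i , ic≡1 , m , m<g , w , eqʷ) =
      let g′ , g′≤m , rest = idealGenerator P Q w (rec m<g) (ℕ.≤-trans (ℕ.<⇒≤ m<g) g≤n)
                               (con i :* A , con i :* B , λ x → begin
               ⟦ monic w ⟧ x             ≡⟨ *-identityˡ _ ⟨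
               1ℚ * ⟦ monic w ⟧ x        ≡⟨ cong (_* ⟦ monic w ⟧ x) ic≡1 ⟨
               i * c * ⟦ monic w ⟧ x     ≡⟨ *-assoc i c _ ⟩
               i * (c * ⟦ monic w ⟧ x)   ≡⟨ cong (i *_) (trans (sym (eqʷ x)) (eqᵛ x)) ⟩
               i * (⟦ A ⟧ x * ⟦ monic P ⟧ x + ⟦ B ⟧ x * ⟦ poly Q ⟧ x)
                                         ≡⟨ lemma i (⟦ A ⟧ x) (⟦ monic P ⟧ x) (⟦ B ⟧ x) (⟦ poly Q ⟧ x) ⟩
               i * ⟦ A ⟧ x * ⟦ monic P ⟧ x + i * ⟦ B ⟧ x * ⟦ poly Q ⟧ x ∎)
      in g′ , ℕ.≤-trans g′≤m (ℕ.<⇒≤ m<g) , rest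
      where
      open ≡-Reasoning
      lemma : ∀ i a p b q → i * (a * p + b * q) ≡ i * a * p + i * b * q
      lemma = solve-∀ ℚ-ring

    solved : ∀ a b g r → a ≡ b * g + r → r ≡ a - b * g
    solved a b g r eq = trans (lemma (b * g) r) (cong (_- b * g) (sym eq))
      where
      lemma : ∀ t r → r ≡ t + r - t
      lemma = solve-∀ ℚ-ring

    test : poly r ≈ con 0ℚ ⊎ ScaledMonic r → poly s ≈ con 0ℚ ⊎ ScaledMonic s → Goal
    -- The remainder P - q G is again in the ideal, by substituting G = X P + Y Q; made monic, it
    -- replaces G.
    test (inj₂ nz)  _          = continue {r} {con 1ℚ :+ con (- 1ℚ) :* (monic q :* X)} {con (- 1ℚ) :* (monic q :* Y)}
      (λ x → trans (solved (⟦ monic P ⟧ x) (⟦ monic q ⟧ x) (⟦ monic G ⟧ x) _ (proj₂ (proj₂ divP) x))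
               (trans (cong (λ t → ⟦ monic P ⟧ x - ⟦ monic q ⟧ x * t) (eqᴳ x))
                 (lemma (⟦ monic P ⟧ x) (⟦ poly Q ⟧ x) (⟦ X ⟧ x) (⟦ Y ⟧ x) (⟦ monic q ⟧ x)))) nz
      where
      lemma : ∀ a b x y q → a - q * (x * a + y * b) ≡ (1ℚ + - 1ℚ * (q * x)) * a + - 1ℚ * (q * y) * b
      lemma = solve-∀ ℚ-ring
    test (inj₁ r≈0) (inj₂ nz)  = continue {s} {con (- 1ℚ) :* (p :* X)} {con 1ℚ :+ con (- 1ℚ) :* (p :* Y)}
      (λ x → trans (solved (⟦ poly Q ⟧ x) (⟦ p ⟧ x) (⟦ monic G ⟧ x) _ (proj₂ (proj₂ divQ) x))
               (trans (cong (λ t → ⟦ poly Q ⟧ x - ⟦ p ⟧ x * t) (eqᴳ x))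
                 (lemma (⟦ monic P ⟧ x) (⟦ poly Q ⟧ x) (⟦ X ⟧ x) (⟦ Y ⟧ x) (⟦ p ⟧ x)))) nz
      where
      lemma : ∀ a b x y q → b - q * (x * a + y * b) ≡ - 1ℚ * (q * x) * a + (1ℚ + - 1ℚ * (q * y)) * b
      lemma = solve-∀ ℚ-ring
    test (inj₁ r≈0) (inj₁ s≈0) = g , ℕ.≤-refl , G , ideal
      , (k , ℕ.m∸n+n≡m g≤n , q , λ x → trans (proj₂ (proj₂ divP) x) (trans (cong (⟦ monic q :* monic G ⟧ x +_) (r≈0 x)) (+-identityʳ (⟦ monic q :* monic G ⟧ x))))
      , (p , λ x → trans (proj₂ (proj₂ divQ) x) (trans (cong (⟦ p :* monic G ⟧ x +_) (s≈0 x)) (+-identityʳ (⟦ p :* monic G ⟧ x))))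

open Division

-- Coprimality, square-free polynomials and radicals.

module Radicals where

  open import Data.Nat as ℕ using (ℕ; zero; suc)
  import Data.Nat.Properties as ℕ
  open import Data.Nat.Induction using (<-wellFounded)
  open import Data.Product using (∃-syntax; _×_; _,_; proj₁; proj₂)
  open import Data.Rational
  open import Data.Rational.Properties
  open import Data.Sum using (_⊎_; inj₁; inj₂)
  open import Data.Vec using (Vec; []; _∷_)
  open import Induction.WellFounded using (Acc; acc)
  open import Relation.Binary.PropositionalEquality
  open import Tactic.RingSolver using (solve-∀)

  -- Encoded as a Bézout identity: it needs no factorisation, and on [0, 1], where the cofactors are
  -- bounded, it keeps one of the two values away from 0.
  Coprime : Expr → Expr → Set
  Coprime f g = ∃[ a ] ∃[ b ] a :* f :+ b :* g ≈ con 1ℚ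

  coprime-sym : ∀ {f g} → Coprime f g → Coprime g f
  coprime-sym {f} {g} (a , b , eq) = b , a , λ x → trans (+-comm (⟦ b :* g ⟧ x) (⟦ a :* f ⟧ x)) (eq x)

  coprime-congʳ : ∀ {f g h} → g ≈ h → Coprime f g → Coprime f h
  coprime-congʳ {f} g≈h (a , b , eq) = a , b , λ x →
    trans (cong (λ t → ⟦ a ⟧ x * ⟦ f ⟧ x + ⟦ b ⟧ x * t) (sym (g≈h x))) (eq x)

  -- In the product of the two Bézout identities every term except b d g h contains f.
  coprime-* : ∀ {f g h} → Coprime f g → Coprime f h → Coprime f (g :* h)
  coprime-* {f} {g} {h} (a , b , eq) (c , d , eq′) =
    a :* c :* f :+ a :* d :* h :+ b :* g :* c , b :* d , λ x →
    trans (lemma (⟦ a ⟧ x) (⟦ b ⟧ x) (⟦ c ⟧ x) (⟦ d ⟧ x) (⟦ f ⟧ x) (⟦ g ⟧ x) (⟦ h ⟧ x))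
          (trans (cong₂ _*_ (eq x) (eq′ x)) (*-identityˡ 1ℚ))
    where
    lemma : ∀ a b c d f g h →
      (a * c * f + a * d * h + b * g * c) * f + b * d * (g * h) ≡ (a * f + b * g) * (c * f + d * h)
    lemma = solve-∀ ℚ-ring

  coprime-+-multiple : ∀ {f g} m → Coprime f g → Coprime f (g :+ f :* m)
  coprime-+-multiple {f} {g} m (a , b , eq) = a :+ con (- 1ℚ) :* (b :* m) , b , λ x →
    trans (lemma (⟦ a ⟧ x) (⟦ b ⟧ x) (⟦ f ⟧ x) (⟦ g ⟧ x) (⟦ m ⟧ x)) (eq x)
    where
    lemma : ∀ a b f g m → (a + - 1ℚ * (b * m)) * f + b * (g + f * m) ≡ a * f + b * g
    lemma = solve-∀ ℚ-ring

  SquareFree : Expr → Set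
  SquareFree f = Coprime f (D f)

  squareFree-cong : ∀ {f g} → f ≈ g → SquareFree f → SquareFree g
  squareFree-cong {f} {g} f≈g sf =
    coprime-sym {D g} {g} (coprime-congʳ {D g} {f} {g} f≈g
      (coprime-sym {f} {D g} (coprime-congʳ {f} {D f} {D g} (D-cong {f} {g} f≈g) sf)))

  -- By the product rule the Bézout identity for `g :* h` can be regrouped: collecting at h and h′
  -- gives this lemma, collecting at g and h the next one.
  squareFree-factorʳ : ∀ g h → SquareFree (g :* h) → SquareFree h
  squareFree-factorʳ g h (a , b , eq) = a :* g :+ b :* D g , b :* g , λ x →
    trans (lemma (⟦ a ⟧ x) (⟦ b ⟧ x) (⟦ g ⟧ x) (⟦ D g ⟧ x) (⟦ h ⟧ x) (⟦ D h ⟧ x)) (eq x)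
    where
    lemma : ∀ a b g g′ h h′ → (a * g + b * g′) * h + b * g * h′ ≡ a * (g * h) + b * (g′ * h + g * h′)
    lemma = solve-∀ ℚ-ring

  squareFree-factors-coprime : ∀ g h → SquareFree (g :* h) → Coprime g h
  squareFree-factors-coprime g h (a , b , eq) = b :* D h , a :* g :+ b :* D g , λ x →
    trans (lemma (⟦ a ⟧ x) (⟦ b ⟧ x) (⟦ g ⟧ x) (⟦ D g ⟧ x) (⟦ h ⟧ x) (⟦ D h ⟧ x)) (eq x)
    where
    lemma : ∀ a b g g′ h h′ → b * h′ * g + (a * g + b * g′) * h ≡ a * (g * h) + b * (g′ * h + g * h′)
    lemma = solve-∀ ℚ-ring

  -- Modulo f the derivative of f g is f′ g, a product of two polynomials coprime to f; likewise
  -- modulo g. Both factors are thus coprime to the derivative, and so is their product.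
  squareFree-* : ∀ f g → Coprime f g → SquareFree f → SquareFree g → SquareFree (f :* g)
  squareFree-* f g f⊥g sf sg =
    coprime-sym {D (f :* g)} {f :* g} (coprime-* {D (f :* g)} {f} {g}
      (coprime-sym {f} {D (f :* g)}
        (coprime-+-multiple {f} {D f :* g} (D g) (coprime-* {f} {D f} {g} sf f⊥g)))
      (coprime-sym {g} {D (f :* g)}
        (coprime-congʳ {g} {f :* D g :+ g :* D f} {D (f :* g)} swap
          (coprime-+-multiple {g} {f :* D g} (D f)
            (coprime-* {g} {f} {D g} (coprime-sym {f} {g} f⊥g) sg)))))
    where
    lemma : ∀ f f′ g g′ → f * g′ + g * f′ ≡ f′ * g + f * g′
    lemma = solve-∀ ℚ-ring
    swap : f :* D g :+ g :* D f ≈ D (f :* g)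
    swap x = lemma (⟦ f ⟧ x) (⟦ D f ⟧ x) (⟦ g ⟧ x) (⟦ D g ⟧ x)

  GCD : Expr → Expr → Set
  GCD f g = ∃[ d ] InIdeal f g d × (∃[ a ] f ≈ a :* d) × (∃[ b ] g ≈ b :* d)

  gcd : ∀ f g → GCD f g
  gcd f g = search (strip v)
    where
    v = proj₁ (proj₂ (normalise f))
    f≈v = proj₂ (proj₂ (normalise f))
    w = proj₁ (proj₂ (normalise g))
    g≈w = proj₂ (proj₂ (normalise g))
    search : poly v ≈ con 0ℚ ⊎ ScaledMonic v → GCD f g
    search (inj₁ v≈0) = g , (con 0ℚ , con 1ℚ , λ x → lemma₁ (⟦ f ⟧ x) (⟦ g ⟧ x))
      , (con 0ℚ , λ x → trans (f≈v x) (trans (v≈0 x) (sym (*-zeroˡ (⟦ g ⟧ x)))))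
      , (con 1ℚ , λ x → sym (*-identityˡ (⟦ g ⟧ x)))
      where
      lemma₁ : ∀ f g → g ≡ 0ℚ * f + 1ℚ * g
      lemma₁ = solve-∀ ℚ-ring
    search (inj₂ (c , i , ic≡1 , m , _ , u , v≈cu)) = 
      let _ , _ , G , (X , Y , G≈) , (_ , _ , a , u≈) , (b , w≈) =
            idealGenerator u w u (<-wellFounded m) ℕ.≤-refl (con 1ℚ , con 0ℚ , λ x → lemma₁ (⟦ monic u ⟧ x) (⟦ poly w ⟧ x))
      in monic G
       , (X :* con i , Y , λ x → trans (G≈ x) (cong₂ _+_
            (trans (cong (⟦ X ⟧ x *_) (u≈if x)) (sym (*-assoc (⟦ X ⟧ x) i (⟦ f ⟧ x))))
            (cong (⟦ Y ⟧ x *_) (sym (g≈w x)))))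
       , (con c :* monic a , λ x → trans (f≈v x) (trans (v≈cu x) (trans (cong (c *_) (u≈ x)) (sym (*-assoc c (⟦ monic a ⟧ x) (⟦ monic G ⟧ x))))))
       , (b , λ x → trans (g≈w x) (w≈ x))
      where
      lemma₁ : ∀ f g → f ≡ 1ℚ * f + 0ℚ * g
      lemma₁ = solve-∀ ℚ-ring
      u≈if : monic u ≈ con i :* f
      u≈if x = begin
        ⟦ monic u ⟧ x            ≡⟨ *-identityˡ _ ⟨
        1ℚ * ⟦ monic u ⟧ x       ≡⟨ cong (_* ⟦ monic u ⟧ x) ic≡1 ⟨
        i * c * ⟦ monic u ⟧ x    ≡⟨ *-assoc i c _ ⟩
        i * (c * ⟦ monic u ⟧ x)  ≡⟨ cong (i *_) (v≈cu x) ⟨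
        i * ⟦ poly v ⟧ x         ≡⟨ cong (i *_) (f≈v x) ⟨
        i * ⟦ f ⟧ x              ∎
        where open ≡-Reasoning

  -- S vanishes at every root of P, but only to first order.
  Radical : Expr → Set
  Radical P = ∃[ S ] SquareFree S × ∃[ U ] ∃[ k ] P :* U ≈ S :^ k

  radical-cong : ∀ {P Q} → P ≈ Q → Radical Q → Radical P
  radical-cong P≈Q (S , sf , U , k , eq) = S , sf , U , k , λ x → trans (cong (_* ⟦ U ⟧ x) (P≈Q x)) (eq x)

  radical-scale : ∀ {c i P} → i * c ≡ 1ℚ → Radical P → Radical (con c :* P)
  radical-scale {c} {i} {P} ic≡1 (S , sf , U , k , eq) = S , sf , con i :* U , k , λ x →
    trans (lemma i c (⟦ P ⟧ x) (⟦ U ⟧ x)) (trans (cong₂ _*_ ic≡1 (eq x)) (*-identityˡ (⟦ S :^ k ⟧ x)))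
    where
    lemma : ∀ i c p u → c * p * (i * u) ≡ i * c * (p * u)
    lemma = solve-∀ ℚ-ring

  -- With d the gcd of the two radicals S and T and T = b d, the radical of the
  -- product is S b.
  radical-* : ∀ {P Q} → Radical P → Radical Q → Radical (P :* Q)
  radical-* {P} {Q} (S , sfS , U , j , eqᴾ) (T , sfT , V , k , eqꟴ) =
    let d , (X , Y , d≈) , (a , S≈) , (b , T≈) = gcd S T
        sf-bd = squareFree-cong {T} {b :* d} T≈ sfT
        α , β , eq = squareFree-factors-coprime b d sf-bd
        -- Substitute d = X S + Y b d in α b + β d = 1.
        S⊥b : Coprime S b
        S⊥b = β :* X , α :+ β :* Y :* d , λ x →
          trans (lemma₁ (⟦ α ⟧ x) (⟦ β ⟧ x) (⟦ X ⟧ x) (⟦ Y ⟧ x) (⟦ S ⟧ x) (⟦ b ⟧ x) (⟦ d ⟧ x))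
         (trans (cong (λ t → ⟦ α ⟧ x * ⟦ b ⟧ x + ⟦ β ⟧ x * (⟦ X ⟧ x * ⟦ S ⟧ x + ⟦ Y ⟧ x * t)) (sym (T≈ x)))
         (trans (cong (λ t → ⟦ α ⟧ x * ⟦ b ⟧ x + ⟦ β ⟧ x * t) (sym (d≈ x))) (eq x)))
        sf-b : SquareFree b
        sf-b = squareFree-factorʳ d b (squareFree-cong {b :* d} {d :* b} (λ x → *-comm (⟦ b ⟧ x) (⟦ d ⟧ x)) sf-bd)
    in S :* b , squareFree-* S b S⊥b sfS sf-b
     -- The factor bʲ turns P U = Sʲ into (S b)ʲ, and aᵏ turns Q V = Tᵏ into (a T)ᵏ, where a T = a b
     -- d = S b.
     , U :* V :* (b :^ j) :* (a :^ k) , j ℕ.+ k , λ x → begin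
       ⟦ P ⟧ x * ⟦ Q ⟧ x * (⟦ U ⟧ x * ⟦ V ⟧ x * ⟦ b :^ j ⟧ x * ⟦ a :^ k ⟧ x)
         ≡⟨ lemma₂ (⟦ P ⟧ x) (⟦ Q ⟧ x) (⟦ U ⟧ x) (⟦ V ⟧ x) (⟦ b :^ j ⟧ x) (⟦ a :^ k ⟧ x) ⟩
       ⟦ P ⟧ x * ⟦ U ⟧ x * ⟦ b :^ j ⟧ x * (⟦ a :^ k ⟧ x * (⟦ Q ⟧ x * ⟦ V ⟧ x))
         ≡⟨ cong₂ (λ s t → s * ⟦ b :^ j ⟧ x * (⟦ a :^ k ⟧ x * t)) (eqᴾ x) (eqꟴ x) ⟩
       ⟦ S :^ j ⟧ x * ⟦ b :^ j ⟧ x * (⟦ a :^ k ⟧ x * ⟦ T :^ k ⟧ x)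
         ≡⟨ cong₂ _*_ (:^-distrib-* S b j x) (:^-distrib-* a T k x) ⟨
       ⟦ (S :* b) :^ j ⟧ x * ⟦ (a :* T) :^ k ⟧ x
         ≡⟨ cong (⟦ (S :* b) :^ j ⟧ x *_) (:^-cong {a :* T} {S :* b} k (λ y →
              trans (cong (⟦ a ⟧ y *_) (T≈ y)) (trans (lemma₃ (⟦ a ⟧ y) (⟦ b ⟧ y) (⟦ d ⟧ y)) (cong (_* ⟦ b ⟧ y) (sym (S≈ y))))) x) ⟩
       ⟦ (S :* b) :^ j ⟧ x * ⟦ (S :* b) :^ k ⟧ x
         ≡⟨ :^-+ (S :* b) j k x ⟨
       ⟦ (S :* b) :^ (j ℕ.+ k) ⟧ x ∎
    where
    open ≡-Reasoning
    lemma₁ : ∀ α β X Y S b d → β * X * S + (α + β * Y * d) * b ≡ α * b + β * (X * S + Y * (b * d))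
    lemma₁ = solve-∀ ℚ-ring
    lemma₂ : ∀ P Q U V b a → P * Q * (U * V * b * a) ≡ P * U * b * (a * (Q * V))
    lemma₂ = solve-∀ ℚ-ring
    lemma₃ : ∀ a b d → a * (b * d) ≡ a * d * b
    lemma₃ = solve-∀ ℚ-ring

  -- Serves to differentiate x v: in v + x v′ the two summands have the same degree, with leading
  -- coefficients 1 and the degree of v.
  monic-combination : ∀ {n α β γ γ⁻¹} → α + β ≡ γ → γ * γ⁻¹ ≡ 1ℚ → (u v : Vec ℚ n) →
    ∃[ w ] con α :* monic u :+ con β :* monic v ≈ con γ :* monic {n} w
  monic-combination {α = α} {β} refl _ [] [] = [] , λ x → sym (*-distribʳ-+ 1ℚ α β)
  monic-combination {α = α} {β} {γ} {γ⁻¹} α+β≡γ γγ⁻¹≡1 (a ∷ u) (b ∷ v) =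
    let w , eq = monic-combination {α = α} {β} α+β≡γ γγ⁻¹≡1 u v
    in γ⁻¹ * (α * a + β * b) ∷ w , λ x → begin
      α * (a + x * ⟦ monic u ⟧ x) + β * (b + x * ⟦ monic v ⟧ x)
        ≡⟨ lemma₁ α a β b x (⟦ monic u ⟧ x) (⟦ monic v ⟧ x) ⟩
      1ℚ * (α * a + β * b) + x * (α * ⟦ monic u ⟧ x + β * ⟦ monic v ⟧ x)
        ≡⟨ cong₂ (λ s t → s * (α * a + β * b) + x * t) (sym γγ⁻¹≡1) (eq x) ⟩
      γ * γ⁻¹ * (α * a + β * b) + x * (γ * ⟦ monic w ⟧ x)
        ≡⟨ lemma₂ γ γ⁻¹ (α * a + β * b) x (⟦ monic w ⟧ x) ⟩
      γ * (γ⁻¹ * (α * a + β * b) + x * ⟦ monic w ⟧ x) ∎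
    where
    open ≡-Reasoning
    lemma₁ : ∀ α a β b x u v → α * (a + x * u) + β * (b + x * v) ≡ 1ℚ * (α * a + β * b) + x * (α * u + β * v)
    lemma₁ = solve-∀ ℚ-ring
    lemma₂ : ∀ γ i s x w → γ * i * s + x * (γ * w) ≡ γ * (i * s + x * w)
    lemma₂ = solve-∀ ℚ-ring

  D-monic : ∀ {n} (v : Vec ℚ (suc n)) → ∃[ w ] D (monic v) ≈ con (ι (suc n)) :* monic {n} w
  D-monic (a ∷ [])    = [] , λ x → trans (lemma x) (cong (_* 1ℚ) (sym ι-1))
    where
    lemma : ∀ x → 0ℚ + (1ℚ * 1ℚ + x * 0ℚ) ≡ 1ℚ * 1ℚ
    lemma = solve-∀ ℚ-ring
  D-monic {suc n} (a ∷ v@(_ ∷ _)) =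
    let w , eq     = D-monic v
        i , _ , inv = divide (0<ι (suc n)) 0<1
        u , eq′    = monic-combination {α = 1ℚ} {ι (suc n)} (sym (ι-suc (suc n))) inv v (0ℚ ∷ w)
    in u , λ x → trans (cong (λ t → 0ℚ + (1ℚ * ⟦ monic v ⟧ x + x * t)) (eq x))
                (trans (lemma x (⟦ monic v ⟧ x) (ι (suc n)) (⟦ monic w ⟧ x)) (eq′ x))
    where
    lemma : ∀ x v c w → 0ℚ + (1ℚ * v + x * (c * w)) ≡ 1ℚ * v + c * (0ℚ + x * w)
    lemma = solve-∀ ℚ-ring

  -- If G = gcd(P, P′) is constant, then P is square-free; otherwise both G and
  -- P / G have smaller degree than P.
  radical-monic : ∀ {n} (P : Vec ℚ n) → Acc ℕ._<_ n → Radical (monic P)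
  radical-monic []        _         = con 1ℚ , (con 1ℚ , con 0ℚ , λ x → refl) , con 1ℚ , 0 , λ x → refl
  radical-monic {suc n} P (acc rec) =
    -- Starting from P′ made monic, of degree n, bounds the degree of the generator by n, as the
    -- recursive call on G requires.
    split (idealGenerator P w d (<-wellFounded n) (ℕ.n≤1+n n) (con 0ℚ , con i , d∈ideal))
    where
    c = ι (suc n)
    i = proj₁ (divide (0<ι n) 0<1)
    inv = proj₂ (proj₂ (divide (0<ι n) 0<1))
    d = proj₁ (D-monic P)
    D≈ = proj₂ (D-monic P)
    w = proj₁ (proj₂ (normalise (D (monic P))))
    D≈w = proj₂ (proj₂ (normalise (D (monic P))))
    lemma : ∀ c i p m → c * i * m ≡ 0ℚ * p + i * (c * m)
    lemma = solve-∀ ℚ-ring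
    d∈ideal : monic d ≈ con 0ℚ :* monic P :+ con i :* poly w
    d∈ideal x = begin
      ⟦ monic d ⟧ x                                 ≡⟨ *-identityˡ (⟦ monic d ⟧ x) ⟨
      1ℚ * ⟦ monic d ⟧ x                            ≡⟨ cong (_* ⟦ monic d ⟧ x) inv ⟨
      c * i * ⟦ monic d ⟧ x                         ≡⟨ lemma c i (⟦ monic P ⟧ x) (⟦ monic d ⟧ x) ⟩
      0ℚ * ⟦ monic P ⟧ x + i * (c * ⟦ monic d ⟧ x)  ≡⟨ cong (λ t → 0ℚ * ⟦ monic P ⟧ x + i * t) (trans (sym (D≈ x)) (D≈w x)) ⟩
      0ℚ * ⟦ monic P ⟧ x + i * ⟦ poly w ⟧ x         ∎
      where open ≡-Reasoning
    split : (∃[ g ] g ℕ.≤ n × ∃[ G ] InIdeal (monic P) (poly w) (monic {g} G) ×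
              (∃[ k ] k ℕ.+ g ≡ suc n × ∃[ q ] monic P ≈ monic {k} q :* monic G) ×
              (∃[ q ] poly w ≈ q :* monic G)) → Radical (monic P)
    -- A monic generator of degree 0 is the constant 1, so its membership in the ideal is the Bézout
    -- identity of P and P′.
    split (zero , _ , [] , (X , Y , eq) , _) =
      monic P , (X , Y , λ x → trans (cong (λ t → ⟦ X ⟧ x * ⟦ monic P ⟧ x + ⟦ Y ⟧ x * t) (D≈w x)) (sym (eq x)))
      , con 1ℚ , 1 , λ x → refl
    split (suc g , g<n , G , _ , (k , k+g≡n , q , eq) , _) =
      radical-cong {monic P} {monic q :* monic G} eq
        (radical-* {monic q} {monic G}
          (radical-monic q (rec (ℕ.≤-trans (ℕ.m<m+n k (ℕ.s≤s ℕ.z≤n)) (ℕ.≤-reflexive k+g≡n))))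
          (radical-monic G (rec (ℕ.s≤s g<n))))

  radical : ∀ f → f ≈ con 0ℚ ⊎ Radical f
  radical f = from-strip (strip v)
    where
    v = proj₁ (proj₂ (normalise f))
    f≈v = proj₂ (proj₂ (normalise f))
    from-strip : poly v ≈ con 0ℚ ⊎ ScaledMonic v → f ≈ con 0ℚ ⊎ Radical f
    from-strip (inj₁ v≈0) = inj₁ λ x → trans (f≈v x) (v≈0 x)
    from-strip (inj₂ (c , i , ic≡1 , m , _ , u , v≈cu)) =
      inj₂ (radical-cong {f} {con c :* monic u} (λ x → trans (f≈v x) (v≈cu x))
             (radical-scale {c} {i} {monic u} ic≡1 (radical-monic u (<-wellFounded m))))

open Radicals

-- Uniform estimates on [0, 1] and intervals that isolate a root.

module Isolation where

  open import Data.Nat as ℕ using (zero; suc)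
  open import Data.Product using (∃-syntax; _×_; _,_; proj₁; proj₂)
  open import Data.Rational
  open import Data.Rational.Properties
  open import Data.Sum using (_⊎_; inj₁; inj₂)
  import Data.Sum as Sum
  open import Relation.Binary.PropositionalEquality
  open import Relation.Nullary using (yes; no; contradiction)
  open import Tactic.RingSolver using (solve-∀)

  Unit : ℚ → Set
  Unit x = 0ℚ ≤ x × x ≤ 1ℚ

  ∣unit∣≤1 : ∀ {x} → Unit x → ∣ x ∣ ≤ 1ℚ
  ∣unit∣≤1 (0≤x , x≤1) = ≤-trans (≤-reflexive (0≤p⇒∣p∣≡p 0≤x)) x≤1

  ∣unit-unit∣≤1 : ∀ {x y} → Unit x → Unit y → ∣ y - x ∣ ≤ 1ℚ
  ∣unit-unit∣≤1 {x} {y} (0≤x , x≤1) (0≤y , y≤1) = ∣∣-intro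
    (≤-offset (lemma₁ x y) (+-nonNeg 0≤x (0≤q-p y≤1)))
    (≤-offset (lemma₂ x y) (+-nonNeg 0≤y (0≤q-p x≤1)))
    where
    lemma₁ : ∀ x y → 1ℚ ≡ y - x + (x + (1ℚ - y))
    lemma₁ = solve-∀ ℚ-ring
    lemma₂ : ∀ x y → 1ℚ ≡ - (y - x) + (y + (1ℚ - x))
    lemma₂ = solve-∀ ℚ-ring

  x+[y-x]≡y : ∀ x y → x + (y - x) ≡ y
  x+[y-x]≡y = solve-∀ ℚ-ring

  -- Bounds on the unit interval that can be divided by.
  positive-bound : ∀ {F} → Bounded 1ℚ F →
    ∃[ C ] 0ℚ < C × ∀ {x y} → Unit x → Unit y → ∣ F x (y - x) ∣ ≤ C
  positive-bound {F} (C , F≤C) = 1ℚ + ∣ C ∣ , +-pos-nonNeg 0<1 (0≤∣p∣ C) , λ {x} {y} ux uy →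
    ≤-trans (F≤C x (y - x) (∣unit∣≤1 ux) (∣unit-unit∣≤1 ux uy))
            (≤-trans (p≤∣p∣ C) (≤-offset (+-comm 1ℚ ∣ C ∣) 0≤1))

  upper-bound : ∀ f → ∃[ C ] 0ℚ < C × ∀ {x} → Unit x → ∣ ⟦ f ⟧ x ∣ ≤ C
  upper-bound f = let C , 0<C , bound = positive-bound (bounded-⟦⟧ f) in C , 0<C , λ ux → bound ux ux

  uniform : ∀ {F} → Bounded 1ℚ F → ∀ {e} → 0ℚ < e →
    ∃[ w ] 0ℚ < w × ∀ {x y} → Unit x → Unit y → ∣ y - x ∣ ≤ w → ∣ (y - x) * F x (y - x) ∣ ≤ e
  uniform {F} F-bounded {e} 0<e =
    let C , 0<C , F≤C = positive-bound F-bounded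
        w , 0<w , Cw≡e = divide 0<C 0<e
    in w , 0<w , λ {x} {y} ux uy ∣y-x∣≤w →
       ≤-trans (∣∣-* {y - x} ∣y-x∣≤w (F≤C ux uy)) (≤-reflexive (trans (*-comm w C) Cw≡e))

  increment : ∀ f x y → ⟦ f ⟧ y - ⟦ f ⟧ x ≡ (y - x) * (⟦ D f ⟧ x + (y - x) * remainder f x (y - x))
  increment f x y =
    trans (cong (_- ⟦ f ⟧ x) (trans (cong ⟦ f ⟧ (sym (x+[y-x]≡y x y))) (taylor f x (y - x))))
          (lemma (⟦ f ⟧ x) ((y - x) * (⟦ D f ⟧ x + (y - x) * remainder f x (y - x))))
    where
    lemma : ∀ a b → a + b - a ≡ b
    lemma = solve-∀ ℚ-ring

  uniformly-continuous : ∀ f {e} → 0ℚ < e →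
    ∃[ w ] 0ℚ < w × ∀ {x y} → Unit x → Unit y → ∣ y - x ∣ ≤ w → ∣ ⟦ f ⟧ y - ⟦ f ⟧ x ∣ ≤ e
  uniformly-continuous f 0<e =
    let w , 0<w , close = uniform (bounded-+ (bounded-⟦⟧ (D f)) (bounded-* bounded-h (bounded-remainder f))) 0<e
    in w , 0<w , λ {x} {y} ux uy ∣y-x∣≤w → ≤-trans (≤-reflexive (cong ∣_∣ (increment f x y))) (close ux uy ∣y-x∣≤w)

  NonZeroOn : Expr → ℚ → ℚ → Set
  NonZeroOn f a b = ∃[ e ] 0ℚ < e × ∀ {x} → a ≤ x → x ≤ b → e ≤ ∣ ⟦ f ⟧ x ∣

  nonZeroOn-⊆ : ∀ {f a b c d} → a ≤ c → d ≤ b → NonZeroOn f a b → NonZeroOn f c d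
  nonZeroOn-⊆ a≤c d≤b (e , 0<e , bound) = e , 0<e , λ c≤x x≤d → bound (≤-trans a≤c c≤x) (≤-trans x≤d d≤b)

  ∣∣-lower-neg : ∀ {p e} → p ≤ 0ℚ → e ≤ ∣ p ∣ → p ≤ - e
  ∣∣-lower-neg {p} {e} p≤0 e≤∣p∣ = ≤-trans (≤-reflexive (sym (neg-involutive p)))
    (neg-antimono-≤ (≤-trans e≤∣p∣ (≤-reflexive ∣p∣≡-p)))
    where
    neg-involutive : ∀ p → - - p ≡ p
    neg-involutive = solve-∀ ℚ-ring
    ∣p∣≡-p : ∣ p ∣ ≡ - p
    ∣p∣≡-p = trans (sym (∣-p∣≡∣p∣ p)) (0≤p⇒∣p∣≡p (neg-antimono-≤ p≤0))

  -- The margin is needed because a polynomial may vanish at an irrational point.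
  NegOn PosOn : Expr → ℚ → ℚ → Set
  NegOn f a b = ∃[ e ] 0ℚ < e × ∀ {x} → a ≤ x → x ≤ b → ⟦ f ⟧ x ≤ - e
  PosOn f a b = ∃[ e ] 0ℚ < e × ∀ {x} → a ≤ x → x ≤ b → e ≤ ⟦ f ⟧ x

  opp : Expr → Expr
  opp f = con (- 1ℚ) :* f

  opp-eval : ∀ f x → ⟦ opp f ⟧ x ≡ - ⟦ f ⟧ x
  opp-eval f x = lemma (⟦ f ⟧ x)
    where
    lemma : ∀ a → - 1ℚ * a ≡ - a
    lemma = solve-∀ ℚ-ring

  opp-abs : ∀ f x → ∣ ⟦ opp f ⟧ x ∣ ≡ ∣ ⟦ f ⟧ x ∣
  opp-abs f x = trans (cong ∣_∣ (opp-eval f x)) (∣-p∣≡∣p∣ (⟦ f ⟧ x))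

  close-upper : ∀ {p q r} → ∣ q - p ∣ ≤ r → q ≤ p + r
  close-upper {p} {q} {r} close = ≤-trans (≤-reflexive (lemma p q)) (+-monoʳ-≤ p (≤-trans (p≤∣p∣ (q - p)) close))
    where
    lemma : ∀ p q → q ≡ p + (q - p)
    lemma = solve-∀ ℚ-ring

  module _ {f a b} (0≤a : 0ℚ ≤ a) (b≤1 : b ≤ 1ℚ) (nz : NonZeroOn f a b) where

    private
      e = proj₁ nz
      0<e = proj₁ (proj₂ nz)
      bound = proj₂ (proj₂ nz)
      cont = uniformly-continuous f 0<e
      w = proj₁ cont
      0<w = proj₁ (proj₂ cont)
      unit : ∀ {x} → a ≤ x → x ≤ b → Unit x
      unit a≤x x≤b = ≤-trans 0≤a a≤x , ≤-trans x≤b b≤1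

      margin : ∀ {x} → a ≤ x → x ≤ b → ⟦ f ⟧ x ≤ 0ℚ → ⟦ f ⟧ x ≤ - e
      margin a≤x x≤b fx≤0 = ∣∣-lower-neg fx≤0 (bound a≤x x≤b)

      -- A discrete substitute for the intermediate value theorem: a nonpositive value is already at
      -- most -e, and over a distance of at most w it changes by at most e, so it cannot become
      -- positive.
      step : ∀ {x y} → a ≤ x → x ≤ y → y ≤ b → y - x ≤ w → ⟦ f ⟧ x ≤ 0ℚ → ⟦ f ⟧ y ≤ 0ℚ
      step {x} {y} a≤x x≤y y≤b y-x≤w fx≤0 = begin
        ⟦ f ⟧ y        ≤⟨ close-upper (proj₂ (proj₂ cont) (unit a≤x (≤-trans x≤y y≤b)) (unit (≤-trans a≤x x≤y) y≤b)
                            (≤-trans (≤-reflexive (0≤p⇒∣p∣≡p (0≤q-p x≤y))) y-x≤w)) ⟩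
        ⟦ f ⟧ x + e    ≤⟨ +-monoˡ-≤ e (margin a≤x (≤-trans x≤y y≤b) fx≤0) ⟩
        - e + e        ≡⟨ +-inverseˡ e ⟩
        0ℚ             ∎
        where open ≤-Reasoning

      walk : ∀ k {x y} → a ≤ x → x ≤ y → y ≤ b → y - x ≤ ι k * w → ⟦ f ⟧ x ≤ 0ℚ → ⟦ f ⟧ y ≤ 0ℚ
      walk k {x} {y} a≤x x≤y y≤b y-x≤kw fx≤0 with ≤-total (y - x) w
      ... | inj₁ y-x≤w = step a≤x x≤y y≤b y-x≤w fx≤0
      walk zero {x} {y} a≤x x≤y y≤b y-x≤kw fx≤0 | inj₂ w≤y-x =
        contradiction (<-≤-trans 0<w (≤-trans w≤y-x (≤-trans y-x≤kw (≤-reflexive (trans (cong (_* w) ι-0) (*-zeroˡ w))))))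
                      (<-irrefl refl)
      walk (suc k) {x} {y} a≤x x≤y y≤b y-x≤kw fx≤0 | inj₂ w≤y-x =
        walk k (≤-trans a≤x x≤x+w) x+w≤y y≤b
          (≤-offset (trans (lemma₁ x y w (ι k)) (cong (λ t → y - (x + w) + (t * w - (y - x))) (sym (ι-suc k)))) (0≤q-p y-x≤kw))
          (step a≤x x≤x+w (≤-trans x+w≤y y≤b) (≤-reflexive (lemma₂ x w)) fx≤0)
        where
        x≤x+w : x ≤ x + w
        x≤x+w = ≤-offset refl (<⇒≤ 0<w)
        lemma₁ : ∀ x y w k → k * w ≡ y - (x + w) + ((1ℚ + k) * w - (y - x))
        lemma₁ = solve-∀ ℚ-ring
        lemma₂ : ∀ x w → x + w - x ≡ w
        lemma₂ = solve-∀ ℚ-ring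
        lemma₃ : ∀ x y w → y ≡ x + w + (y - x - w)
        lemma₃ = solve-∀ ℚ-ring
        x+w≤y : x + w ≤ y
        x+w≤y = ≤-offset (lemma₃ x y w) (0≤q-p w≤y-x)

    sign-persists : ∀ {x y} → a ≤ x → x ≤ y → y ≤ b → ⟦ f ⟧ x ≤ 0ℚ → ⟦ f ⟧ y ≤ 0ℚ
    sign-persists {x} {y} a≤x x≤y y≤b = let k , y-x≤kw = archimedean-* (y - x) 0<w in walk k a≤x x≤y y≤b y-x≤kw

    negOn : ⟦ f ⟧ a ≤ 0ℚ → NegOn f a b
    negOn fa≤0 = e , 0<e , λ a≤x x≤b → margin a≤x x≤b (sign-persists ≤-refl a≤x x≤b fa≤0)

    posOn : 0ℚ < ⟦ f ⟧ b → PosOn f a b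
    posOn 0<fb = e , 0<e , λ {x} a≤x x≤b → ∣∣-lower-pos (bound a≤x x≤b)
      (≮⇒≥ λ fx<0 → <-irrefl refl (<-≤-trans 0<fb (sign-persists a≤x x≤b ≤-refl (<⇒≤ fx<0))))
      where
      ∣∣-lower-pos : ∀ {p} → e ≤ ∣ p ∣ → 0ℚ ≤ p → e ≤ p
      ∣∣-lower-pos e≤∣p∣ 0≤p = ≤-trans e≤∣p∣ (≤-reflexive (0≤p⇒∣p∣≡p 0≤p))

  -- A constructive form of "at most one root in [a, b]". The gap between x and y is what allows the
  -- alternative to be decided even if a root lies at or near one of them.
  Isolating : Expr → ℚ → ℚ → Set
  Isolating f a b = ∀ {x y} → a ≤ x → x < y → y ≤ b → NonZeroOn f a x ⊎ NonZeroOn f y b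

  ½-pos : ∀ {e} → 0ℚ < e → 0ℚ < ½ * e
  ½-pos = *-pos (positive⁻¹ ½)

  ¼ : ℚ
  ¼ = ½ * ½

  ½≤ : ∀ {e} → 0ℚ < e → ½ * e ≤ e
  ½≤ {e} 0<e = ≤-offset (lemma e) (<⇒≤ (½-pos 0<e))
    where
    lemma : ∀ e → e ≡ ½ * e + ½ * e
    lemma = solve-∀ ℚ-ring

  close-lower : ∀ {p q r} → ∣ q - p ∣ ≤ r → p - r ≤ q
  close-lower {p} {q} {r} close = ≤-offset (lemma p q r) (0≤q-p (≤-trans (-p≤∣p∣ (q - p)) close))
    where
    lemma : ∀ p q r → q ≡ p - r + (r - - (q - p))
    lemma = solve-∀ ℚ-ring

  smaller : ∀ {p q} → 0ℚ < p → 0ℚ < q → ∃[ r ] 0ℚ < r × r ≤ p × r ≤ q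
  smaller {p} {q} 0<p 0<q with ≤-total p q
  ... | inj₁ p≤q = p , 0<p , ≤-refl , p≤q
  ... | inj₂ q≤p = q , 0<q , q≤p , ≤-refl

  -- By Taylor's formula the slope of f on a short interval is close to the
  -- derivative at its left end.
  increasing-nearby : ∀ f {η} → 0ℚ < η → ∃[ h ] 0ℚ < h × ∀ {a b} → 0ℚ ≤ a → b ≤ 1ℚ → b - a ≤ h →
    η ≤ ⟦ D f ⟧ a → ∀ {x y} → a ≤ x → x ≤ y → y ≤ b → (y - x) * (½ * η) ≤ ⟦ f ⟧ y - ⟦ f ⟧ x
  increasing-nearby f {η} 0<η =
    -- A quarter of η is allowed for the variation of the derivative and another quarter for the
    -- Taylor remainder, which leaves a slope of η/2.
    let v , 0<v , close₁ = uniformly-continuous (D f) (½-pos (½-pos 0<η))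
        w , 0<w , close₂ = uniform (bounded-remainder f) (½-pos (½-pos 0<η))
        h , 0<h , h≤v , h≤w = smaller 0<v 0<w
    in h , 0<h , λ {a} {b} 0≤a b≤1 b-a≤h η≤Dfa {x} {y} a≤x x≤y y≤b →
       let x≤b   = ≤-trans x≤y y≤b
           ux    = ≤-trans 0≤a a≤x , ≤-trans x≤b b≤1
           uy    = ≤-trans (proj₁ ux) x≤y , ≤-trans y≤b b≤1
           ua    = 0≤a , ≤-trans a≤x (proj₂ ux)
           Dfa-δ≤Dfx = close-lower {⟦ D f ⟧ a} {⟦ D f ⟧ x} (close₁ ua ux (short a≤x ≤-refl x≤b (≤-trans b-a≤h h≤v)))
           -δ≤error  = close-lower {0ℚ} {(y - x) * remainder f x (y - x)} (≤-trans (≤-reflexive (cong ∣_∣ (minus-zero ((y - x) * remainder f x (y - x)))))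
                                         (close₂ ux uy (short x≤y a≤x y≤b (≤-trans b-a≤h h≤w))))
       in ≤-trans
            (*-monoˡ (0≤q-p x≤y) (≤-trans (≤-reflexive (quarters η))
              (+-mono-≤ (≤-trans (+-monoˡ-≤ (- (½ * (½ * η))) η≤Dfa) Dfa-δ≤Dfx) -δ≤error)))
            (≤-reflexive (sym (increment f x y)))
    where
    minus-zero : ∀ p → p - 0ℚ ≡ p
    minus-zero = solve-∀ ℚ-ring
    quarters : ∀ η → ½ * η ≡ η - ½ * (½ * η) + (0ℚ - ½ * (½ * η))
    quarters = solve-∀ ℚ-ring
    lemma : ∀ a b x y → b - a ≡ y - x + ((b - y) + (x - a))
    lemma = solve-∀ ℚ-ring
    short : ∀ {a b h x y} → x ≤ y → a ≤ x → y ≤ b → b - a ≤ h → ∣ y - x ∣ ≤ h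
    short {a} {b} {h} {x} {y} x≤y a≤x y≤b b-a≤h = ≤-trans (≤-reflexive (0≤p⇒∣p∣≡p (0≤q-p x≤y)))
      (≤-trans (≤-offset (lemma a b x y) (+-nonNeg (0≤q-p y≤b) (0≤q-p a≤x))) b-a≤h)

  -- Between x and y the value rises by at least 2δ, so it is at most -δ at x or at least δ at y.
  -- Monotonicity carries this bound to the left of x or to the right of y.
  increasing-isolates : ∀ f {a b κ} → 0ℚ < κ →
    (∀ {x y} → a ≤ x → x ≤ y → y ≤ b → (y - x) * κ ≤ ⟦ f ⟧ y - ⟦ f ⟧ x) → Isolating f a b
  increasing-isolates f {a} {b} {κ} 0<κ increasing {x} {y} a≤x x<y y≤b = choose (≤-total (⟦ f ⟧ x) (- δ))
    where
    δ = ½ * ((y - x) * κ)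
    0<δ : 0ℚ < δ
    0<δ = ½-pos (*-pos (0<q-p x<y) 0<κ)
    monotone : ∀ {x y} → a ≤ x → x ≤ y → y ≤ b → ⟦ f ⟧ x ≤ ⟦ f ⟧ y
    monotone {x} {y} a≤x x≤y y≤b = ≤-offset (sym (x+[y-x]≡y (⟦ f ⟧ x) (⟦ f ⟧ y)))
      (≤-trans (*-nonNeg (0≤q-p x≤y) (<⇒≤ 0<κ)) (increasing a≤x x≤y y≤b))
    lemma₁ : ∀ p q t → q ≡ ½ * t + ((p - - (½ * t)) + (q - p - t))
    lemma₁ = solve-∀ ℚ-ring
    lemma₂ : ∀ p → - - p ≡ p
    lemma₂ = solve-∀ ℚ-ring
    choose : ⟦ f ⟧ x ≤ - δ ⊎ - δ ≤ ⟦ f ⟧ x → NonZeroOn f a x ⊎ NonZeroOn f y b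
    choose (inj₁ fx≤-δ) = inj₁ (δ , 0<δ , λ {z} a≤z z≤x →
      ≤-trans (≤-trans (≤-reflexive (sym (lemma₂ δ)))
                       (neg-antimono-≤ (≤-trans (monotone a≤z z≤x (≤-trans (<⇒≤ x<y) y≤b)) fx≤-δ)))
              (-p≤∣p∣ (⟦ f ⟧ z)))
    choose (inj₂ -δ≤fx) = inj₂ (δ , 0<δ , λ {z} y≤z z≤b →
      ≤-trans (≤-trans δ≤fy (monotone (≤-trans a≤x (<⇒≤ x<y)) y≤z z≤b)) (p≤∣p∣ (⟦ f ⟧ z)))
      where
      δ≤fy : δ ≤ ⟦ f ⟧ y
      δ≤fy = ≤-offset (lemma₁ (⟦ f ⟧ x) (⟦ f ⟧ y) ((y - x) * κ))
               (+-nonNeg (0≤q-p -δ≤fx) (0≤q-p (increasing a≤x (<⇒≤ x<y) y≤b)))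

  isolating-opp : ∀ {f a b} → Isolating (opp f) a b → Isolating f a b
  isolating-opp {f} iso a≤x x<y y≤b = Sum.map unopp unopp (iso a≤x x<y y≤b)
    where
    unopp : ∀ {c d} → NonZeroOn (opp f) c d → NonZeroOn f c d
    unopp (e , 0<e , bound) = e , 0<e , λ {x} c≤x x≤d → ≤-trans (bound c≤x x≤d) (≤-reflexive (opp-abs f x))

  nonZero-isolates : ∀ {f a b} → NonZeroOn f a b → Isolating f a b
  nonZero-isolates {f} nz a≤x x<y y≤b = inj₁ (nonZeroOn-⊆ {f} ≤-refl (≤-trans (<⇒≤ x<y) y≤b) nz)

  -- If |A| ≤ M and |B| ≤ N in A f + B f′ = 1, then at the left end |f| or |f′| is at least η = 1/(M
  -- + N). On a short interval a large value stays at least η/2 in size, and a large slope makes f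
  -- or -f strictly increasing. The admissible length depends on f alone.
  squareFree-isolates : ∀ f → SquareFree f →
    ∃[ h ] 0ℚ < h × ∀ {a b} → 0ℚ ≤ a → a ≤ b → b ≤ 1ℚ → b - a ≤ h → Isolating f a b
  squareFree-isolates f (A , B , eq) =
    let M , 0<M , A≤M = upper-bound A
        N , 0<N , B≤N = upper-bound B
        η , 0<η , Kη≡1 = divide (+-pos 0<M 0<N) 0<1
        h₁ , 0<h₁ , close = uniformly-continuous f (½-pos 0<η)
        h₂ , 0<h₂ , incr  = increasing-nearby f 0<η
        h₃ , 0<h₃ , decr  = increasing-nearby (opp f) 0<η
        h₄ , 0<h₄ , h₄≤h₁ , h₄≤h₂ = smaller 0<h₁ 0<h₂
        h , 0<h , h≤h₄ , h≤h₃ = smaller 0<h₄ 0<h₃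
    in h , 0<h , λ {a} {b} 0≤a a≤b b≤1 b-a≤h →
       let ua = 0≤a , ≤-trans a≤b b≤1
           large-f : η ≤ ∣ ⟦ f ⟧ a ∣ → Isolating f a b
           large-f η≤∣fa∣ = nonZero-isolates {f} (½ * η , ½-pos 0<η , λ {x} a≤x x≤b →
             ∣∣-close (close ua (≤-trans 0≤a a≤x , ≤-trans x≤b b≤1)
               (≤-trans (≤-reflexive (0≤p⇒∣p∣≡p (0≤q-p a≤x)))
                 (≤-trans (+-monoˡ-≤ (- a) x≤b) (≤-trans b-a≤h (≤-trans h≤h₄ h₄≤h₁))))) η≤∣fa∣)
           large-D : η ≤ ∣ ⟦ D f ⟧ a ∣ → Isolating f a b
           large-D η≤∣Dfa∣ = Sum.[ (λ 0≤Dfa → increasing-isolates f (½-pos 0<η)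
               (incr 0≤a b≤1 (≤-trans b-a≤h (≤-trans h≤h₄ h₄≤h₂)) (≤-trans η≤∣Dfa∣ (≤-reflexive (0≤p⇒∣p∣≡p 0≤Dfa)))))
             , (λ Dfa≤0 → isolating-opp {f} (increasing-isolates (opp f) (½-pos 0<η)
               (decr 0≤a b≤1 (≤-trans b-a≤h h≤h₃) (≤-trans (neg-flip (∣∣-lower-neg Dfa≤0 η≤∣Dfa∣)) (≤-reflexive (sym (D-opp a)))))))
             ]′ (≤-total 0ℚ (⟦ D f ⟧ a))
       in Sum.[ large-f , large-D ]′ (one-is-large 0<M 0<N Kη≡1 (A≤M ua) (B≤N ua) (eq a))
    where
    lemma₁ : ∀ g f → 0ℚ * f + - 1ℚ * g ≡ - g
    lemma₁ = solve-∀ ℚ-ring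
    D-opp : ∀ x → ⟦ D (opp f) ⟧ x ≡ - ⟦ D f ⟧ x
    D-opp x = lemma₁ (⟦ D f ⟧ x) (⟦ f ⟧ x)
    neg-neg : ∀ p → - - p ≡ p
    neg-neg = solve-∀ ℚ-ring
    neg-flip : ∀ {p q} → p ≤ - q → q ≤ - p
    neg-flip {p} {q} p≤-q = ≤-trans (≤-reflexive (sym (neg-neg q))) (neg-antimono-≤ p≤-q)
    lemma₃ : ∀ p q → p ≡ q + - (q - p)
    lemma₃ = solve-∀ ℚ-ring
    lemma₄ : ∀ q η → q ≡ ½ * η + (q + ½ * η - η)
    lemma₄ = solve-∀ ℚ-ring
    ∣∣-close : ∀ {p q η} → ∣ q - p ∣ ≤ ½ * η → η ≤ ∣ p ∣ → ½ * η ≤ ∣ q ∣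
    ∣∣-close {p} {q} {η} close η≤∣p∣ = ≤-offset (lemma₄ ∣ q ∣ η) (0≤q-p (begin
      η                    ≤⟨ η≤∣p∣ ⟩
      ∣ p ∣                ≡⟨ cong ∣_∣ (lemma₃ p q) ⟩
      ∣ q + - (q - p) ∣    ≤⟨ ∣∣-+ {q} {q = - (q - p)} ≤-refl (≤-trans (≤-reflexive (∣-p∣≡∣p∣ (q - p))) close) ⟩
      ∣ q ∣ + ½ * η        ∎))
      where open ≤-Reasoning
    one-is-large : ∀ {M N η a b s t} → 0ℚ < M → 0ℚ < N → (M + N) * η ≡ 1ℚ → ∣ a ∣ ≤ M → ∣ b ∣ ≤ N →
      a * s + b * t ≡ 1ℚ → η ≤ ∣ s ∣ ⊎ η ≤ ∣ t ∣
    one-is-large {M} {N} {η} {a} {b} {s} {t} 0<M 0<N Kη≡1 a≤M b≤N as+bt≡1 with η ≤? ∣ s ∣ | η ≤? ∣ t ∣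
    ... | yes η≤s | _       = inj₁ η≤s
    ... | no  _   | yes η≤t = inj₂ η≤t
    ... | no  η≰s | no  η≰t = contradiction (begin-strict
      1ℚ                     ≡⟨ as+bt≡1 ⟨
      a * s + b * t          ≤⟨ p≤∣p∣ (a * s + b * t) ⟩
      ∣ a * s + b * t ∣      ≤⟨ ∣∣-+ {a * s} {b * t} (∣∣-* {a} {s} a≤M ≤-refl) (∣∣-* {b} {t} b≤N ≤-refl) ⟩
      M * ∣ s ∣ + N * ∣ t ∣  <⟨ +-mono-< (*-monoʳ-<-pos M {{positive 0<M}} (≰⇒> η≰s)) (*-monoʳ-<-pos N {{positive 0<N}} (≰⇒> η≰t)) ⟩
      M * η + N * η          ≡⟨ *-distribʳ-+ η M N ⟨
      (M + N) * η            ≡⟨ Kη≡1 ⟩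
      1ℚ                     ∎) (<-irrefl refl)
      where open ≤-Reasoning

open Isolation

-- Locating a strict sign change by trisection.

module Crossings where

  import Data.Integer as ℤ
  open import Data.Nat as ℕ using (ℕ; zero; suc)
  import Data.Nat.Properties as ℕ
  open import Data.Product using (∃-syntax; _×_; _,_; proj₁; proj₂)
  open import Data.Rational
  open import Data.Rational.Properties
  open import Data.Sum using (_⊎_; inj₁; inj₂)
  import Data.Sum as Sum
  open import Relation.Binary.PropositionalEquality
  open import Relation.Binary.Definitions using (tri<; tri≈; tri>)
  open import Relation.Nullary using (contradiction)
  open import Tactic.RingSolver using (solve-∀)

  nonZeroOn-:^ : ∀ {f a b} k → NonZeroOn f a b → NonZeroOn (f :^ k) a b
  nonZeroOn-:^ zero    nz = 1ℚ , 0<1 , λ _ _ → ≤-refl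
  nonZeroOn-:^ {f} (suc k) nz@(d , 0<d , d≤) =
    let e , 0<e , e≤ = nonZeroOn-:^ {f} k nz
    in d * e , *-pos 0<d 0<e , λ {x} a≤x x≤b →
       ≤-trans (*-mono (<⇒≤ 0<d) (0≤∣p∣ (⟦ f :^ k ⟧ x)) (d≤ a≤x x≤b) (e≤ a≤x x≤b))
               (≤-reflexive (sym (∣p*q∣≡∣p∣*∣q∣ (⟦ f ⟧ x) (⟦ f :^ k ⟧ x))))

  nonZeroOn-factor : ∀ {f g h a b} → 0ℚ ≤ a → b ≤ 1ℚ → f :* g ≈ h → NonZeroOn h a b → NonZeroOn f a b
  nonZeroOn-factor {f} {g} {h} 0≤a b≤1 fg≈h (e , 0<e , e≤) =
    let M , 0<M , g≤M = upper-bound g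
        d , 0<d , Md≡e = divide 0<M 0<e
    in d , 0<d , λ {x} a≤x x≤b → *-cancelˡ-≤ 0<M (begin
         M * d                      ≡⟨ Md≡e ⟩
         e                          ≤⟨ e≤ a≤x x≤b ⟩
         ∣ ⟦ h ⟧ x ∣                ≡⟨ cong ∣_∣ (fg≈h x) ⟨
         ∣ ⟦ f ⟧ x * ⟦ g ⟧ x ∣      ≤⟨ ∣∣-* {⟦ f ⟧ x} {⟦ g ⟧ x} ≤-refl (g≤M (≤-trans 0≤a a≤x , ≤-trans x≤b b≤1)) ⟩
         ∣ ⟦ f ⟧ x ∣ * M            ≡⟨ *-comm ∣ ⟦ f ⟧ x ∣ M ⟩
         M * ∣ ⟦ f ⟧ x ∣            ∎)
    where open ≤-Reasoning

  -- Since f divides a power of S and the cofactor is bounded, f is bounded away from 0 wherever S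
  -- is.
  radical-isolates : ∀ f → Radical f →
    ∃[ h ] 0ℚ < h × ∀ {a b} → 0ℚ ≤ a → a ≤ b → b ≤ 1ℚ → b - a ≤ h → Isolating f a b
  radical-isolates f (S , sf , U , k , eq) =
    let h , 0<h , iso = squareFree-isolates S sf
    in h , 0<h , λ {a} {b} 0≤a a≤b b≤1 b-a≤h {x} {y} a≤x x<y y≤b →
       Sum.map (λ nz → nonZeroOn-factor {f} {U} {S :^ k} 0≤a (≤-trans (<⇒≤ x<y) (≤-trans y≤b b≤1)) eq (nonZeroOn-:^ {S} k nz))
               (λ nz → nonZeroOn-factor {f} {U} {S :^ k} (≤-trans 0≤a (≤-trans a≤x (<⇒≤ x<y))) b≤1 eq (nonZeroOn-:^ {S} k nz))
               (iso 0≤a a≤b b≤1 b-a≤h a≤x x<y y≤b)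

  nonZeroOn⇒≢0 : ∀ {f a b x} → NonZeroOn f a b → a ≤ x → x ≤ b → ⟦ f ⟧ x ≢ 0ℚ
  nonZeroOn⇒≢0 (e , 0<e , e≤) a≤x x≤b fx≡0 =
    <-irrefl refl (<-≤-trans 0<e (≤-trans (e≤ a≤x x≤b) (≤-reflexive (cong ∣_∣ fx≡0))))

  SignChange : Expr → ℚ → ℚ → Set
  SignChange f a b = a ≤ b × ⟦ f ⟧ a < 0ℚ × 0ℚ < ⟦ f ⟧ b

  -- Of two nearby points at least one is not a root, so that the interval can be
  -- traversed in short steps with non-roots as end points.
  short-signChange : ∀ f {h} → 0ℚ < h →
    (∀ {a b} → 0ℚ ≤ a → a ≤ b → b ≤ 1ℚ → b - a ≤ h → Isolating f a b) →
    ∀ k {a b} → 0ℚ ≤ a → b ≤ 1ℚ → b - a ≤ ι k * (½ * h) → SignChange f a b →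
    ∃[ c ] ∃[ d ] a ≤ c × d ≤ b × d - c ≤ h × SignChange f c d
  short-signChange f {h} 0<h iso = search
    where
    Found : ℚ → ℚ → Set
    Found a b = ∃[ c ] ∃[ d ] a ≤ c × d ≤ b × d - c ≤ h × SignChange f c d
    lemma₁ : ∀ a h → a + h - (a + ½ * h) ≡ ½ * h
    lemma₁ = solve-∀ ℚ-ring
    lemma₂ : ∀ a h → a + h - a ≡ h
    lemma₂ = solve-∀ ℚ-ring
    lemma₃ : ∀ k a b h → k * (½ * h) ≡ b - (a + ½ * h) + ((1ℚ + k) * (½ * h) - (b - a))
    lemma₃ = solve-∀ ℚ-ring
    lemma₄ : ∀ a b h → b ≡ a + h + (b - a - h)
    lemma₄ = solve-∀ ℚ-ring
    lemma₅ : ∀ a h → a + h ≡ a + ½ * h + ½ * h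
    lemma₅ = solve-∀ ℚ-ring
    search : ∀ k {a b} → 0ℚ ≤ a → b ≤ 1ℚ → b - a ≤ ι k * (½ * h) → SignChange f a b → Found a b
    search k {a} {b} 0≤a b≤1 b-a≤ sc with ≤-total (b - a) h
    ... | inj₁ b-a≤h = a , b , ≤-refl , ≤-refl , b-a≤h , sc
    search zero {a} {b} 0≤a b≤1 b-a≤ sc | inj₂ h≤b-a =
      contradiction (<-≤-trans 0<h (≤-trans h≤b-a (≤-trans b-a≤ (≤-reflexive (trans (cong (_* (½ * h)) ι-0) (*-zeroˡ (½ * h)))))))
                    (<-irrefl refl)
    search (suc k) {a} {b} 0≤a b≤1 b-a≤ (a≤b , fa<0 , 0<fb) | inj₂ h≤b-a =
      -- Isolation on [a + h/2, a + h], applied to its own end points, shows that one of them is not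
      -- a root. Each step therefore advances by at least h/2 and at most h.
      Sum.[ (λ nz → advance a+½h a≤a+½h (≤-trans (<⇒≤ a+½h<a+h) a+h≤b) ≤-refl (<⇒≤ a+½h<a+h) (nonZeroOn⇒≢0 {f} nz ≤-refl ≤-refl))
          , (λ nz → advance a+h (≤-trans a≤a+½h (<⇒≤ a+½h<a+h)) a+h≤b (<⇒≤ a+½h<a+h) ≤-refl (nonZeroOn⇒≢0 {f} nz ≤-refl ≤-refl))
          ]′ (iso (≤-trans 0≤a a≤a+½h) (<⇒≤ a+½h<a+h) (≤-trans a+h≤b b≤1)
                  (≤-trans (≤-reflexive (lemma₁ a h)) (½≤ 0<h)) ≤-refl a+½h<a+h ≤-refl)
      where
      a+½h = a + ½ * h
      a+h = a + h
      a≤a+½h : a ≤ a+½h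
      a≤a+½h = ≤-offset refl (<⇒≤ (½-pos 0<h))
      a+½h<a+h : a+½h < a+h
      a+½h<a+h = <-offset (lemma₅ a h) (½-pos 0<h)
      a+h≤b : a+h ≤ b
      a+h≤b = ≤-offset (lemma₄ a b h) (0≤q-p h≤b-a)
      advance : ∀ m → a ≤ m → m ≤ b → a+½h ≤ m → m ≤ a+h → ⟦ f ⟧ m ≢ 0ℚ → Found a b
      advance m a≤m m≤b a+½h≤m m≤a+h fm≢0 with <-cmp (⟦ f ⟧ m) 0ℚ
      ... | tri≈ _ fm≡0 _ = contradiction fm≡0 fm≢0
      ... | tri> _ _ 0<fm = a , m , ≤-refl , m≤b
                          , ≤-trans (+-monoˡ-≤ (- a) m≤a+h) (≤-reflexive (lemma₂ a h)) , a≤m , fa<0 , 0<fm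
      ... | tri< fm<0 _ _ =
        let c , d , m≤c , rest = search k (≤-trans 0≤a a≤m) b≤1
              (≤-trans (+-monoʳ-≤ b (neg-antimono-≤ a+½h≤m))
                (≤-offset (trans (lemma₃ (ι k) a b h)
                    (cong (λ t → b - (a + ½ * h) + (t * (½ * h) - (b - a))) (sym (ι-suc k))))
                  (0≤q-p b-a≤)))
              (m≤b , fm<0 , 0<fb)
        in c , d , ≤-trans a≤m m≤c , rest

  -- Nested rational intervals around the future root, with a definite sign of f outside each of
  -- them, up to the fixed ends a and b. Strictness of `a<lo` and `hi<b` keeps the limit inside (a,
  -- b).
  record Crossing (f : Expr) (a b : ℚ) : Set where
    field
      lo hi    : ℕ → ℚ
      lo-mono  : ∀ {i j} → i ℕ.≤ j → lo i ≤ lo j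
      hi-mono  : ∀ {i j} → i ℕ.≤ j → hi j ≤ hi i
      lo≤hi    : ∀ i → lo i ≤ hi i
      shrink   : ∀ {e} → 0ℚ < e → ∃[ i ] hi i - lo i ≤ e
      a<lo     : a < lo 0
      hi<b     : hi 0 < b
      neg-left : ∀ i → NegOn f a (lo i)
      pos-right : ∀ i → PosOn f (hi i) b

  ⅓ : ℚ
  ⅓ = ℤ.+ 1 / 3

  module Trisection {f a b} (0≤a : 0ℚ ≤ a) (b≤1 : b ≤ 1ℚ) (fa<0 : ⟦ f ⟧ a < 0ℚ) (0<fb : 0ℚ < ⟦ f ⟧ b)
                    (iso : Isolating f a b) where

    record State : Set where
      field
        lo hi    : ℚ
        a≤lo     : a ≤ lo
        lo<hi    : lo < hi
        hi≤b     : hi ≤ b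
        neg-left : NegOn f a lo
        pos-right : PosOn f hi b

    module _ (s : State) where
      open State s

      private
        third = ⅓ * (hi - lo)
        0<third : 0ℚ < third
        0<third = *-pos (positive⁻¹ ⅓) (0<q-p lo<hi)
        lemma₁ : ∀ l u → u - ⅓ * (u - l) ≡ l + ⅓ * (u - l) + ⅓ * (u - l)
        lemma₁ = solve-∀ ℚ-ring
        lemma₂ : ∀ l u → u ≡ u - ⅓ * (u - l) + ⅓ * (u - l)
        lemma₂ = solve-∀ ℚ-ring
        m₁ = lo + third
        m₂ = hi - third
        lo<m₁ : lo < m₁
        lo<m₁ = <-offset refl 0<third
        m₁<m₂ : m₁ < m₂
        m₁<m₂ = <-offset (lemma₁ lo hi) 0<third
        m₂<hi : m₂ < hi
        m₂<hi = <-offset (lemma₂ lo hi) 0<third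
        m₁≤b = ≤-trans (<⇒≤ (<-trans m₁<m₂ m₂<hi)) hi≤b
        a≤m₂ = ≤-trans a≤lo (<⇒≤ (<-trans lo<m₁ m₁<m₂))
        lemma₃ : ∀ l u → u - (l + ⅓ * (u - l)) ≡ (⅓ + ⅓) * (u - l)
        lemma₃ = solve-∀ ℚ-ring
        lemma₄ : ∀ l u → u - ⅓ * (u - l) - l ≡ (⅓ + ⅓) * (u - l)
        lemma₄ = solve-∀ ℚ-ring

      Next : Set
      Next = ∃[ t ] lo ≤ State.lo t × State.hi t ≤ hi × State.hi t - State.lo t ≡ (⅓ + ⅓) * (hi - lo)

      -- Where f is bounded away from 0 it keeps its sign at a or at b, so the left or the right
      -- third can be discarded. Thirds replace halves because the decision needs two distinct
      -- points.
      choose : NonZeroOn f a m₁ ⊎ NonZeroOn f m₂ b → Next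
      choose (inj₁ nz) = record
        { lo = m₁; hi = hi; a≤lo = ≤-trans a≤lo (<⇒≤ lo<m₁); lo<hi = <-trans m₁<m₂ m₂<hi; hi≤b = hi≤b
        ; neg-left = negOn {f} 0≤a (≤-trans m₁≤b b≤1) nz (<⇒≤ fa<0)
        ; pos-right = pos-right } , <⇒≤ lo<m₁ , ≤-refl , lemma₃ lo hi
      choose (inj₂ nz) = record
        { lo = lo; hi = m₂; a≤lo = a≤lo; lo<hi = <-trans lo<m₁ m₁<m₂; hi≤b = ≤-trans (<⇒≤ m₂<hi) hi≤b
        ; neg-left = neg-left
        ; pos-right = posOn {f} (≤-trans 0≤a a≤m₂) b≤1 nz 0<fb } , ≤-refl , <⇒≤ m₂<hi , lemma₄ lo hi

      next : Next
      next = choose (iso (≤-trans a≤lo (<⇒≤ lo<m₁)) m₁<m₂ (≤-trans (<⇒≤ m₂<hi) hi≤b))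

    module _ (start : State) (a<lo : a < State.lo start) (hi<b : State.hi start < b) where

      private
        state : ℕ → State
        state zero    = start
        state (suc i) = proj₁ (next (state i))

        lo hi : ℕ → ℚ
        lo i = State.lo (state i)
        hi i = State.hi (state i)

        monotone : ∀ {P : ℚ → ℚ → Set} → (∀ {x} → P x x) → (∀ {x y z} → P x y → P y z → P x z) →
                   (s : ℕ → ℚ) → (∀ i → P (s i) (s (suc i))) → ∀ {i j} → i ℕ.≤′ j → P (s i) (s j)
        monotone r t s step ℕ.≤′-refl       = r
        monotone {P} r t s step (ℕ.≤′-step i≤j) = t (monotone {P} r t s step i≤j) (step _)

        lemma₁ : ∀ i w → (1ℚ + (1ℚ + (1ℚ + i))) * ((⅓ + ⅓) * w) + ⅓ * i * w ≡ (1ℚ + (1ℚ + i)) * w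
        lemma₁ = solve-∀ ℚ-ring

        -- Bernoulli's inequality for the powers of 3/2.
        width : ∀ i → ι (2 ℕ.+ i) * (hi i - lo i) ≤ ι 2 * (hi 0 - lo 0)
        width zero    = ≤-refl
        width (suc i) = ≤-trans (≤-offset (sym (begin
            ι (3 ℕ.+ i) * (hi (suc i) - lo (suc i)) + ⅓ * ι i * w
              ≡⟨ cong₂ (λ s t → s * t + ⅓ * ι i * w)
                   (trans (ι-suc (2 ℕ.+ i)) (cong (1ℚ +_) (trans (ι-suc (suc i)) (cong (1ℚ +_) (ι-suc i)))))
                   (proj₂ (proj₂ (proj₂ (next (state i))))) ⟩
            (1ℚ + (1ℚ + (1ℚ + ι i))) * ((⅓ + ⅓) * w) + ⅓ * ι i * w
              ≡⟨ lemma₁ (ι i) w ⟩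
            (1ℚ + (1ℚ + ι i)) * w
              ≡⟨ cong (_* w) (trans (ι-suc (suc i)) (cong (1ℚ +_) (ι-suc i))) ⟨
            ι (2 ℕ.+ i) * w ∎))
            (*-nonNeg (*-nonNeg (<⇒≤ (positive⁻¹ ⅓)) (0≤ι i)) (0≤q-p (<⇒≤ (State.lo<hi (state i))))))
          (width i)
          where
          open ≡-Reasoning
          w = hi i - lo i

        shrink : ∀ {e} → 0ℚ < e → ∃[ i ] hi i - lo i ≤ e
        shrink {e} 0<e =
          let n , W≤ne = archimedean-* (ι 2 * (hi 0 - lo 0)) 0<e
          in n , *-cancelˡ-≤ (0<ι (suc n)) (begin
               ι (2 ℕ.+ n) * (hi n - lo n)  ≤⟨ width n ⟩
               ι 2 * (hi 0 - lo 0)          ≤⟨ W≤ne ⟩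
               ι n * e                      ≤⟨ *-monoʳ (<⇒≤ 0<e) (ι-mono-≤ (ℕ.m≤n+m n 2)) ⟩
               ι (2 ℕ.+ n) * e              ∎)
          where open ≤-Reasoning

      crossing-from : Crossing f a b
      crossing-from = record
        { lo = lo; hi = hi
        ; lo-mono = λ i≤j → monotone {_≤_} ≤-refl ≤-trans lo (λ i → proj₁ (proj₂ (next (state i)))) (ℕ.≤⇒≤′ i≤j)
        ; hi-mono = λ i≤j → monotone {_≥_} ≤-refl (λ p q → ≤-trans q p) hi (λ i → proj₁ (proj₂ (proj₂ (next (state i))))) (ℕ.≤⇒≤′ i≤j)
        ; lo≤hi = λ i → <⇒≤ (State.lo<hi (state i))
        ; shrink = shrink
        ; a<lo = a<lo; hi<b = hi<b
        ; neg-left = λ i → State.neg-left (state i)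
        ; pos-right = λ i → State.pos-right (state i)
        }

  signChange⇒< : ∀ {f a b} → SignChange f a b → a < b
  signChange⇒< {f} {a} {b} (a≤b , fa<0 , 0<fb) =
    ≰⇒> λ b≤a → <-irrefl (cong ⟦ f ⟧ (≤-antisym a≤b b≤a)) (<-trans fa<0 0<fb)

  -- Together with `near-right` it supplies a first interval strictly inside (a, b); the caps at one
  -- third of the length keep its two ends apart.
  near-left : ∀ f {a b} → 0ℚ ≤ a → b ≤ 1ℚ → a < b → ⟦ f ⟧ a < 0ℚ →
    ∃[ m ] a < m × m ≤ a + ⅓ * (b - a) × NegOn f a m
  near-left f {a} {b} 0≤a b≤1 a<b fa<0 =
    let w , 0<w , cont        = uniformly-continuous f (½-pos 0<e)
        r , 0<r , r≤w , r≤⅓ = smaller 0<w (*-pos (positive⁻¹ ⅓) (0<q-p a<b))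
    in a + r , <-offset refl 0<r , +-monoʳ-≤ a r≤⅓ , ½ * e , ½-pos 0<e , λ {x} a≤x x≤a+r →
       ≤-trans (close-upper (cont (0≤a , ≤-trans (<⇒≤ a<b) b≤1)
                 (≤-trans 0≤a a≤x , ≤-trans x≤a+r (≤-trans (+-monoʳ-≤ a r≤⅓) a+⅓≤1))
                 (≤-trans (≤-reflexive (0≤p⇒∣p∣≡p (0≤q-p a≤x))) (≤-trans (x-a≤r x≤a+r) r≤w))))
               (≤-reflexive (lemma₂ (⟦ f ⟧ a)))
    where
    e = - ⟦ f ⟧ a
    0<e : 0ℚ < e
    0<e = neg-antimono-< fa<0
    lemma₁ : ∀ a b → b ≡ a + ⅓ * (b - a) + (⅓ + ⅓) * (b - a)
    lemma₁ = solve-∀ ℚ-ring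
    lemma₂ : ∀ p → p + ½ * - p ≡ - (½ * - p)
    lemma₂ = solve-∀ ℚ-ring
    lemma₃ : ∀ x a r → r ≡ x - a + (a + r - x)
    lemma₃ = solve-∀ ℚ-ring
    a+⅓≤1 : a + ⅓ * (b - a) ≤ 1ℚ
    a+⅓≤1 = ≤-trans (≤-offset (lemma₁ a b) (*-nonNeg {⅓ + ⅓} (≤ᵇ⇒≤ _) (<⇒≤ (0<q-p a<b)))) b≤1
    x-a≤r : ∀ {x r} → x ≤ a + r → x - a ≤ r
    x-a≤r {x} {r} x≤a+r = ≤-offset (lemma₃ x a r) (0≤q-p x≤a+r)

  near-right : ∀ f {a b} → 0ℚ ≤ a → b ≤ 1ℚ → a < b → 0ℚ < ⟦ f ⟧ b →
    ∃[ m ] m < b × b - ⅓ * (b - a) ≤ m × PosOn f m b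
  near-right f {a} {b} 0≤a b≤1 a<b 0<e =
    let w , 0<w , cont        = uniformly-continuous f (½-pos 0<e)
        r , 0<r , r≤w , r≤⅓ = smaller 0<w (*-pos (positive⁻¹ ⅓) (0<q-p a<b))
    in b - r , <-offset (lemma₄ b r) 0<r , +-monoʳ-≤ b (neg-antimono-≤ r≤⅓) , ½ * e , ½-pos 0<e , λ {x} b-r≤x x≤b →
       ≤-trans (≤-reflexive (lemma₂ e))
               (close-lower {e} {⟦ f ⟧ x} (cont (≤-trans 0≤a (<⇒≤ a<b) , b≤1)
                 (≤-trans 0≤b-⅓ (≤-trans (+-monoʳ-≤ b (neg-antimono-≤ r≤⅓)) b-r≤x) , ≤-trans x≤b b≤1)
                 (≤-trans (≤-reflexive (trans (sym (∣-p∣≡∣p∣ (x - b))) (trans (cong ∣_∣ (lemma₅ x b)) (0≤p⇒∣p∣≡p (0≤q-p x≤b)))))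
                          (≤-trans (b-x≤r b-r≤x) r≤w))))
    where
    e = ⟦ f ⟧ b
    lemma₁ : ∀ a b → b - ⅓ * (b - a) ≡ a + (⅓ + ⅓) * (b - a)
    lemma₁ = solve-∀ ℚ-ring
    lemma₂ : ∀ p → ½ * p ≡ p - ½ * p
    lemma₂ = solve-∀ ℚ-ring
    lemma₃ : ∀ x b r → r ≡ b - x + (x - (b - r))
    lemma₃ = solve-∀ ℚ-ring
    lemma₄ : ∀ b r → b ≡ b - r + r
    lemma₄ = solve-∀ ℚ-ring
    lemma₅ : ∀ x b → - (x - b) ≡ b - x
    lemma₅ = solve-∀ ℚ-ring
    0≤b-⅓ : 0ℚ ≤ b - ⅓ * (b - a)
    0≤b-⅓ = ≤-trans (+-nonNeg 0≤a (*-nonNeg {⅓ + ⅓} (≤ᵇ⇒≤ _) (<⇒≤ (0<q-p a<b)))) (≤-reflexive (sym (lemma₁ a b)))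
    b-x≤r : ∀ {x r} → b - r ≤ x → b - x ≤ r
    b-x≤r {x} {r} b-r≤x = ≤-offset (lemma₃ x b r) (0≤q-p b-r≤x)

  crossing : ∀ f {a b} → 0ℚ ≤ a → b ≤ 1ℚ → SignChange f a b →
    ∃[ c ] ∃[ d ] a ≤ c × d ≤ b × Crossing f c d
  crossing f {a} {b} 0≤a b≤1 sc = Sum.[ vanish , cross ]′ (radical f)
    where
    Goal = ∃[ c ] ∃[ d ] a ≤ c × d ≤ b × Crossing f c d
    vanish : f ≈ con 0ℚ → Goal
    vanish f≈0 = contradiction (proj₁ (proj₂ sc)) (<-irrefl (f≈0 a))
    lemma : ∀ c d → d - ⅓ * (d - c) ≡ c + ⅓ * (d - c) + ⅓ * (d - c)
    lemma = solve-∀ ℚ-ring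
    cross : Radical f → Goal
    cross rad =
      let h , 0<h , iso = radical-isolates f rad
          k , b-a≤ = archimedean-* (b - a) (½-pos 0<h)
          c , d , a≤c , d≤b , d-c≤h , sc′@(c≤d , fc<0 , 0<fd) = short-signChange f 0<h iso k 0≤a b≤1 b-a≤ sc
          c<d = signChange⇒< {f} sc′
          0≤c = ≤-trans 0≤a a≤c
          d≤1 = ≤-trans d≤b b≤1
          l , c<l , l≤ , neg = near-left f 0≤c d≤1 c<d fc<0
          u , u<d , ≤u , pos = near-right f 0≤c d≤1 c<d 0<fd
          l<u = ≤-<-trans l≤ (<-≤-trans (<-offset (lemma c d) (*-pos (positive⁻¹ ⅓) (0<q-p c<d))) ≤u)
      in c , d , a≤c , d≤b ,
         Trisection.crossing-from {f} 0≤c d≤1 fc<0 0<fd (iso 0≤c c≤d d≤1 d-c≤h)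
           (record { lo = l ; hi = u ; a≤lo = <⇒≤ c<l ; lo<hi = l<u ; hi≤b = <⇒≤ u<d ; neg-left = neg ; pos-right = pos })
           c<l u<d

open Crossings

-- Real crossing points as limits of rational intervals.

module RealPoints where

  open import Defs using (Poly; ℝ; mkℝ; seq; Cauchy; fromℚ; eval; ChangesSignAt) renaming (_<_ to _<ᴿ_)
  open import Data.List using ([]; _∷_)
  open import Data.Nat as ℕ using (ℕ)
  import Data.Nat.Properties as ℕ
  open import Data.Product using (∃-syntax; _×_; _,_)
  open import Data.Rational
  open import Data.Rational.Properties
  open import Data.Sum using (_⊎_; inj₁; inj₂)
  open import Relation.Binary.PropositionalEquality
  open import Tactic.RingSolver using (solve-∀)

  toExpr : Poly → Expr
  toExpr []       = con 0ℚ
  toExpr (a ∷ as) = con (a / 1) :+ var :* toExpr as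

  seq-eval : ∀ P x i → seq (eval P x) i ≡ ⟦ toExpr P ⟧ (seq x i)
  seq-eval []       x i = refl
  seq-eval (a ∷ as) x i = cong (λ t → a / 1 + seq x i * t) (seq-eval as x i)

  module _ {f a b} (cr : Crossing f a b) where
    open Crossing cr

    private
      lo≤hi′ : ∀ {i N} → N ℕ.≤ i → lo i ≤ hi N
      lo≤hi′ {i} N≤i = ≤-trans (lo≤hi i) (hi-mono N≤i)

      close : ∀ {N i j} → N ℕ.≤ i → N ℕ.≤ j → lo i - lo j ≤ hi N - lo N
      close N≤i N≤j = +-mono-≤ (lo≤hi′ N≤i) (neg-antimono-≤ (lo-mono N≤j))

      swap : ∀ p q → - (p - q) ≡ q - p
      swap = solve-∀ ℚ-ring

      lo-cauchy : Cauchy lo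
      lo-cauchy e 0<e = let N , short = shrink 0<e in N , λ i j N≤i N≤j → ∣∣-intro
        (≤-trans (close N≤i N≤j) short)
        (≤-trans (≤-reflexive (swap (lo i) (lo j))) (≤-trans (close N≤j N≤i) short))

      cancel : ∀ {p q d r} → p + d ≤ q → q - r ≤ d → p ≤ r
      cancel {p} {q} {d} {r} p+d≤q q-r≤d = ≤-offset (lemma p q d r) (+-nonNeg (0≤q-p p+d≤q) (0≤q-p q-r≤d))
        where
        lemma : ∀ p q d r → r ≡ p + (q - (p + d) + (d - (q - r)))
        lemma = solve-∀ ℚ-ring

      weaken : ∀ {p q d} → 0ℚ < d → p + d ≤ q → p ≤ q
      weaken 0<d p+d≤q = ≤-trans (≤-offset refl (<⇒≤ 0<d)) p+d≤q

    point : ℝ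
    point = mkℝ lo lo-cauchy

    a<point : fromℚ a <ᴿ point
    a<point = lo 0 - a , 0<q-p a<lo , 0 , λ i _ → ≤-trans (≤-reflexive (x+[y-x]≡y a (lo 0))) (lo-mono ℕ.z≤n)

    point<b : point <ᴿ fromℚ b
    point<b = b - hi 0 , 0<q-p hi<b , 0 , λ i _ →
      ≤-trans (+-monoˡ-≤ (b - hi 0) (lo≤hi′ {i} ℕ.z≤n)) (≤-reflexive (x+[y-x]≡y (hi 0) b))

    -- If x is below the limit by d′, then from some index on the terms of x are below the left end
    -- of any interval no longer than d′. The sign statement for rationals applies to these terms,
    -- and its margin witnesses strictness for the real value.
    negative-before : ∀ x → fromℚ a <ᴿ x → x <ᴿ point →
      ∃[ e ] 0ℚ < e × ∃[ N ] ∀ i → N ℕ.≤ i → ⟦ f ⟧ (seq x i) ≤ - e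
    negative-before x (d , 0<d , K , a<x) (d′ , 0<d′ , L , x<c) =
      let M , short = shrink 0<d′
          e , 0<e , neg = neg-left M
      in e , 0<e , K ℕ.⊔ (L ℕ.⊔ M) , λ i ≤i →
         let K≤i = ℕ.m⊔n≤o⇒m≤o K (L ℕ.⊔ M) ≤i
             LM≤i = ℕ.m⊔n≤o⇒n≤o K (L ℕ.⊔ M) ≤i
         in neg (weaken 0<d (a<x i K≤i))
                (cancel (≤-trans (x<c i (ℕ.m⊔n≤o⇒m≤o L M LM≤i)) (lo≤hi′ (ℕ.m⊔n≤o⇒n≤o L M LM≤i))) short)

    positive-after : ∀ x → point <ᴿ x → x <ᴿ fromℚ b →
      ∃[ e ] 0ℚ < e × ∃[ N ] ∀ i → N ℕ.≤ i → e ≤ ⟦ f ⟧ (seq x i)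
    positive-after x (d′ , 0<d′ , L , c<x) (d , 0<d , K , x<b) =
      let M , short = shrink 0<d′
          e , 0<e , pos = pos-right M
      in e , 0<e , K ℕ.⊔ (L ℕ.⊔ M) , λ i ≤i →
         let K≤i = ℕ.m⊔n≤o⇒m≤o K (L ℕ.⊔ M) ≤i
             LM≤i = ℕ.m⊔n≤o⇒n≤o K (L ℕ.⊔ M) ≤i
         in pos (≤-trans (hi≤ short) (≤-trans (+-monoˡ-≤ d′ (lo-mono (ℕ.m⊔n≤o⇒n≤o L M LM≤i))) (c<x i (ℕ.m⊔n≤o⇒m≤o L M LM≤i))))
                (weaken 0<d (x<b i K≤i))
      where
      lemma : ∀ u l d → l + d ≡ u + (d - (u - l))
      lemma = solve-∀ ℚ-ring
      hi≤ : ∀ {M d} → hi M - lo M ≤ d → hi M ≤ lo M + d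
      hi≤ {M} {d} short = ≤-offset (lemma (hi M) (lo M) d) (0≤q-p short)

  private
    ≤-e⇒+e≤0 : ∀ {p e} → p ≤ - e → p + e ≤ 0ℚ
    ≤-e⇒+e≤0 {p} {e} p≤-e = ≤-trans (+-monoˡ-≤ e p≤-e) (≤-reflexive (+-inverseˡ e))

    neg-neg : ∀ p → - - p ≡ p
    neg-neg = solve-∀ ℚ-ring

  signChange⇒changesSignAt : ∀ P {a b} → 0ℚ ≤ a → b ≤ 1ℚ →
    SignChange (toExpr P) a b ⊎ SignChange (opp (toExpr P)) a b →
    ∃[ c ] fromℚ a <ᴿ c × c <ᴿ fromℚ b × ChangesSignAt P c
  signChange⇒changesSignAt P {a} {b} 0≤a b≤1 = λ where
      (inj₁ sc) → let l , u , a≤l , u≤b , cr = crossing f 0≤a b≤1 sc in upward a≤l u≤b cr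
      (inj₂ sc) → let l , u , a≤l , u≤b , cr = crossing (opp f) 0≤a b≤1 sc in downward a≤l u≤b cr
    where
    f = toExpr P
    widen : ∀ {l} c → a ≤ l → fromℚ l <ᴿ c → fromℚ a <ᴿ c
    widen c a≤l (d , 0<d , N , l<c) = d , 0<d , N , λ i N≤i → ≤-trans (+-monoˡ-≤ d a≤l) (l<c i N≤i)
    widen′ : ∀ {u} c → u ≤ b → c <ᴿ fromℚ u → c <ᴿ fromℚ b
    widen′ c u≤b (d , 0<d , N , c<u) = d , 0<d , N , λ i N≤i → ≤-trans (c<u i N≤i) u≤b
    unopp-neg : ∀ x {e} → ⟦ opp f ⟧ x ≤ - e → e ≤ ⟦ f ⟧ x
    unopp-neg x {e} p = ≤-trans (≤-reflexive (sym (neg-neg e)))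
      (≤-trans (neg-antimono-≤ (≤-trans (≤-reflexive (sym (opp-eval f x))) p)) (≤-reflexive (neg-neg (⟦ f ⟧ x))))
    unopp-pos : ∀ x {e} → e ≤ ⟦ opp f ⟧ x → ⟦ f ⟧ x ≤ - e
    unopp-pos x {e} p = ≤-trans (≤-reflexive (sym (neg-neg (⟦ f ⟧ x))))
      (neg-antimono-≤ (≤-trans p (≤-reflexive (opp-eval f x))))
    Goal = ∃[ c ] fromℚ a <ᴿ c × c <ᴿ fromℚ b × ChangesSignAt P c
    upward : ∀ {l u} → a ≤ l → u ≤ b → Crossing f l u → Goal
    upward {l} {u} a≤l u≤b cr =
      point cr , widen (point cr) a≤l (a<point cr) , widen′ (point cr) u≤b (point<b cr) ,
      fromℚ l , fromℚ u , a<point cr , point<b cr , inj₁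
        ( (λ x l<x x<c → let e , 0<e , N , neg = negative-before cr x l<x x<c
                         in e , 0<e , N , λ i N≤i → ≤-e⇒+e≤0 (≤-trans (≤-reflexive (seq-eval P x i)) (neg i N≤i)))
        , (λ x c<x x<u → let e , 0<e , N , pos = positive-after cr x c<x x<u
                         in e , 0<e , N , λ i N≤i → ≤-trans (≤-reflexive (+-identityˡ e))
                              (≤-trans (pos i N≤i) (≤-reflexive (sym (seq-eval P x i))))))
    downward : ∀ {l u} → a ≤ l → u ≤ b → Crossing (opp f) l u → Goal
    downward {l} {u} a≤l u≤b cr =
      point cr , widen (point cr) a≤l (a<point cr) , widen′ (point cr) u≤b (point<b cr) ,
      fromℚ l , fromℚ u , a<point cr , point<b cr , inj₂
        ( (λ x l<x x<c → let e , 0<e , N , neg = negative-before cr x l<x x<c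
                         in e , 0<e , N , λ i N≤i → ≤-trans (≤-reflexive (+-identityˡ e))
                              (≤-trans (unopp-neg (seq x i) (neg i N≤i)) (≤-reflexive (sym (seq-eval P x i)))))
        , (λ x c<x x<u → let e , 0<e , N , pos = positive-after cr x c<x x<u
                         in e , 0<e , N , λ i N≤i → ≤-e⇒+e≤0 (≤-trans (≤-reflexive (seq-eval P x i))
                              (unopp-pos (seq x i) (pos i N≤i)))))

open RealPoints

-- Second derivatives of the Bernstein terms.

module Bernstein where

  open import Defs using (derivative; _⊞_; _⊠_; _↑_)
  open import Data.Integer as ℤ using (0ℤ)
  open import Data.List using ([]; _∷_; map)
  open import Data.Nat as ℕ using (ℕ; zero; suc)
  open import Data.Rational
  open import Data.Rational.Properties
  open import Relation.Binary.PropositionalEquality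
  open import Tactic.RingSolver using (solve-∀)

  toExpr-⊞ : ∀ P Q → toExpr (P ⊞ Q) ≈ toExpr P :+ toExpr Q
  toExpr-⊞ []       Q        x = sym (+-identityˡ (⟦ toExpr Q ⟧ x))
  toExpr-⊞ (a ∷ as) []       x = sym (+-identityʳ (⟦ toExpr (a ∷ as) ⟧ x))
  toExpr-⊞ (a ∷ as) (b ∷ bs) x =
    trans (cong₂ (λ s t → s + x * t) (i/1+j/1 a b) (toExpr-⊞ as bs x))
          (lemma (a / 1) (b / 1) x (⟦ toExpr as ⟧ x) (⟦ toExpr bs ⟧ x))
    where
    lemma : ∀ a b x p q → a + b + x * (p + q) ≡ a + x * p + (b + x * q)
    lemma = solve-∀ ℚ-ring

  toExpr-scale : ∀ a P x → ⟦ toExpr (map (a ℤ.*_) P) ⟧ x ≡ a / 1 * ⟦ toExpr P ⟧ x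
  toExpr-scale a []       x = sym (*-zeroʳ (a / 1))
  toExpr-scale a (b ∷ bs) x =
    trans (cong₂ (λ s t → s + x * t) (i/1*j/1 a b) (toExpr-scale a bs x))
          (lemma (a / 1) (b / 1) x (⟦ toExpr bs ⟧ x))
    where
    lemma : ∀ a b x p → a * b + x * (a * p) ≡ a * (b + x * p)
    lemma = solve-∀ ℚ-ring

  toExpr-⊠ : ∀ P Q → toExpr (P ⊠ Q) ≈ toExpr P :* toExpr Q
  toExpr-⊠ []       Q x = sym (*-zeroˡ (⟦ toExpr Q ⟧ x))
  toExpr-⊠ (a ∷ as) Q x =
    trans (toExpr-⊞ (map (a ℤ.*_) Q) (0ℤ ∷ (as ⊠ Q)) x)
   (trans (cong₂ (λ s t → s + (0ℚ + x * t)) (toExpr-scale a Q x) (toExpr-⊠ as Q x))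
          (lemma (a / 1) x (⟦ toExpr as ⟧ x) (⟦ toExpr Q ⟧ x)))
    where
    lemma : ∀ a x p q → a * q + (0ℚ + x * (p * q)) ≡ (a + x * p) * q
    lemma = solve-∀ ℚ-ring

  toExpr-↑ : ∀ P k → toExpr (P ↑ k) ≈ toExpr P :^ k
  toExpr-↑ P zero    x = lemma x
    where
    lemma : ∀ x → 1ℚ + x * 0ℚ ≡ 1ℚ
    lemma = solve-∀ ℚ-ring
  toExpr-↑ P (suc k) x = trans (toExpr-⊠ P (P ↑ k) x) (cong (⟦ toExpr P ⟧ x *_) (toExpr-↑ P k x))

  toExpr-derivative : ∀ P → toExpr (derivative P) ≈ D (toExpr P)
  toExpr-derivative []       x = refl
  toExpr-derivative (a ∷ as) x =
    trans (toExpr-⊞ as (0ℤ ∷ derivative as) x)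
   (trans (cong (λ t → ⟦ toExpr as ⟧ x + (0ℚ + x * t)) (toExpr-derivative as x))
          (lemma x (⟦ toExpr as ⟧ x) (⟦ D (toExpr as) ⟧ x)))
    where
    lemma : ∀ x p q → p + (0ℚ + x * q) ≡ 0ℚ + (1ℚ * p + x * q)
    lemma = solve-∀ ℚ-ring

  1-var : Expr
  1-var = con 1ℚ :+ con (- 1ℚ) :* var

  1-var-eval : ∀ x → ⟦ 1-var ⟧ x ≡ 1ℚ - x
  1-var-eval = lemma
    where
    lemma : ∀ x → 1ℚ + - 1ℚ * x ≡ 1ℚ - x
    lemma = solve-∀ ℚ-ring

  :^-pos : ∀ f {x} k → 0ℚ < ⟦ f ⟧ x → 0ℚ < ⟦ f :^ k ⟧ x
  :^-pos f zero    0<fx = 0<1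
  :^-pos f (suc k) 0<fx = *-pos 0<fx (:^-pos f k 0<fx)

  module _ (b : Expr) {c : ℚ} (Db≡c : ∀ x → ⟦ D b ⟧ x ≡ c) (DDb≡0 : ∀ x → ⟦ D (D b) ⟧ x ≡ 0ℚ) where

    -- Multiplying through by b avoids the exponent k - 1, so k = 0 is no exception. For the second
    -- derivative below, b² plays the same part.
    D-:^ : ∀ k x → ⟦ b ⟧ x * ⟦ D (b :^ k) ⟧ x ≡ ι k * c * ⟦ b :^ k ⟧ x
    D-:^ zero    x = trans (*-zeroʳ (⟦ b ⟧ x)) (trans (lemma c) (cong (λ t → t * c * 1ℚ) (sym ι-0)))
      where
      lemma : ∀ c → 0ℚ ≡ 0ℚ * c * 1ℚ
      lemma = solve-∀ ℚ-ring
    D-:^ (suc k) x = begin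
      β * (⟦ D b ⟧ x * p + β * p′)     ≡⟨ cong (λ t → β * (t * p + β * p′)) (Db≡c x) ⟩
      β * (c * p + β * p′)             ≡⟨ cong (λ t → β * (c * p + t)) (D-:^ k x) ⟩
      β * (c * p + ι k * c * p)        ≡⟨ lemma β c p (ι k) ⟩
      (1ℚ + ι k) * c * (β * p)         ≡⟨ cong (λ t → t * c * (β * p)) (ι-suc k) ⟨
      ι (suc k) * c * (β * p)          ∎
      where
      open ≡-Reasoning
      β = ⟦ b ⟧ x
      p = ⟦ b :^ k ⟧ x
      p′ = ⟦ D (b :^ k) ⟧ x
      lemma : ∀ β c p k → β * (c * p + k * c * p) ≡ (1ℚ + k) * c * (β * p)
      lemma = solve-∀ ℚ-ring

    DD-:^ : ∀ k x → ⟦ b ⟧ x * (⟦ b ⟧ x * ⟦ D (D (b :^ k)) ⟧ x) ≡ ι k * (ι k - 1ℚ) * (c * c) * ⟦ b :^ k ⟧ x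
    DD-:^ zero    x = trans (lemma (⟦ b ⟧ x) c) (cong (λ t → t * (t - 1ℚ) * (c * c) * 1ℚ) (sym ι-0))
      where
      lemma : ∀ b c → b * (b * 0ℚ) ≡ 0ℚ * (0ℚ - 1ℚ) * (c * c) * 1ℚ
      lemma = solve-∀ ℚ-ring
    DD-:^ (suc k) x = begin
      β * (β * (⟦ D (D b) ⟧ x * p + ⟦ D b ⟧ x * p′ + (⟦ D b ⟧ x * p′ + β * p″)))
        ≡⟨ cong₂ (λ s t → β * (β * (s * p + t * p′ + (t * p′ + β * p″)))) (DDb≡0 x) (Db≡c x) ⟩
      β * (β * (0ℚ * p + c * p′ + (c * p′ + β * p″)))
        ≡⟨ lemma₁ β c p p′ p″ ⟩
      (1ℚ + 1ℚ) * (β * (c * (β * p′))) + β * (β * (β * p″))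
        ≡⟨ cong₂ (λ s t → (1ℚ + 1ℚ) * (β * (c * s)) + β * t) (D-:^ k x) (DD-:^ k x) ⟩
      (1ℚ + 1ℚ) * (β * (c * (ι k * c * p))) + β * (ι k * (ι k - 1ℚ) * (c * c) * p)
        ≡⟨ lemma₂ β c p (ι k) ⟩
      (1ℚ + ι k) * (1ℚ + ι k - 1ℚ) * (c * c) * (β * p)
        ≡⟨ cong (λ t → t * (t - 1ℚ) * (c * c) * (β * p)) (ι-suc k) ⟨
      ι (suc k) * (ι (suc k) - 1ℚ) * (c * c) * (β * p) ∎
      where
      open ≡-Reasoning
      β = ⟦ b ⟧ x
      p = ⟦ b :^ k ⟧ x
      p′ = ⟦ D (b :^ k) ⟧ x
      p″ = ⟦ D (D (b :^ k)) ⟧ x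
      lemma₁ : ∀ β c p p′ p″ → β * (β * (0ℚ * p + c * p′ + (c * p′ + β * p″))) ≡
        (1ℚ + 1ℚ) * (β * (c * (β * p′))) + β * (β * (β * p″))
      lemma₁ = solve-∀ ℚ-ring
      lemma₂ : ∀ β c p k → (1ℚ + 1ℚ) * (β * (c * (k * c * p))) + β * (k * (k - 1ℚ) * (c * c) * p) ≡
        (1ℚ + k) * (1ℚ + k - 1ℚ) * (c * c) * (β * p)
      lemma₂ = solve-∀ ℚ-ring

  bernstein : ℕ → ℕ → Expr
  bernstein k m = var :^ k :* 1-var :^ m

  -- x² (1 − x)² times the second derivative of xᵏ (1 − x)ᵐ is bracket k (k + m) x
  -- times xᵏ (1 − x)ᵐ.
  bracket : ℚ → ℚ → ℚ → ℚ
  bracket k n x = k * (k - 1ℚ) - (1ℚ + 1ℚ) * k * (n - 1ℚ) * x + n * (n - 1ℚ) * (x * x)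

  DD-bernstein : ∀ k m x → let q = ⟦ 1-var ⟧ x in
    x * x * (q * q) * ⟦ D (D (bernstein k m)) ⟧ x ≡ ⟦ bernstein k m ⟧ x * bracket (ι k) (ι k + ι m) x
  DD-bernstein k m x = begin
    x * x * (q * q) * (f″ * g + f′ * g′ + (f′ * g′ + f * g″))
      ≡⟨ lemma₁ x q f f′ f″ g g′ g″ ⟩
    x * (x * f″) * (q * q * g) + (1ℚ + 1ℚ) * x * q * ((x * f′) * (q * g′)) + x * x * f * (q * (q * g″))
      ≡⟨ cong₂ (λ s t → s * (q * q * g) + (1ℚ + 1ℚ) * x * q * ((x * f′) * (q * g′)) + x * x * f * t)
           (DD-:^ var (λ _ → refl) (λ _ → refl) k x) (DD-:^ 1-var D1-var DD1-var m x) ⟩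
    κ * (κ - 1ℚ) * (1ℚ * 1ℚ) * f * (q * q * g) + (1ℚ + 1ℚ) * x * q * ((x * f′) * (q * g′))
      + x * x * f * (μ * (μ - 1ℚ) * (- 1ℚ * - 1ℚ) * g)
      ≡⟨ cong₂ (λ s t → κ * (κ - 1ℚ) * (1ℚ * 1ℚ) * f * (q * q * g) + (1ℚ + 1ℚ) * x * q * (s * t)
                        + x * x * f * (μ * (μ - 1ℚ) * (- 1ℚ * - 1ℚ) * g))
           (D-:^ var (λ _ → refl) (λ _ → refl) k x) (D-:^ 1-var D1-var DD1-var m x) ⟩
    κ * (κ - 1ℚ) * (1ℚ * 1ℚ) * f * (q * q * g) + (1ℚ + 1ℚ) * x * q * (κ * 1ℚ * f * (μ * - 1ℚ * g))
      + x * x * f * (μ * (μ - 1ℚ) * (- 1ℚ * - 1ℚ) * g)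
      ≡⟨ lemma₂ κ μ x f g ⟩
    f * g * bracket κ (κ + μ) x ∎
    where
    open ≡-Reasoning
    q = ⟦ 1-var ⟧ x
    κ = ι k
    μ = ι m
    f = ⟦ var :^ k ⟧ x
    f′ = ⟦ D (var :^ k) ⟧ x
    f″ = ⟦ D (D (var :^ k)) ⟧ x
    g = ⟦ 1-var :^ m ⟧ x
    g′ = ⟦ D (1-var :^ m) ⟧ x
    g″ = ⟦ D (D (1-var :^ m)) ⟧ x
    D1-var : ∀ x → ⟦ D 1-var ⟧ x ≡ - 1ℚ
    D1-var = lemma
      where
      lemma : ∀ x → 0ℚ + (0ℚ * x + - 1ℚ * 1ℚ) ≡ - 1ℚ
      lemma = solve-∀ ℚ-ring
    DD1-var : ∀ x → ⟦ D (D 1-var) ⟧ x ≡ 0ℚ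
    DD1-var = lemma
      where
      lemma : ∀ x → 0ℚ + (0ℚ * x + 0ℚ * 1ℚ + (0ℚ * 1ℚ + - 1ℚ * 0ℚ)) ≡ 0ℚ
      lemma = solve-∀ ℚ-ring
    lemma₁ : ∀ x q f f′ f″ g g′ g″ → x * x * (q * q) * (f″ * g + f′ * g′ + (f′ * g′ + f * g″)) ≡
      x * (x * f″) * (q * q * g) + (1ℚ + 1ℚ) * x * q * ((x * f′) * (q * g′)) + x * x * f * (q * (q * g″))
    lemma₁ = solve-∀ ℚ-ring
    lemma₂ : ∀ κ μ x f g → let q = 1ℚ + - 1ℚ * x; n = κ + μ in
      κ * (κ - 1ℚ) * (1ℚ * 1ℚ) * f * (q * q * g) + (1ℚ + 1ℚ) * x * q * (κ * 1ℚ * f * (μ * - 1ℚ * g))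
        + x * x * f * (μ * (μ - 1ℚ) * (- 1ℚ * - 1ℚ) * g)
      ≡ f * g * (κ * (κ - 1ℚ) - (1ℚ + 1ℚ) * κ * (n - 1ℚ) * x + n * (n - 1ℚ) * (x * x))
    lemma₂ = solve-∀ ℚ-ring

open Bernstein

-- Finite sums over all subsets, by size and by prescribed elements.

module SubsetSums where

  open import Defs using (subsets)
  open import Data.Bool using (Bool; true; false; if_then_else_; _∧_)
  open import Data.Fin as Fin using (Fin; zero; suc)
  open import Data.Fin.Subset using (Subset; inside; outside; ∣_∣)
  open import Data.List using (List; []; _∷_; _++_; map; filter; length)
  open import Data.List.Relation.Unary.All using (All; []; _∷_)
  open import Data.List.Relation.Unary.Any using (here; there)
  open import Data.List.Membership.Propositional using (_∈_)
  open import Data.Nat as ℕ using (ℕ; zero; suc; s≤s)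
  import Data.Nat.Properties as ℕ
  open import Data.Rational hiding (∣_∣)
  open import Data.Rational.Properties
  open import Data.Vec using ([]; _∷_; lookup)
  open import Function using (_∘_)
  open import Relation.Binary.PropositionalEquality
  open import Relation.Nullary using (Dec; does)
  open import Relation.Unary using (Decidable)
  open import Tactic.RingSolver using (solve-∀)

  sum : ∀ {A : Set} → (A → ℚ) → List A → ℚ
  sum F []       = 0ℚ
  sum F (a ∷ as) = F a + sum F as

  sum-0 : ∀ {A : Set} as → sum {A} (λ _ → 0ℚ) as ≡ 0ℚ
  sum-0 []       = refl
  sum-0 (a ∷ as) = trans (+-identityˡ _) (sum-0 as)

  module _ {A : Set} where

    sum-++ : ∀ (F : A → ℚ) as bs → sum F (as ++ bs) ≡ sum F as + sum F bs
    sum-++ F []       bs = sym (+-identityˡ (sum F bs))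
    sum-++ F (a ∷ as) bs = trans (cong (F a +_) (sum-++ F as bs)) (sym (+-assoc (F a) (sum F as) (sum F bs)))

    sum-map : ∀ {B : Set} (F : B → ℚ) (g : A → B) as → sum F (map g as) ≡ sum (F ∘ g) as
    sum-map F g []       = refl
    sum-map F g (a ∷ as) = cong (F (g a) +_) (sum-map F g as)

    sum-cong : ∀ {F G : A → ℚ} → (∀ a → F a ≡ G a) → ∀ as → sum F as ≡ sum G as
    sum-cong F≡G []       = refl
    sum-cong F≡G (a ∷ as) = cong₂ _+_ (F≡G a) (sum-cong F≡G as)

    sum-mono : ∀ {F G : A → ℚ} → (∀ a → F a ≤ G a) → ∀ as → sum F as ≤ sum G as
    sum-mono F≤G []       = ≤-refl
    sum-mono F≤G (a ∷ as) = +-mono-≤ (F≤G a) (sum-mono F≤G as)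

    sum-+ : ∀ (F G : A → ℚ) as → sum (λ a → F a + G a) as ≡ sum F as + sum G as
    sum-+ F G []       = refl
    sum-+ F G (a ∷ as) = trans (cong (F a + G a +_) (sum-+ F G as)) (lemma (F a) (G a) (sum F as) (sum G as))
      where
      lemma : ∀ a b c d → a + b + (c + d) ≡ a + c + (b + d)
      lemma = solve-∀ ℚ-ring

    sum-* : ∀ c (F : A → ℚ) as → sum (λ a → c * F a) as ≡ c * sum F as
    sum-* c F []       = sym (*-zeroʳ c)
    sum-* c F (a ∷ as) = trans (cong (c * F a +_) (sum-* c F as)) (sym (*-distribˡ-+ c (F a) (sum F as)))

    sum-- : ∀ (F G : A → ℚ) as → sum (λ a → F a - G a) as ≡ sum F as - sum G as
    sum-- F G []       = refl
    sum-- F G (a ∷ as) = trans (cong (F a - G a +_) (sum-- F G as)) (lemma (F a) (G a) (sum F as) (sum G as))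
      where
      lemma : ∀ a b c d → a - b + (c - d) ≡ a + c - (b + d)
      lemma = solve-∀ ℚ-ring

    sum-swap : ∀ {B : Set} (F : A → B → ℚ) as bs → sum (λ a → sum (F a) bs) as ≡ sum (λ b → sum (λ a → F a b) as) bs
    sum-swap F []       bs = sym (sum-0 bs)
    sum-swap F (a ∷ as) bs = trans (cong (sum (F a) bs +_) (sum-swap F as bs))
      (sym (lemma bs))
      where
      rearrange : ∀ a b c d → a + b + (c + d) ≡ a + c + (b + d)
      rearrange = solve-∀ ℚ-ring
      lemma : ∀ bs → sum (λ b → F a b + sum (λ a → F a b) as) bs ≡ sum (F a) bs + sum (λ b → sum (λ a → F a b) as) bs
      lemma []       = refl
      lemma (b ∷ bs) = trans (cong (F a b + sum (λ a → F a b) as +_) (lemma bs)) (rearrange (F a b) _ _ _)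

    sum-All-const : ∀ {P : A → Set} (F : A → ℚ) {c} → (∀ {a} → P a → F a ≡ c) → ∀ {as} → All P as → sum F as ≡ ι (length as) * c
    sum-All-const F {c} F≡c []               = sym (trans (cong (_* c) ι-0) (*-zeroˡ c))
    sum-All-const F {c} F≡c {a ∷ as} (p ∷ ps) = trans (cong₂ _+_ (F≡c p) (sum-All-const F F≡c ps))
      (trans (lemma c (ι (length as))) (cong (_* c) (sym (ι-suc (length as)))))
      where
      lemma : ∀ c n → c + n * c ≡ (1ℚ + n) * c
      lemma = solve-∀ ℚ-ring

    sum-nonNeg : ∀ {F : A → ℚ} → (∀ a → 0ℚ ≤ F a) → ∀ as → 0ℚ ≤ sum F as
    sum-nonNeg 0≤F as = ≤-trans (≤-reflexive (sym (sum-0 as))) (sum-mono 0≤F as)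

    sum-strict : ∀ {F G : A → ℚ} → (∀ a → F a ≤ G a) → ∀ {a as} → a ∈ as → 1ℚ + F a ≤ G a → 1ℚ + sum F as ≤ sum G as
    sum-strict {F} {G} F≤G {a} {as = _ ∷ as} (here refl) 1+F≤G = ≤-trans (≤-reflexive (sym (+-assoc 1ℚ (F a) (sum F as))))
      (+-mono-≤ 1+F≤G (sum-mono F≤G as))
    sum-strict {F} {G} F≤G {a} {as = b ∷ as} (there a∈as) 1+F≤G = ≤-trans (≤-reflexive (lemma (F b) (sum F as)))
      (+-mono-≤ (F≤G b) (sum-strict F≤G a∈as 1+F≤G))
      where
      lemma : ∀ a b → 1ℚ + (a + b) ≡ a + (1ℚ + b)
      lemma = solve-∀ ℚ-ring

  when : ∀ {P : Set} → Dec P → ℚ → ℚ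
  when P? a = if does P? then a else 0ℚ

  sum-filter : ∀ {A : Set} {P : A → Set} (P? : Decidable P) (F : A → ℚ) as → sum F (filter P? as) ≡ sum (λ a → when (P? a) (F a)) as
  sum-filter P? F []       = refl
  sum-filter P? F (a ∷ as) with does (P? a)
  ... | true  = cong (F a +_) (sum-filter P? F as)
  ... | false = trans (sum-filter P? F as) (sym (+-identityˡ _))

  Σ[_] : ∀ n → (Subset n → ℚ) → ℚ
  Σ[ n ] F = sum F (subsets n)

  Σ-suc : ∀ n F → Σ[ suc n ] F ≡ Σ[ n ] (F ∘ (inside ∷_)) + Σ[ n ] (F ∘ (outside ∷_))
  Σ-suc n F = trans (sum-++ F (map (inside ∷_) (subsets n)) (map (outside ∷_) (subsets n)))
    (cong₂ _+_ (sum-map F (inside ∷_) (subsets n)) (sum-map F (outside ∷_) (subsets n)))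

  -- This is the sum of C(n, k) ψ k over k, and `Σ-size-suc` is Pascal's rule. In all applications ψ
  -- vanishes from size 1, 2 or 4 on, so the closed forms below are explicit polynomials in `ι n`,
  -- within reach of the ring solver.
  Σ-size : ℕ → (ℕ → ℚ) → ℚ
  Σ-size n ψ = Σ[ n ] λ C → ψ ∣ C ∣

  Σ-size-suc : ∀ n ψ → Σ-size (suc n) ψ ≡ Σ-size n (ψ ∘ ℕ.suc) + Σ-size n ψ
  Σ-size-suc n ψ = Σ-suc n λ C → ψ ∣ C ∣

  VanishesFrom : ℕ → (ℕ → ℚ) → Set
  VanishesFrom d ψ = ∀ {k} → d ℕ.≤ k → ψ k ≡ 0ℚ

  vanishes-suc : ∀ {d ψ} → VanishesFrom (suc d) ψ → VanishesFrom d (ψ ∘ ℕ.suc)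
  vanishes-suc ψ≡0 d≤k = ψ≡0 (s≤s d≤k)

  Σ-size-0 : ∀ n ψ → VanishesFrom 0 ψ → Σ-size n ψ ≡ 0ℚ
  Σ-size-0 n ψ ψ≡0 = trans (sum-cong (λ C → ψ≡0 ℕ.z≤n) (subsets n)) (sum-0 (subsets n))

  Σ-size-1 : ∀ n ψ → VanishesFrom 1 ψ → Σ-size n ψ ≡ ψ 0
  Σ-size-1 zero    ψ ψ≡0 = +-identityʳ (ψ 0)
  Σ-size-1 (suc n) ψ ψ≡0 = trans (Σ-size-suc n ψ)
    (trans (cong₂ _+_ (Σ-size-0 n (ψ ∘ ℕ.suc) (vanishes-suc {ψ = ψ} ψ≡0)) (Σ-size-1 n ψ ψ≡0)) (+-identityˡ (ψ 0)))

  Σ-size-2 : ∀ n ψ → VanishesFrom 2 ψ → Σ-size n ψ ≡ ψ 0 + ι n * ψ 1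
  Σ-size-2 zero    ψ ψ≡0 = cong (ψ 0 +_) (sym (trans (cong (_* ψ 1) ι-0) (*-zeroˡ (ψ 1))))
  Σ-size-2 (suc n) ψ ψ≡0 = trans (Σ-size-suc n ψ)
    (trans (cong₂ _+_ (Σ-size-1 n (ψ ∘ ℕ.suc) (vanishes-suc {ψ = ψ} ψ≡0)) (Σ-size-2 n ψ ψ≡0))
    (trans (lemma (ψ 0) (ψ 1) (ι n)) (cong (λ t → ψ 0 + t * ψ 1) (sym (ι-suc n)))))
    where
    lemma : ∀ a b n → b + (a + n * b) ≡ a + (1ℚ + n) * b
    lemma = solve-∀ ℚ-ring

  binom₂ binom₃ : ℚ → ℚ
  binom₂ n = ½ * (n * (n - 1ℚ))
  binom₃ n = ½ * ⅓ * (n * (n - 1ℚ) * (n - (1ℚ + 1ℚ)))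

  Σ-size-3 : ∀ n ψ → VanishesFrom 3 ψ → Σ-size n ψ ≡ ψ 0 + ι n * ψ 1 + binom₂ (ι n) * ψ 2
  Σ-size-3 zero    ψ ψ≡0 = trans (lemma (ψ 0) (ψ 1) (ψ 2)) (cong (λ t → ψ 0 + t * ψ 1 + binom₂ t * ψ 2) (sym ι-0))
    where
    lemma : ∀ a b c → a + 0ℚ ≡ a + 0ℚ * b + ½ * (0ℚ * (0ℚ - 1ℚ)) * c
    lemma = solve-∀ ℚ-ring
  Σ-size-3 (suc n) ψ ψ≡0 = trans (Σ-size-suc n ψ)
    (trans (cong₂ _+_ (Σ-size-2 n (ψ ∘ ℕ.suc) (vanishes-suc {ψ = ψ} ψ≡0)) (Σ-size-3 n ψ ψ≡0))
    (trans (lemma (ψ 0) (ψ 1) (ψ 2) (ι n)) (cong (λ t → ψ 0 + t * ψ 1 + binom₂ t * ψ 2) (sym (ι-suc n)))))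
    where
    lemma : ∀ a b c n → b + n * c + (a + n * b + ½ * (n * (n - 1ℚ)) * c) ≡
      a + (1ℚ + n) * b + ½ * ((1ℚ + n) * (1ℚ + n - 1ℚ)) * c
    lemma = solve-∀ ℚ-ring

  Σ-size-4 : ∀ n ψ → VanishesFrom 4 ψ →
    Σ-size n ψ ≡ ψ 0 + ι n * ψ 1 + binom₂ (ι n) * ψ 2 + binom₃ (ι n) * ψ 3
  Σ-size-4 zero    ψ ψ≡0 = trans (lemma (ψ 0) (ψ 1) (ψ 2) (ψ 3))
    (cong (λ t → ψ 0 + t * ψ 1 + binom₂ t * ψ 2 + binom₃ t * ψ 3) (sym ι-0))
    where
    lemma : ∀ a b c d → a + 0ℚ ≡
      a + 0ℚ * b + ½ * (0ℚ * (0ℚ - 1ℚ)) * c + ½ * ⅓ * (0ℚ * (0ℚ - 1ℚ) * (0ℚ - (1ℚ + 1ℚ))) * d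
    lemma = solve-∀ ℚ-ring
  Σ-size-4 (suc n) ψ ψ≡0 = trans (Σ-size-suc n ψ)
    (trans (cong₂ _+_ (Σ-size-3 n (ψ ∘ ℕ.suc) (vanishes-suc {ψ = ψ} ψ≡0)) (Σ-size-4 n ψ ψ≡0))
    (trans (lemma (ψ 0) (ψ 1) (ψ 2) (ψ 3) (ι n))
           (cong (λ t → ψ 0 + t * ψ 1 + binom₂ t * ψ 2 + binom₃ t * ψ 3) (sym (ι-suc n)))))
    where
    lemma : ∀ a b c d n →
      b + n * c + ½ * (n * (n - 1ℚ)) * d
        + (a + n * b + ½ * (n * (n - 1ℚ)) * c + ½ * ⅓ * (n * (n - 1ℚ) * (n - (1ℚ + 1ℚ))) * d) ≡
      a + (1ℚ + n) * b + ½ * ((1ℚ + n) * (1ℚ + n - 1ℚ)) * c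
        + ½ * ⅓ * ((1ℚ + n) * (1ℚ + n - 1ℚ) * (1ℚ + n - (1ℚ + 1ℚ))) * d
    lemma = solve-∀ ℚ-ring

  χ : Bool → ℚ
  χ b = if b then 1ℚ else 0ℚ

  Σ-containing : ∀ n φ (u : Fin (suc n)) →
    Σ[ suc n ] (λ C → χ (lookup C u) * φ ∣ C ∣) ≡ Σ-size n (φ ∘ ℕ.suc)
  Σ-containing n φ zero = trans (Σ-suc n _)
    (trans (cong₂ _+_ (sum-cong (λ C → *-identityˡ (φ (suc ∣ C ∣))) (subsets n))
                      (trans (sum-cong (λ C → *-zeroˡ (φ ∣ C ∣)) (subsets n)) (sum-0 (subsets n))))
           (+-identityʳ _))
  Σ-containing (suc n) φ (suc u) = trans (Σ-suc (suc n) λ C → χ (lookup C (suc u)) * φ ∣ C ∣)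
    (trans (cong₂ _+_ (Σ-containing n (φ ∘ ℕ.suc) u) (Σ-containing n φ u))
           (sym (Σ-size-suc n (φ ∘ ℕ.suc))))

  -- Deleting u and v leaves an arbitrary subset of the other n vertices, smaller by two. The
  -- induction peels off the first vertex; when that is neither u nor v, Pascal's rule reassembles
  -- the two halves.
  Σ-containing₂ : ∀ n φ (u v : Fin (suc (suc n))) → u Fin.< v →
    Σ[ suc (suc n) ] (λ C → χ (lookup C u ∧ lookup C v) * φ ∣ C ∣) ≡ Σ-size n (φ ∘ ℕ.suc ∘ ℕ.suc)
  Σ-containing₂ n φ zero (suc v) _ = trans (Σ-suc (suc n) λ C → χ (lookup C zero ∧ lookup C (suc v)) * φ ∣ C ∣)
    (trans (cong₂ _+_ (Σ-containing n (φ ∘ ℕ.suc) v)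
                      (trans (sum-cong (λ C → *-zeroˡ (φ ∣ C ∣)) (subsets (suc n))) (sum-0 (subsets (suc n)))))
           (+-identityʳ _))
  Σ-containing₂ zero    φ (suc zero) (suc zero) (s≤s ())
  Σ-containing₂ (suc n) φ (suc u) (suc v) (s≤s u<v) =
    trans (Σ-suc (suc (suc n)) λ C → χ (lookup C (suc u) ∧ lookup C (suc v)) * φ ∣ C ∣)
    (trans (cong₂ _+_ (Σ-containing₂ n (φ ∘ ℕ.suc) u v u<v) (Σ-containing₂ n φ u v u<v))
           (sym (Σ-size-suc n (φ ∘ ℕ.suc ∘ ℕ.suc))))

open SubsetSums

-- Counting edges inside connected sets.

module Edges where

  open import Defs using (Graph; Adj; adj?; symm; irrefl; size; InducedAdj; ConnectedSet; KConnected; subsets)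
  open import Data.Bool using (true; false; _∧_)
  open import Data.Bool.Properties using (¬-not; ∧-zeroʳ)
  open import Data.Fin as Fin using (Fin; zero; suc)
  import Data.Fin.Properties as Fin
  open import Data.Fin.Subset using (Subset; inside; outside; ∣_∣; ⁅_⁆; _∈_; _∉_; _⊆_; ⊥; ∁; Nonempty)
  open import Data.Fin.Subset.Properties using (∣p∣≤n; ∣⁅x⁆∣≡1; x∈⁅x⁆; x∈⁅y⁆⇒x≡y; _∈?_; p⊆q⇒∣p∣≤∣q∣; ∣⊥∣≡0; ∣∁p∣≡n∸∣p∣)
  open import Data.List using (List; []; _∷_; filter; cartesianProduct; allFin)
  open import Data.List.Membership.Propositional using () renaming (_∈_ to _∈ᴸ_)
  open import Data.List.Membership.Propositional.Properties using (∈-filter⁺; ∈-allFin; ∈-cartesianProduct⁺)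
  open import Data.List.Relation.Unary.All.Properties using (all-filter)
  import Data.List.Relation.Unary.All as All
  open import Data.Nat as ℕ using (ℕ; zero; suc; _∸_; s≤s)
  import Data.Nat.Properties as ℕ
  open import Data.Product using (∃-syntax; _×_; _,_; proj₂)
  open import Data.Rational hiding (∣_∣)
  open import Data.Rational.Properties
  open import Data.Vec using ([]; _∷_; lookup; _[_]≔_)
  open import Data.Vec.Properties using ([]=⇒lookup; lookup⇒[]=; lookup∘update; lookup∘update′)
  open import Function using (_∘_)
  open import Relation.Binary.Construct.Closure.ReflexiveTransitive using (Star; ε; _◅_)
  open import Relation.Binary.Definitions using (tri<; tri≈; tri>)
  open import Relation.Binary.PropositionalEquality
  open import Relation.Nullary using (yes; no; contradiction)
  open import Relation.Nullary.Decidable using (_×-dec_; ¬?)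

  edges : ∀ {n} → Graph n → List (Fin n × Fin n)
  edges {n} G = filter (λ (u , v) → (u Fin.<? v) ×-dec adj? G u v)
                       (cartesianProduct (allFin n) (allFin n))

  contains : ∀ {n} → Subset n → Fin n × Fin n → ℚ
  contains C (u , v) = χ (lookup C u ∧ lookup C v)

  edgesIn : ∀ {n} → Graph n → Subset n → ℚ
  edgesIn G C = sum (contains C) (edges G)

  0≤χ : ∀ b → 0ℚ ≤ χ b
  0≤χ true  = 0≤1
  0≤χ false = ≤-refl

  χ≤1 : ∀ b → χ b ≤ 1ℚ
  χ≤1 true  = ≤-refl
  χ≤1 false = 0≤1

  0≤edgesIn : ∀ {n} (G : Graph n) C → 0ℚ ≤ edgesIn G C
  0≤edgesIn G C = sum-nonNeg (λ (u , v) → 0≤χ (lookup C u ∧ lookup C v)) (edges G)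

  edgesIn≤size : ∀ {n} (G : Graph n) C → edgesIn G C ≤ ι (size G)
  edgesIn≤size G C = ≤-trans (sum-mono (λ (u , v) → χ≤1 (lookup C u ∧ lookup C v)) (edges G))
    (≤-reflexive (trans (sum-All-const {P = λ _ → 1ℚ ≡ 1ℚ} (λ _ → 1ℚ) (λ _ → refl) (All.universal (λ _ → refl) (edges G)))
                        (*-identityʳ (ι (size G)))))

  contains-mono : ∀ {n} {S T : Subset n} → S ⊆ T → ∀ e → contains S e ≤ contains T e
  contains-mono {S = S} {T} S⊆T (u , v) with lookup S u in eqᵘ | lookup S v in eqᵛ
  ... | false | _     = 0≤χ (lookup T u ∧ lookup T v)
  ... | true  | false = 0≤χ (lookup T u ∧ lookup T v)
  ... | true  | true  = ≤-reflexive (sym (cong χ (cong₂ _∧_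
    ([]=⇒lookup (S⊆T (lookup⇒[]= u S eqᵘ))) ([]=⇒lookup (S⊆T (lookup⇒[]= v S eqᵛ))))))

  edgesIn-mono : ∀ {n} (G : Graph n) {S T} → S ⊆ T → edgesIn G S ≤ edgesIn G T
  edgesIn-mono G S⊆T = sum-mono (contains-mono S⊆T) (edges G)

  ∉⇒lookup : ∀ {n} {C : Subset n} {u} → u ∉ C → lookup C u ≡ outside
  ∉⇒lookup {C = C} {u} u∉C = ¬-not (u∉C ∘ lookup⇒[]= u C)

  module _ {n} (C : Subset n) (y : Fin n) where

    insert : Subset n
    insert = C [ y ]≔ inside

    ⊆insert : C ⊆ insert
    ⊆insert {u} u∈C with u Fin.≟ y
    ... | yes refl = lookup⇒[]= u insert (lookup∘update u C inside)
    ... | no  u≢y  = lookup⇒[]= u insert (trans (lookup∘update′ u≢y C inside) ([]=⇒lookup u∈C))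

    y∈insert : y ∈ insert
    y∈insert = lookup⇒[]= y insert (lookup∘update y C inside)

    insert⊆ : ∀ {T} → C ⊆ T → y ∈ T → insert ⊆ T
    insert⊆ C⊆T y∈T {u} u∈ with u Fin.≟ y
    ... | yes refl = y∈T
    ... | no  u≢y  = C⊆T (lookup⇒[]= u C (trans (sym (lookup∘update′ u≢y C inside)) ([]=⇒lookup u∈)))

  ∣insert∣ : ∀ {n} (C : Subset n) {y} → y ∉ C → ∣ insert C y ∣ ≡ suc ∣ C ∣
  ∣insert∣ (true  ∷ C) {zero}  y∉C = contradiction (lookup⇒[]= zero (true ∷ C) refl) y∉C
  ∣insert∣ (false ∷ C) {zero}  y∉C = refl
  ∣insert∣ (true  ∷ C) {suc y} y∉C = cong suc (∣insert∣ C (y∉C ∘ there))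
    where open import Data.Vec using (there)
  ∣insert∣ (false ∷ C) {suc y} y∉C = ∣insert∣ C (y∉C ∘ there)
    where open import Data.Vec using (there)

  edgesIn-insert : ∀ {n} (G : Graph n) C {x y} → x ∈ C → y ∉ C → Adj G x y → 1ℚ + edgesIn G C ≤ edgesIn G (insert C y)
  edgesIn-insert {n} G C {x} {y} x∈C y∉C xy with Fin.<-cmp x y
  ... | tri≈ _ x≡y _ = contradiction xy (irrefl G x≡y)
  ... | tri< x<y _ _ = sum-strict (contains-mono (⊆insert C y))
      (∈-filter⁺ (λ (u , v) → (u Fin.<? v) ×-dec adj? G u v) (∈-cartesianProduct⁺ (∈-allFin x) (∈-allFin y)) (x<y , xy))
      (≤-reflexive (trans (cong (1ℚ +_) old) (trans (+-identityʳ 1ℚ) (sym new))))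
    where
    old : contains C (x , y) ≡ 0ℚ
    old = cong χ (trans (cong (lookup C x ∧_) (∉⇒lookup y∉C)) (∧-zeroʳ (lookup C x)))
    new : contains (insert C y) (x , y) ≡ 1ℚ
    new = cong χ (cong₂ _∧_ ([]=⇒lookup (⊆insert C y x∈C)) ([]=⇒lookup (y∈insert C y)))
  ... | tri> _ _ y<x = sum-strict (contains-mono (⊆insert C y))
      (∈-filter⁺ (λ (u , v) → (u Fin.<? v) ×-dec adj? G u v) (∈-cartesianProduct⁺ (∈-allFin y) (∈-allFin x)) (y<x , symm G xy))
      (≤-reflexive (trans (cong (1ℚ +_) old) (trans (+-identityʳ 1ℚ) (sym new))))
    where
    old : contains C (y , x) ≡ 0ℚ
    old = cong (λ b → χ (b ∧ lookup C x)) (∉⇒lookup y∉C)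
    new : contains (insert C y) (y , x) ≡ 1ℚ
    new = cong χ (cong₂ _∧_ ([]=⇒lookup (y∈insert C y)) ([]=⇒lookup (⊆insert C y x∈C)))

  leaving-edge : ∀ {n} (G : Graph n) {C} T {u v} → Star (InducedAdj G C) u v → u ∈ T → v ∉ T →
    ∃[ x ] ∃[ y ] x ∈ T × y ∉ T × y ∈ C × Adj G x y
  leaving-edge G T ε u∈T u∉T = contradiction u∈T u∉T
  leaving-edge G T {u} (_◅_ {j = w} (_ , w∈C , uw) path) u∈T v∉T with w ∈? T
  ... | yes w∈T = leaving-edge G T path w∈T v∉T
  ... | no  w∉T = u , w , u∈T , w∉T , w∈C , uw

  -- A set T ⊆ C, initially a singleton, can be enlarged along an edge leaving it
  -- until it exhausts C.
  connected⇒size≤1+edges : ∀ {n} (G : Graph n) {C} → ConnectedSet G C → ι ∣ C ∣ ≤ 1ℚ + edgesIn G C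
  connected⇒size≤1+edges {n} G {C} ((r , r∈C) , paths) =
    grow n ⁅ r ⁆ (ℕ.m≤n+m n ∣ ⁅ r ⁆ ∣) (λ u∈ → subst (_∈ C) (sym (x∈⁅y⁆⇒x≡y r u∈)) r∈C) (x∈⁅x⁆ r)
      (≤-trans (≤-reflexive (trans (cong ι (∣⁅x⁆∣≡1 r)) ι-1)) (≤-offset refl (0≤edgesIn G ⁅ r ⁆)))
    where
    finish : ∀ T → T ⊆ C → ι ∣ T ∣ ≤ 1ℚ + edgesIn G T → ∣ C ∣ ℕ.≤ ∣ T ∣ → ι ∣ C ∣ ≤ 1ℚ + edgesIn G C
    finish T T⊆C T≤ C≤T = ≤-trans (ι-mono-≤ C≤T) (≤-trans T≤ (+-monoʳ-≤ 1ℚ (edgesIn-mono G T⊆C)))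
    grow : ∀ k T → n ℕ.≤ ∣ T ∣ ℕ.+ k → T ⊆ C → r ∈ T → ι ∣ T ∣ ≤ 1ℚ + edgesIn G T → ι ∣ C ∣ ≤ 1ℚ + edgesIn G C
    -- With no fuel left, T has at least n elements, hence at least as many as C.
    grow zero    T n≤ T⊆C r∈T T≤ =
      finish T T⊆C T≤ (ℕ.≤-trans (∣p∣≤n C) (ℕ.≤-trans n≤ (ℕ.≤-reflexive (ℕ.+-identityʳ ∣ T ∣))))
    grow (suc k) T n≤ T⊆C r∈T T≤ with Fin.any? (λ v → (v ∈? C) ×-dec ¬? (v ∈? T))
    ... | no  none = finish T T⊆C T≤ (p⊆q⇒∣p∣≤∣q∣ C⊆T)
      where
      C⊆T : C ⊆ T
      C⊆T {v} v∈C with v ∈? T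
      ... | yes v∈T = v∈T
      ... | no  v∉T = contradiction (v , v∈C , v∉T) none
    ... | yes (v , v∈C , v∉T) =
      let x , y , x∈T , y∉T , y∈C , xy = leaving-edge G T (paths r v r∈C v∈C) r∈T v∉T
      in grow k (insert T y)
           (ℕ.≤-trans n≤ (ℕ.≤-reflexive (trans (ℕ.+-suc ∣ T ∣ k) (cong (ℕ._+ k) (sym (∣insert∣ T y∉T))))))
           (insert⊆ T y T⊆C y∈C) (⊆insert T y r∈T)
           (≤-trans (≤-reflexive (trans (cong ι (∣insert∣ T y∉T)) (ι-suc ∣ T ∣)))
                    (+-monoʳ-≤ 1ℚ (≤-trans T≤ (edgesIn-insert G T x∈T y∉T xy))))

  -- Double counting of the pairs of a set and an edge inside it.
  Σ-edgesIn : ∀ {n} (G : Graph (suc (suc n))) φ →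
    Σ[ suc (suc n) ] (λ C → edgesIn G C * φ ∣ C ∣) ≡ ι (size G) * Σ-size n (φ ∘ ℕ.suc ∘ ℕ.suc)
  Σ-edgesIn {n} G φ = begin
    Σ[ suc (suc n) ] (λ C → edgesIn G C * φ ∣ C ∣)
      ≡⟨ sum-cong (λ C → trans (*-comm (edgesIn G C) (φ ∣ C ∣))
           (trans (sym (sum-* (φ ∣ C ∣) (contains C) (edges G)))
                  (sum-cong (λ e → *-comm (φ ∣ C ∣) (contains C e)) (edges G)))) (subsets (suc (suc n))) ⟩
    Σ[ suc (suc n) ] (λ C → sum (λ e → contains C e * φ ∣ C ∣) (edges G))
      ≡⟨ sum-swap (λ C e → contains C e * φ ∣ C ∣) (subsets (suc (suc n))) (edges G) ⟩
    sum (λ e → Σ[ suc (suc n) ] (λ C → contains C e * φ ∣ C ∣)) (edges G)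
      ≡⟨ sum-All-const _ (λ {(u , v)} (u<v , _) → Σ-containing₂ n φ u v u<v)
           (all-filter (λ (u , v) → (u Fin.<? v) ×-dec adj? G u v) (cartesianProduct (allFin (suc (suc n))) (allFin (suc (suc n))))) ⟩
    ι (size G) * Σ-size n (φ ∘ ℕ.suc ∘ ℕ.suc) ∎
    where open ≡-Reasoning

  ∣C∣≡0⇒∉ : ∀ {n} {C : Subset n} {u} → ∣ C ∣ ≡ 0 → u ∉ C
  ∣C∣≡0⇒∉ {C = C} {u} ∣C∣≡0 u∈C = contradiction
    (ℕ.≤-trans (ℕ.≤-reflexive (sym (∣⁅x⁆∣≡1 u)))
      (ℕ.≤-trans (p⊆q⇒∣p∣≤∣q∣ (λ v∈ → subst (_∈ C) (sym (x∈⁅y⁆⇒x≡y u v∈)) u∈C)) (ℕ.≤-reflexive ∣C∣≡0))) λ ()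

  connected⇒∣C∣≢0 : ∀ {n} {G : Graph n} {C} → ConnectedSet G C → ∣ C ∣ ≢ 0
  connected⇒∣C∣≢0 ((_ , u∈C) , _) ∣C∣≡0 = ∣C∣≡0⇒∉ ∣C∣≡0 u∈C

  ∣C∣≡1⇒singleton : ∀ {n} {C : Subset n} → ∣ C ∣ ≡ 1 → Nonempty C × (∀ {u v} → u ∈ C → v ∈ C → u ≡ v)
  ∣C∣≡1⇒singleton {C = true ∷ C} ∣C∣≡1 = (zero , here) , unique
    where
    open import Data.Vec using (here; there)
    unique : ∀ {u v} → u ∈ true ∷ C → v ∈ true ∷ C → u ≡ v
    unique here here = refl
    unique here (there v∈C) = contradiction v∈C (∣C∣≡0⇒∉ (ℕ.suc-injective ∣C∣≡1))
    unique (there u∈C) _    = contradiction u∈C (∣C∣≡0⇒∉ (ℕ.suc-injective ∣C∣≡1))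
  ∣C∣≡1⇒singleton {C = false ∷ C} ∣C∣≡1 =
    let (x , x∈C) , unique = ∣C∣≡1⇒singleton ∣C∣≡1
    in (suc x , there x∈C) , λ where (there u∈C) (there v∈C) → cong suc (unique u∈C v∈C)
    where open import Data.Vec using (there)

  singleton-connected : ∀ {n} (G : Graph n) {C} → ∣ C ∣ ≡ 1 → ConnectedSet G C
  singleton-connected G {C} ∣C∣≡1 =
    let nonempty , unique = ∣C∣≡1⇒singleton ∣C∣≡1
    in nonempty , λ u v u∈C v∈C → subst (Star (InducedAdj G C) u) (unique u∈C v∈C) ε

  ∁∁ : ∀ {n} (C : Subset n) → ∁ (∁ C) ≡ C
  ∁∁ []          = refl
  ∁∁ (true  ∷ C) = cong (true ∷_) (∁∁ C)
  ∁∁ (false ∷ C) = cong (false ∷_) (∁∁ C)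

  large-connected : ∀ {n} {G : Graph n} {k C} → KConnected k G → n ∸ ∣ C ∣ ℕ.< k → ConnectedSet G C
  large-connected {G = G} {k} {C} (_ , connected) small =
    subst (ConnectedSet G) (∁∁ C) (connected (∁ C) (subst (ℕ._< k) (sym (∣∁p∣≡n∸∣p∣ C)) small))

  -- Removing the empty set shows that the whole vertex set is connected, so it spans at least n - 1
  -- edges.
  order≤1+size : ∀ {n} (G : Graph n) → KConnected 2 G → n ℕ.≤ suc (size G)
  order≤1+size {n} G conn = ι-cancel-≤ (begin
    ι n                      ≡⟨ cong ι (trans (∣∁p∣≡n∸∣p∣ (⊥ {n})) (cong (n ∸_) (∣⊥∣≡0 n))) ⟨
    ι ∣ ∁ (⊥ {n}) ∣          ≤⟨ connected⇒size≤1+edges G (proj₂ conn ⊥ (subst (ℕ._< 2) (sym (∣⊥∣≡0 n)) (s≤s ℕ.z≤n))) ⟩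
    1ℚ + edgesIn G (∁ ⊥)     ≤⟨ +-monoʳ-≤ 1ℚ (edgesIn≤size G (∁ ⊥)) ⟩
    1ℚ + ι (size G)          ≡⟨ ι-suc (size G) ⟨
    ι (suc (size G))         ∎)
    where open ≤-Reasoning

open Edges

-- The second derivative of the node reliability as a sum over connected sets.

module SecondDerivative where

  open import Defs using (derivative; _⊞_; _⊠_; _↑_; 𝐩; 1-𝐩; Graph; nRel; connectedSets; connectedSet?; ConnectedSet; subsets)
  open import Data.Fin.Subset using (Subset; ∣_∣)
  open import Data.Fin.Subset.Properties using (∣p∣≤n)
  open import Data.List using (List; []; _∷_; map; foldr)
  open import Data.Nat as ℕ using (ℕ; zero; suc; _∸_; s≤s)
  import Data.Nat.Properties as ℕ
  open import Data.Rational hiding (∣_∣)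
  open import Data.Rational.Properties
  open import Relation.Binary.PropositionalEquality
  open import Relation.Nullary using (¬_; Dec; yes; no; contradiction)
  open import Tactic.RingSolver using (solve-∀)

  sumExpr : ∀ {A : Set} → (A → Expr) → List A → Expr
  sumExpr f = foldr (λ a e → f a :+ e) (con 0ℚ)

  sumExpr-eval : ∀ {A : Set} (f : A → Expr) as x → ⟦ sumExpr f as ⟧ x ≡ sum (λ a → ⟦ f a ⟧ x) as
  sumExpr-eval f []       x = refl
  sumExpr-eval f (a ∷ as) x = cong (⟦ f a ⟧ x +_) (sumExpr-eval f as x)

  DD-sumExpr : ∀ {A : Set} (f : A → Expr) as x → ⟦ D (D (sumExpr f as)) ⟧ x ≡ sum (λ a → ⟦ D (D (f a)) ⟧ x) as
  DD-sumExpr f []       x = refl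
  DD-sumExpr f (a ∷ as) x = cong (⟦ D (D (f a)) ⟧ x +_) (DD-sumExpr f as x)

  term : ∀ n → Subset n → Expr
  term n C = bernstein ∣ C ∣ (n ∸ ∣ C ∣)

  toExpr-nRel : ∀ {n} (G : Graph n) → toExpr (nRel G) ≈ sumExpr (term n) (connectedSets G)
  toExpr-nRel {n} G = go (connectedSets G)
    where
    lemma₁ : ∀ x → 0ℚ + x * (1ℚ + x * 0ℚ) ≡ x
    lemma₁ = solve-∀ ℚ-ring
    lemma₂ : ∀ x → 1ℚ + x * (- 1ℚ + x * 0ℚ) ≡ 1ℚ + - 1ℚ * x
    lemma₂ = solve-∀ ℚ-ring
    go : ∀ Cs → toExpr (foldr _⊞_ [] (map (λ C → (𝐩 ↑ ∣ C ∣) ⊠ (1-𝐩 ↑ (n ∸ ∣ C ∣))) Cs)) ≈ sumExpr (term n) Cs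
    go []       x = refl
    go (C ∷ Cs) x = trans (toExpr-⊞ ((𝐩 ↑ k) ⊠ (1-𝐩 ↑ m)) _ x)
      (cong₂ _+_ (trans (toExpr-⊠ (𝐩 ↑ k) (1-𝐩 ↑ m) x)
                        (cong₂ _*_ (trans (toExpr-↑ 𝐩 k x) (:^-cong {toExpr 𝐩} {var} k lemma₁ x))
                                   (trans (toExpr-↑ 1-𝐩 m x) (:^-cong {toExpr 1-𝐩} {1-var} m lemma₂ x))))
                 (go Cs x))
      where
      k = ∣ C ∣
      m = n ∸ ∣ C ∣

  weight curvature : ℕ → ℚ → ℕ → ℚ
  weight n x k = ⟦ bernstein k (n ∸ k) ⟧ x
  curvature n x k = weight n x k * bracket (ι k) (ι n) x

  scale : ℚ → ℚ
  scale x = x * x * (⟦ 1-var ⟧ x * ⟦ 1-var ⟧ x)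

  scaled-DD-term : ∀ n x (C : Subset n) → scale x * ⟦ D (D (term n C)) ⟧ x ≡ curvature n x ∣ C ∣
  scaled-DD-term n x C = trans (DD-bernstein ∣ C ∣ (n ∸ ∣ C ∣) x)
    (cong (λ t → weight n x ∣ C ∣ * bracket (ι ∣ C ∣) t x)
          (trans (sym (ι-+ ∣ C ∣ (n ∸ ∣ C ∣))) (cong ι (ℕ.m+[n∸m]≡n (∣p∣≤n C)))))

  scaled-DD-sum : ∀ n x Cs → scale x * ⟦ D (D (sumExpr (term n) Cs)) ⟧ x ≡ sum (λ C → curvature n x ∣ C ∣) Cs
  scaled-DD-sum n x Cs = begin
    scale x * ⟦ D (D (sumExpr (term n) Cs)) ⟧ x           ≡⟨ cong (scale x *_) (DD-sumExpr (term n) Cs x) ⟩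
    scale x * sum (λ C → ⟦ D (D (term n C)) ⟧ x) Cs       ≡⟨ sum-* (scale x) (λ C → ⟦ D (D (term n C)) ⟧ x) Cs ⟨
    sum (λ C → scale x * ⟦ D (D (term n C)) ⟧ x) Cs       ≡⟨ sum-cong (scaled-DD-term n x) Cs ⟩
    sum (λ C → curvature n x ∣ C ∣) Cs                    ∎
    where open ≡-Reasoning

  nRel″ : ∀ {n} → Graph n → Expr
  nRel″ G = toExpr (derivative (derivative (nRel G)))

  scaled-nRel″ : ∀ {n} (G : Graph n) x →
    scale x * ⟦ nRel″ G ⟧ x ≡ Σ[ n ] (λ C → when (connectedSet? G C) (curvature n x ∣ C ∣))
  scaled-nRel″ {n} G x = begin
    scale x * ⟦ nRel″ G ⟧ x
      ≡⟨ cong (scale x *_) (toExpr-derivative (derivative (nRel G)) x) ⟩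
    scale x * ⟦ D (toExpr (derivative (nRel G))) ⟧ x
      ≡⟨ cong (scale x *_) (D-cong {toExpr (derivative (nRel G))} {D S} first x) ⟩
    scale x * ⟦ D (D S) ⟧ x
      ≡⟨ scaled-DD-sum n x (connectedSets G) ⟩
    sum (λ C → curvature n x ∣ C ∣) (connectedSets G)
      ≡⟨ sum-filter (connectedSet? G) (λ C → curvature n x ∣ C ∣) (subsets n) ⟩
    Σ[ n ] (λ C → when (connectedSet? G C) (curvature n x ∣ C ∣)) ∎
    where
    open ≡-Reasoning
    S = sumExpr (term n) (connectedSets G)
    first : toExpr (derivative (nRel G)) ≈ D S
    first y = trans (toExpr-derivative (nRel G) y) (D-cong {toExpr (nRel G)} {S} (toExpr-nRel G) y)

  -- The binomial expansion of (x + (1 - x))ⁿ, obtained by splitting on whether the first vertex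
  -- belongs to the set.
  Σ-weight : ∀ n x → Σ[ n ] (λ C → weight n x ∣ C ∣) ≡ 1ℚ
  Σ-weight zero    x = refl
  Σ-weight (suc n) x = begin
    Σ[ suc n ] (λ C → weight (suc n) x ∣ C ∣)
      ≡⟨ Σ-suc n (λ C → weight (suc n) x ∣ C ∣) ⟩
    Σ[ n ] (λ C → weight (suc n) x (suc ∣ C ∣)) + Σ[ n ] (λ C → weight (suc n) x ∣ C ∣)
      ≡⟨ cong₂ _+_ (sum-cong inner (subsets n)) (sum-cong outer (subsets n)) ⟩
    Σ[ n ] (λ C → x * weight n x ∣ C ∣) + Σ[ n ] (λ C → ⟦ 1-var ⟧ x * weight n x ∣ C ∣)
      ≡⟨ cong₂ _+_ (sum-* x _ (subsets n)) (sum-* (⟦ 1-var ⟧ x) _ (subsets n)) ⟩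
    x * Σ[ n ] (λ C → weight n x ∣ C ∣) + ⟦ 1-var ⟧ x * Σ[ n ] (λ C → weight n x ∣ C ∣)
      ≡⟨ cong (λ t → x * t + ⟦ 1-var ⟧ x * t) (Σ-weight n x) ⟩
    x * 1ℚ + ⟦ 1-var ⟧ x * 1ℚ
      ≡⟨ lemma x ⟩
    1ℚ ∎
    where
    open ≡-Reasoning
    lemma : ∀ x → x * 1ℚ + (1ℚ + - 1ℚ * x) * 1ℚ ≡ 1ℚ
    lemma = solve-∀ ℚ-ring
    swap : ∀ p q r → p * (q * r) ≡ q * (p * r)
    swap = solve-∀ ℚ-ring
    inner : ∀ C → weight (suc n) x (suc ∣ C ∣) ≡ x * weight n x ∣ C ∣
    inner C = *-assoc x _ _
    outer : ∀ C → weight (suc n) x ∣ C ∣ ≡ ⟦ 1-var ⟧ x * weight n x ∣ C ∣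
    outer C = trans (cong (λ m → ⟦ bernstein ∣ C ∣ m ⟧ x) (ℕ.+-∸-assoc 1 (∣p∣≤n C)))
                    (swap (⟦ var :^ ∣ C ∣ ⟧ x) (⟦ 1-var ⟧ x) (⟦ 1-var :^ (n ∸ ∣ C ∣) ⟧ x))

  -- The weights of all subsets sum to the constant polynomial 1.
  Σ-curvature : ∀ n x → Σ[ n ] (λ C → curvature n x ∣ C ∣) ≡ 0ℚ
  Σ-curvature n x = begin
    Σ[ n ] (λ C → curvature n x ∣ C ∣)   ≡⟨ scaled-DD-sum n x (subsets n) ⟨
    scale x * ⟦ D (D S) ⟧ x              ≡⟨ cong (scale x *_) (D-cong {D S} {con 0ℚ} (D-cong {S} {con 1ℚ} S≈1) x) ⟩
    scale x * 0ℚ                         ≡⟨ *-zeroʳ (scale x) ⟩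
    0ℚ                                   ∎
    where
    open ≡-Reasoning
    S = sumExpr (term n) (subsets n)
    S≈1 : S ≈ con 1ℚ
    S≈1 y = trans (sumExpr-eval (term n) (subsets n) y) (Σ-weight n y)

  when-≤ : ∀ {P : Set} (P? : Dec P) {a b} → (P → a ≤ b) → (¬ P → 0ℚ ≤ b) → when P? a ≤ b
  when-≤ (yes p) a≤b 0≤b = a≤b p
  when-≤ (no ¬p) a≤b 0≤b = 0≤b ¬p

  ≤-when : ∀ {P : Set} (P? : Dec P) {a b} → (P → b ≤ a) → (¬ P → b ≤ 0ℚ) → b ≤ when P? a
  ≤-when (yes p) b≤a b≤0 = b≤a p
  ≤-when (no ¬p) b≤a b≤0 = b≤0 ¬p

  1-var-pos : ∀ {x} → x < 1ℚ → 0ℚ < ⟦ 1-var ⟧ x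
  1-var-pos {x} x<1 = <-≤-trans (0<q-p x<1) (≤-reflexive (sym (1-var-eval x)))

  scale-pos : ∀ {x} → 0ℚ < x → x < 1ℚ → 0ℚ < scale x
  scale-pos 0<x x<1 = *-pos (*-pos 0<x 0<x) (*-pos (1-var-pos x<1) (1-var-pos x<1))

  weight-pos : ∀ n {x} → 0ℚ < x → x < 1ℚ → ∀ k → 0ℚ < weight n x k
  weight-pos n 0<x x<1 k = *-pos (:^-pos var k 0<x) (:^-pos 1-var (n ∸ k) (1-var-pos x<1))

  -- The connected sets contribute the negative of what the disconnected ones do.
  nRel″-negative : ∀ {n} (G : Graph (suc (suc n))) {x} → 0ℚ < x → x < 1ℚ →
    (∀ C → ¬ ConnectedSet G C → 0ℚ ≤ bracket (ι ∣ C ∣) (ι (suc (suc n))) x) → ⟦ nRel″ G ⟧ x < 0ℚ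
  nRel″-negative {n′} G {x} 0<x x<1 disconnected =
    ≰⇒> λ 0≤f → <-irrefl refl (<-≤-trans negative-sum
      (≤-trans (*-nonNeg (<⇒≤ (scale-pos 0<x x<1)) 0≤f) (≤-reflexive (scaled-nRel″ G x))))
    where
    n = suc (suc n′)
    -- The empty set is not connected and its bracket n N x² is positive. Splitting off its
    -- contribution makes the final inequality strict.
    ψ : ℕ → ℚ
    ψ zero    = curvature n x 0
    ψ (suc _) = 0ℚ
    0<ψ0 : 0ℚ < ψ 0
    0<ψ0 = *-pos (weight-pos n 0<x x<1 0) (<-≤-trans
      (*-pos (*-pos (0<ι (suc n′)) (0<ι n′)) (*-pos 0<x 0<x))
      (≤-reflexive (trans (lemma (ι (suc n′)) (ι n) x (ι-suc (suc n′))) (cong (λ t → bracket t (ι n) x) (sym ι-0)))))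
      where
      ring : ∀ N x → (1ℚ + N) * N * (x * x) ≡
        0ℚ * (0ℚ - 1ℚ) - (1ℚ + 1ℚ) * 0ℚ * (1ℚ + N - 1ℚ) * x + (1ℚ + N) * (1ℚ + N - 1ℚ) * (x * x)
      ring = solve-∀ ℚ-ring
      lemma : ∀ N n x → n ≡ 1ℚ + N → n * N * (x * x) ≡ bracket 0ℚ n x
      lemma N _ x refl = ring N x
    p-0 : ∀ p → p - 0ℚ ≡ p
    p-0 = solve-∀ ℚ-ring
    connected-case : ∀ k → k ≢ 0 → curvature n x k ≤ curvature n x k - ψ k
    connected-case zero    k≢0 = contradiction refl k≢0
    connected-case (suc k) _   = ≤-reflexive (sym (p-0 (curvature n x (suc k))))
    disconnected-case : ∀ k → 0ℚ ≤ bracket (ι k) (ι n) x → 0ℚ ≤ curvature n x k - ψ k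
    disconnected-case zero    _   = ≤-reflexive (sym (+-inverseʳ (curvature n x 0)))
    disconnected-case (suc k) 0≤b = ≤-trans (*-nonNeg (<⇒≤ (weight-pos n 0<x x<1 (suc k))) 0≤b)
                                            (≤-reflexive (sym (p-0 (curvature n x (suc k)))))
    0-p : ∀ p → 0ℚ ≡ 0ℚ - p + p
    0-p = solve-∀ ℚ-ring
    negative-sum : Σ[ n ] (λ C → when (connectedSet? G C) (curvature n x ∣ C ∣)) < 0ℚ
    negative-sum = ≤-<-trans
      (≤-trans (sum-mono (λ C → when-≤ (connectedSet? G C)
                  (λ c → connected-case ∣ C ∣ (connected⇒∣C∣≢0 {G = G} c))
                  (λ ¬c → disconnected-case ∣ C ∣ (disconnected C ¬c))) (subsets n))
        (≤-reflexive (trans (sum-- (λ C → curvature n x ∣ C ∣) (λ C → ψ ∣ C ∣) (subsets n))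
          (cong₂ _-_ (Σ-curvature n x) (Σ-size-1 n ψ (λ where (s≤s _) → refl))))))
      (<-offset (0-p (ψ 0)) 0<ψ0)

open SecondDerivative

-- Negativity of the second derivative near 0 and near 1.

module NegativePoints where

  open import Defs using (Graph; KConnected)
  open import Data.Fin.Subset using (∣_∣)
  open import Data.Fin.Subset.Properties using (∣p∣≤n)
  open import Data.Nat as ℕ using (ℕ; zero; suc; _∸_; s≤s)
  import Data.Nat.Properties as ℕ
  open import Data.Rational hiding (∣_∣)
  open import Data.Rational.Properties
  open import Relation.Binary.PropositionalEquality
  open import Relation.Nullary using (contradiction)
  open import Tactic.RingSolver using (solve-∀)

  module _ {N} {h : ℚ} (0<h : 0ℚ < h) (2Nh≡1 : (1ℚ + 1ℚ) * ι N * h ≡ 1ℚ) where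

    private
      n = suc N

    -- Since 2 N h = 1, the bracket equals j (j - 2) + n N h², and among the natural numbers j (j -
    -- 2) is negative only at j = 1.
    bracket-h : ∀ j → j ≢ 1 → 0ℚ ≤ bracket (ι j) (ι n) h
    bracket-h j j≢1 = ≤-trans (+-nonNeg (j[j-2] j j≢1) (*-nonNeg (*-nonNeg (0≤ι n) (0≤ι N)) (*-nonNeg (<⇒≤ 0<h) (<⇒≤ 0<h))))
      (≤-reflexive (begin
        ι j * (ι j - (1ℚ + 1ℚ)) + ι n * ι N * (h * h)
          ≡⟨ lemma₁ (ι j) (ι n) (ι N) h ⟩
        ι j * (ι j - 1ℚ) - ι j * 1ℚ + ι n * ι N * (h * h)
          ≡⟨ cong (λ t → ι j * (ι j - 1ℚ) - ι j * t + ι n * ι N * (h * h)) 2Nh≡1 ⟨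
        ι j * (ι j - 1ℚ) - ι j * ((1ℚ + 1ℚ) * ι N * h) + ι n * ι N * (h * h)
          ≡⟨ lemma₂ (ι j) (ι n) (ι N) h ⟩
        ι j * (ι j - 1ℚ) - (1ℚ + 1ℚ) * ι j * (1ℚ + ι N - 1ℚ) * h + ι n * (1ℚ + ι N - 1ℚ) * (h * h)
          ≡⟨ cong (λ t → ι j * (ι j - 1ℚ) - (1ℚ + 1ℚ) * ι j * (t - 1ℚ) * h + ι n * (t - 1ℚ) * (h * h)) (ι-suc N) ⟨
        bracket (ι j) (ι n) h ∎))
      where
      open ≡-Reasoning
      lemma₁ : ∀ j n N h → j * (j - (1ℚ + 1ℚ)) + n * N * (h * h) ≡ j * (j - 1ℚ) - j * 1ℚ + n * N * (h * h)
      lemma₁ = solve-∀ ℚ-ring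
      lemma₂ : ∀ j n N h → j * (j - 1ℚ) - j * ((1ℚ + 1ℚ) * N * h) + n * N * (h * h) ≡
        j * (j - 1ℚ) - (1ℚ + 1ℚ) * j * (1ℚ + N - 1ℚ) * h + n * (1ℚ + N - 1ℚ) * (h * h)
      lemma₂ = solve-∀ ℚ-ring
      lemma₃ : ∀ j → (1ℚ + (1ℚ + j)) * j ≡ (1ℚ + (1ℚ + j)) * (1ℚ + (1ℚ + j) - (1ℚ + 1ℚ))
      lemma₃ = solve-∀ ℚ-ring
      j[j-2] : ∀ j → j ≢ 1 → 0ℚ ≤ ι j * (ι j - (1ℚ + 1ℚ))
      j[j-2] zero          _   = ≤-reflexive (cong (λ t → t * (t - (1ℚ + 1ℚ))) (sym ι-0))
      j[j-2] (suc zero)    j≢1 = contradiction refl j≢1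
      j[j-2] (suc (suc j)) _   = ≤-trans
        (*-nonNeg (+-nonNeg 0≤1 (+-nonNeg 0≤1 (0≤ι j))) (0≤ι j))
        (≤-reflexive (trans (lemma₃ (ι j))
          (cong (λ t → t * (t - (1ℚ + 1ℚ))) (sym (trans (ι-suc (suc j)) (cong (1ℚ +_) (ι-suc j)))))))

  -- Passing to complements exchanges x and 1 - x; this carries the estimate at h over to 1 - h.
  bracket-reflect : ∀ k n x → bracket (n - k) n x ≡ bracket k n (1ℚ - x)
  bracket-reflect = lemma
    where
    lemma : ∀ k n x →
      (n - k) * (n - k - 1ℚ) - (1ℚ + 1ℚ) * (n - k) * (n - 1ℚ) * x + n * (n - 1ℚ) * (x * x) ≡
      k * (k - 1ℚ) - (1ℚ + 1ℚ) * k * (n - 1ℚ) * (1ℚ - x) + n * (n - 1ℚ) * ((1ℚ - x) * (1ℚ - x))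
    lemma = solve-∀ ℚ-ring

  module _ {N} (G : Graph (suc (suc N))) {h : ℚ} (0<h : 0ℚ < h) (h<1 : h < 1ℚ)
           (2Nh≡1 : (1ℚ + 1ℚ) * ι (suc N) * h ≡ 1ℚ) where

    private
      n = suc (suc N)

    negative-near-0 : ⟦ nRel″ G ⟧ h < 0ℚ
    negative-near-0 = nRel″-negative G 0<h h<1 λ C ¬c →
      bracket-h {suc N} 0<h 2Nh≡1 ∣ C ∣ λ ∣C∣≡1 → ¬c (singleton-connected G ∣C∣≡1)

    negative-near-1 : KConnected 2 G → ⟦ nRel″ G ⟧ (1ℚ - h) < 0ℚ
    negative-near-1 conn = nRel″-negative G (0<q-p h<1) (<-offset (lemma h) 0<h) λ C ¬c →
      ≤-trans (bracket-h {suc N} 0<h 2Nh≡1 (n ∸ ∣ C ∣)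
                λ n∸C≡1 → ¬c (large-connected {G = G} conn (s≤s (ℕ.≤-reflexive n∸C≡1))))
              (≤-reflexive (trans (cong (λ t → bracket t (ι n) h) (ι-∸ (∣p∣≤n C))) (bracket-reflect (ι ∣ C ∣) (ι n) h)))
      where
      lemma : ∀ h → 1ℚ ≡ 1ℚ - h + h
      lemma = solve-∀ ℚ-ring
      lemma₂ : ∀ a b → b ≡ a + b - a
      lemma₂ = solve-∀ ℚ-ring
      ι-∸ : ∀ {m n} → m ℕ.≤ n → ι (n ∸ m) ≡ ι n - ι m
      ι-∸ {m} {n} m≤n = trans (lemma₂ (ι m) (ι (n ∸ m)))
        (cong (_- ι m) (trans (sym (ι-+ m (n ∸ m))) (cong ι (ℕ.m+[n∸m]≡n m≤n))))

open NegativePoints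

-- Positivity of the second derivative at 3/N.

module PositivePoint where

  open import Defs using (Graph; size; connectedSet?; subsets)
  open import Data.Fin.Subset using (∣_∣)
  import Data.Integer as ℤ
  open import Data.Nat as ℕ using (ℕ; suc; s≤s)
  import Data.Nat.Properties as ℕ
  open import Data.Rational hiding (∣_∣)
  open import Data.Rational.Properties
  open import Function using (_∘_)
  open import Relation.Binary.PropositionalEquality
  open import Relation.Nullary using (contradiction)
  open import Tactic.RingSolver using (solve-∀)

  -- Unlike the opaque `ι`, these literals reduce to constants with which the ring solver can
  -- compute.
  #_ : ℕ → ℚ
  # k = ℤ.+ k / 1

  infix 9 #_

  -- The graph has 11 + t vertices and the second derivative is evaluated at
  -- 3 y = 3 / (10 + t).
  module _ (t : ℕ) (G : Graph (11 ℕ.+ t)) {y : ℚ} (0<y : 0ℚ < y) (Ny≡1 : (# 10 + ι t) * y ≡ 1ℚ)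
           (sparse : ι (size G) ≤ ℤ.+ 851 / 10000 * (ι (11 ℕ.+ t) * ι (11 ℕ.+ t))) where

    private
      n = 11 ℕ.+ t
      T = ι t
      x = # 3 * y
      q = ⟦ 1-var ⟧ x
      -- M is N - 3, so that 1 - x = M y.
      M = # 7 + T
      m̂ = ι (size G)

      0≤T : 0ℚ ≤ T
      0≤T = 0≤ι t

      0<M : 0ℚ < M
      0<M = +-pos-nonNeg (positive⁻¹ (# 7)) 0≤T

      0≤1+T : 0ℚ ≤ 1ℚ + T
      0≤1+T = +-nonNeg 0≤1 0≤T

      0<x : 0ℚ < x
      0<x = *-pos (positive⁻¹ (# 3)) 0<y

      n̂≡ : ι n ≡ # 11 + T
      n̂≡ = trans (ι-+ 11 t) (cong (_+ T) (ι≡ 11))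

      q≡My : q ≡ M * y
      q≡My = trans (cong (_+ - 1ℚ * (# 3 * y)) (sym Ny≡1)) (lemma T y)
        where
        lemma : ∀ T y → (# 10 + T) * y + - 1ℚ * (# 3 * y) ≡ (# 7 + T) * y
        lemma = solve-∀ ℚ-ring

      0<q : 0ℚ < q
      0<q = <-≤-trans (*-pos 0<M 0<y) (≤-reflexive (sym q≡My))

    x<1 : x < 1ℚ
    x<1 = <-offset (lemma x) 0<q
      where
      lemma : ∀ x → 1ℚ ≡ x + (1ℚ + - 1ℚ * x)
      lemma = solve-∀ ℚ-ring

    private
      bracket-x : ∀ k → bracket (ι k) (ι n) x ≡ ι k * ι k - # 7 * ι k + # 9 + # 9 * y
      bracket-x k = begin
        bracket κ (ι n) x
          ≡⟨ cong (λ v → bracket κ v x) n̂≡ ⟩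
        bracket κ (# 11 + T) (# 3 * y)
          ≡⟨ lemma₁ κ T y ⟩
        κ * (κ - 1ℚ) - # 6 * κ * ((# 10 + T) * y) + # 9 * ((# 10 + T) * y * ((# 10 + T) * y) + (# 10 + T) * y * y)
          ≡⟨ cong (λ s → κ * (κ - 1ℚ) - # 6 * κ * s + # 9 * (s * s + s * y)) Ny≡1 ⟩
        κ * (κ - 1ℚ) - # 6 * κ * 1ℚ + # 9 * (1ℚ * 1ℚ + 1ℚ * y)
          ≡⟨ lemma₂ κ y ⟩
        κ * κ - # 7 * κ + # 9 + # 9 * y ∎
        where
        open ≡-Reasoning
        κ = ι k
        lemma₁ : ∀ κ T y → κ * (κ - 1ℚ) - (1ℚ + 1ℚ) * κ * (# 11 + T - 1ℚ) * (# 3 * y)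
            + (# 11 + T) * (# 11 + T - 1ℚ) * (# 3 * y * (# 3 * y)) ≡
          κ * (κ - 1ℚ) - # 6 * κ * ((# 10 + T) * y) + # 9 * ((# 10 + T) * y * ((# 10 + T) * y) + (# 10 + T) * y * y)
        lemma₁ = solve-∀ ℚ-ring
        lemma₂ : ∀ κ y → κ * (κ - 1ℚ) - # 6 * κ * 1ℚ + # 9 * (1ℚ * 1ℚ + 1ℚ * y) ≡ κ * κ - # 7 * κ + # 9 + # 9 * y
        lemma₂ = solve-∀ ℚ-ring

      -- The brackets of the sizes 2, …, 5 are negative; loss k is their absolute
      -- value divided by k − 1, the number of edges of a tree.
      loss : ℕ → ℚ
      loss 2 = (1ℚ + T) * y
      loss 3 = # 3 * ½ * (M * y)
      loss 4 = M * y
      loss 5 = ¼ * ((1ℚ + T) * y)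
      loss _ = 0ℚ

      0≤My = <⇒≤ (*-pos 0<M 0<y)
      0≤[1+T]y = *-nonNeg 0≤1+T (<⇒≤ 0<y)

      0≤loss : ∀ k → 0ℚ ≤ loss k
      0≤loss 0 = ≤-refl
      0≤loss 1 = ≤-refl
      0≤loss 2 = 0≤[1+T]y
      0≤loss 3 = *-nonNeg {# 3 * ½} (≤ᵇ⇒≤ _) 0≤My
      0≤loss 4 = 0≤My
      0≤loss 5 = *-nonNeg {¼} (≤ᵇ⇒≤ _) 0≤[1+T]y
      0≤loss (suc (suc (suc (suc (suc (suc _)))))) = ≤-refl

      gain : ℕ → ℚ
      gain 1 = # 3 + # 9 * y
      gain _ = 0ℚ

      -- Multiplying the constant part by N y = 1 turns the whole bracket into a multiple of y, the
      -- form in which `loss` is given.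
      bracket-literal : ∀ k → bracket (ι k) (ι n) x ≡ (# k * # k - # 7 * # k + # 9) * ((# 10 + T) * y) + # 9 * y
      bracket-literal k = trans (bracket-x k) (trans (cong (λ κ → κ * κ - # 7 * κ + # 9 + # 9 * y) (ι≡ k))
        (cong (_+ # 9 * y) (trans (sym (*-identityʳ c)) (cong (c *_) (sym Ny≡1)))))
        where c = # k * # k - # 7 * # k + # 9

      bracket≡-loss : ∀ k → 2 ℕ.≤ k → k ℕ.≤ 5 → bracket (ι k) (ι n) x ≡ - ((# k - 1ℚ) * loss k)
      bracket≡-loss 0 () _
      bracket≡-loss 1 (s≤s ()) _
      bracket≡-loss 2 _ _ = trans (bracket-literal 2) (lemma T y)
        where
        lemma : ∀ T y → (# 2 * # 2 - # 7 * # 2 + # 9) * ((# 10 + T) * y) + # 9 * y ≡ - ((# 2 - 1ℚ) * ((1ℚ + T) * y))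
        lemma = solve-∀ ℚ-ring
      bracket≡-loss 3 _ _ = trans (bracket-literal 3) (lemma T y)
        where
        lemma : ∀ T y → (# 3 * # 3 - # 7 * # 3 + # 9) * ((# 10 + T) * y) + # 9 * y ≡
          - ((# 3 - 1ℚ) * (# 3 * ½ * ((# 7 + T) * y)))
        lemma = solve-∀ ℚ-ring
      bracket≡-loss 4 _ _ = trans (bracket-literal 4) (lemma T y)
        where
        lemma : ∀ T y → (# 4 * # 4 - # 7 * # 4 + # 9) * ((# 10 + T) * y) + # 9 * y ≡ - ((# 4 - 1ℚ) * ((# 7 + T) * y))
        lemma = solve-∀ ℚ-ring
      bracket≡-loss 5 _ _ = trans (bracket-literal 5) (lemma T y)
        where
        lemma : ∀ T y → (# 5 * # 5 - # 7 * # 5 + # 9) * ((# 10 + T) * y) + # 9 * y ≡ - ((# 5 - 1ℚ) * (¼ * ((1ℚ + T) * y)))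
        lemma = solve-∀ ℚ-ring
      bracket≡-loss (suc (suc (suc (suc (suc (suc _)))))) _ (s≤s (s≤s (s≤s (s≤s (s≤s ())))))

      0-e*0 : ∀ e → 0ℚ - e * 0ℚ ≡ 0ℚ
      0-e*0 = solve-∀ ℚ-ring

      0≤9y : 0ℚ ≤ # 9 * y
      0≤9y = *-nonNeg {# 9} (≤ᵇ⇒≤ _) (<⇒≤ 0<y)

      -- A connected set of size k spans e ≥ k - 1 edges, so charging `loss k` to each of them
      -- covers the negative bracket. An unknown number of connected sets is thereby replaced by
      -- edge counts, which double counting sums exactly.
      tree-bound : ∀ k e → 2 ℕ.≤ k → k ℕ.≤ 5 → ι k ≤ 1ℚ + e → 0ℚ - e * loss k ≤ bracket (ι k) (ι n) x
      tree-bound k e 2≤k k≤5 k≤1+e = ≤-offset (trans (bracket≡-loss k 2≤k k≤5) (lemma (# k) e (loss k)))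
        (*-nonNeg (0≤q-p (≤-trans (≤-reflexive (sym (ι≡ k))) k≤1+e)) (0≤loss k))
        where
        lemma : ∀ κ e l → - ((κ - 1ℚ) * l) ≡ 0ℚ - e * l + (1ℚ + e - κ) * l
        lemma = solve-∀ ℚ-ring

      bracket-bound : ∀ k e → ι k ≤ 1ℚ + e → gain k - e * loss k ≤ bracket (ι k) (ι n) x
      bracket-bound 0 e _ = ≤-trans (≤-reflexive (0-e*0 e))
        (≤-trans (+-nonNeg {# 9} (≤ᵇ⇒≤ _) 0≤9y)
                 (≤-reflexive (sym (trans (bracket-x 0) (cong (λ κ → κ * κ - # 7 * κ + # 9 + # 9 * y) (ι≡ 0))))))
      bracket-bound 1 e _ = ≤-reflexive (trans (lemma (# 9 * y) e)
        (sym (trans (bracket-x 1) (cong (λ κ → κ * κ - # 7 * κ + # 9 + # 9 * y) (ι≡ 1)))))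
        where
        lemma : ∀ z e → # 3 + z - e * 0ℚ ≡ 1ℚ * 1ℚ - # 7 * 1ℚ + # 9 + z
        lemma = solve-∀ ℚ-ring
      bracket-bound 2 e = tree-bound 2 e (ℕ.≤ᵇ⇒≤ 2 2 _) (ℕ.≤ᵇ⇒≤ 2 5 _)
      bracket-bound 3 e = tree-bound 3 e (ℕ.≤ᵇ⇒≤ 2 3 _) (ℕ.≤ᵇ⇒≤ 3 5 _)
      bracket-bound 4 e = tree-bound 4 e (ℕ.≤ᵇ⇒≤ 2 4 _) (ℕ.≤ᵇ⇒≤ 4 5 _)
      bracket-bound 5 e = tree-bound 5 e (ℕ.≤ᵇ⇒≤ 2 5 _) (ℕ.≤ᵇ⇒≤ 5 5 _)
      bracket-bound k@(suc (suc (suc (suc (suc (suc j)))))) e _ = ≤-trans (≤-reflexive (0-e*0 e))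
        (≤-trans (+-nonNeg (+-nonNeg {# 3} (≤ᵇ⇒≤ _) (+-nonNeg (*-nonNeg {# 5} (≤ᵇ⇒≤ _) (0≤ι j)) (*-nonNeg (0≤ι j) (0≤ι j)))) 0≤9y)
                 (≤-reflexive (trans (lemma (ι j) (# 9 * y))
                   (sym (trans (bracket-x k) (cong (λ κ → κ * κ - # 7 * κ + # 9 + # 9 * y) (trans (ι-+ 6 j) (cong (_+ ι j) (ι≡ 6)))))))))
        where
        lemma : ∀ j z → # 3 + (# 5 * j + j * j) + z ≡ (# 6 + j) * (# 6 + j) - # 7 * (# 6 + j) + # 9 + z
        lemma = solve-∀ ℚ-ring

      W : ℕ → ℚ
      W = weight n x

      0≤W : ∀ k → 0ℚ ≤ W k
      0≤W k = <⇒≤ (weight-pos n 0<x x<1 k)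

      gains losses : ℕ → ℚ
      gains k = W k * gain k
      losses k = W k * loss k

      -- For a disconnected set the right side is 0 and the left side at most 0: only singletons
      -- have a gain, and these are connected.
      lower : ∀ C → gains ∣ C ∣ - edgesIn G C * (losses ∣ C ∣) ≤ when (connectedSet? G C) (curvature n x ∣ C ∣)
      lower C = ≤-when (connectedSet? G C)
        (λ c → ≤-trans (≤-reflexive (lemma (W k) (gain k) e (loss k)))
                       (*-monoˡ (0≤W k) (bracket-bound k e (connected⇒size≤1+edges G c))))
        (λ ¬c → disconnected k (λ k≡1 → ¬c (singleton-connected G k≡1)))
        where
        k = ∣ C ∣
        e = edgesIn G C
        lemma : ∀ w g e l → w * g - e * (w * l) ≡ w * (g - e * l)
        lemma = solve-∀ ℚ-ring
        lemma₂ : ∀ w p → 0ℚ ≡ w * 0ℚ - p + p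
        lemma₂ = solve-∀ ℚ-ring
        no-gain : ∀ k → gain k ≡ 0ℚ → gains k - e * losses k ≤ 0ℚ
        no-gain k gain≡0 = ≤-offset
          (trans (lemma₂ (W k) (e * losses k)) (cong (λ g → W k * g - e * losses k + e * losses k) (sym gain≡0)))
          (*-nonNeg (0≤edgesIn G C) (*-nonNeg (0≤W k) (0≤loss k)))
        disconnected : ∀ k → k ≢ 1 → gains k - e * losses k ≤ 0ℚ
        disconnected 0             _   = no-gain 0 refl
        disconnected 1             k≢1 = contradiction refl k≢1
        disconnected (suc (suc k)) _   = no-gain (suc (suc k)) refl

      -- Its four summands are the losses of the sizes 2, 3, 4 and 5 per edge of the graph, without
      -- the common factor (9/8) y⁶ Q M that `balance≡` takes out.
      K : ℚ
      K = # 8 * (M * M) * (1ℚ + T) + # 36 * (# 9 + T) * (M * M) + # 36 * (# 9 + T) * (# 8 + T) * M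
          + # 9 * (# 9 + T) * (# 8 + T) * (1ℚ + T)

      0≤K : 0ℚ ≤ K
      0≤K = +-nonNeg (+-nonNeg (+-nonNeg
          (*-nonNeg (*-nonNeg {# 8} (≤ᵇ⇒≤ _) 0≤M²) 0≤1+T)
          (*-nonNeg (*-nonNeg {# 36} (≤ᵇ⇒≤ _) 0≤9+T) 0≤M²))
          (*-nonNeg (*-nonNeg (*-nonNeg {# 36} (≤ᵇ⇒≤ _) 0≤9+T) 0≤8+T) (<⇒≤ 0<M)))
          (*-nonNeg (*-nonNeg (*-nonNeg {# 9} (≤ᵇ⇒≤ _) 0≤9+T) 0≤8+T) 0≤1+T)
        where
        0≤M² = *-nonNeg (<⇒≤ 0<M) (<⇒≤ 0<M)
        0≤9+T = +-nonNeg {# 9} (≤ᵇ⇒≤ _) 0≤T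
        0≤8+T = +-nonNeg {# 8} (≤ᵇ⇒≤ _) 0≤T

      -- This is where the constant 0.0851 matters: for the largest admissible m̂ the
      -- difference is (# 11 + T) * p / 10000, and all coefficients of p are positive.
      dominates : 0ℚ < # 8 * (M * M * M) * (# 13 + T) * (# 11 + T) - m̂ * K
      dominates = <-≤-trans
        (+-pos-nonNeg (*-pos 0<n̂ (*-pos (positive⁻¹ (ℤ.+ 1 / 10000)) 0<p))
          (*-nonNeg (0≤q-p (≤-trans sparse (≤-reflexive (cong (λ v → c * (v * v)) n̂≡)))) 0≤K))
        (≤-reflexive (trans (regroup n̂ (ℤ.+ 1 / 10000 * p) c m̂ K)
          (cong (λ v → v * n̂ - m̂ * K) (sym (polynomial T)))))
        where
        c = ℤ.+ 851 / 10000
        n̂ = # 11 + T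
        -- The leading coefficient is 80000 - 851 · 89, where 89 = 8 + 36 + 36 + 9 is that of `K`;
        -- the ratio 8/89 is the limit of this estimate as T grows.
        p = # 28523340 + # 14927299 * T + # 2798055 * (T * T) + # 206997 * (T * T * T) + # 4261 * (T * T * T * T)
        0<n̂ : 0ℚ < n̂
        0<n̂ = +-pos-nonNeg (positive⁻¹ (# 11)) 0≤T
        0≤T² = *-nonNeg 0≤T 0≤T
        0≤T³ = *-nonNeg 0≤T² 0≤T
        0<p : 0ℚ < p
        0<p = +-pos-nonNeg (+-pos-nonNeg (+-pos-nonNeg (+-pos-nonNeg (positive⁻¹ (# 28523340))
          (*-nonNeg {# 14927299} (≤ᵇ⇒≤ _) 0≤T)) (*-nonNeg {# 2798055} (≤ᵇ⇒≤ _) 0≤T²))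
          (*-nonNeg {# 206997} (≤ᵇ⇒≤ _) 0≤T³)) (*-nonNeg {# 4261} (≤ᵇ⇒≤ _) (*-nonNeg 0≤T³ 0≤T))
        regroup : ∀ n r c m K → n * r + (c * (n * n) - m) * K ≡ (c * n * K + r) * n - m * K
        regroup = solve-∀ ℚ-ring
        polynomial : ∀ T → # 8 * ((# 7 + T) * (# 7 + T) * (# 7 + T)) * (# 13 + T) ≡
          ℤ.+ 851 / 10000 * (# 11 + T) *
            (# 8 * ((# 7 + T) * (# 7 + T)) * (1ℚ + T) + # 36 * (# 9 + T) * ((# 7 + T) * (# 7 + T))
             + # 36 * (# 9 + T) * (# 8 + T) * (# 7 + T) + # 9 * (# 9 + T) * (# 8 + T) * (1ℚ + T))
          + ℤ.+ 1 / 10000 * (# 28523340 + # 14927299 * T + # 2798055 * (T * T) + # 206997 * (T * T * T)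
             + # 4261 * (T * T * T * T))
        polynomial = solve-∀ ℚ-ring

      -- The power of 1 - x with exponent n - 5, common to the weights of all sizes up to 5.
      Q : ℚ
      Q = ⟦ 1-var :^ (6 ℕ.+ t) ⟧ x

      -- Total gain minus total loss, with the weights unfolded down to `Q`. The four parameters are
      -- the quantities still to be rewritten in terms of T and y.
      balance : ℚ → ℚ → ℚ → ℚ → ℚ
      balance n̂ T′ g q =
        W 0 * 0ℚ + n̂ * (x * 1ℚ * (q * (q * (q * (q * Q)))) * g)
        - m̂ * (x * (x * 1ℚ) * (q * (q * (q * Q))) * ((1ℚ + T) * y)
          + T′ * (x * (x * (x * 1ℚ)) * (q * (q * Q)) * (# 3 * ½ * (M * y)))
          + binom₂ T′ * (x * (x * (x * (x * 1ℚ))) * (q * Q) * (M * y))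
          + binom₃ T′ * (x * (x * (x * (x * (x * 1ℚ)))) * Q * (¼ * ((1ℚ + T) * y))))

      Σ-lower : Σ[ n ] (λ C → gains ∣ C ∣ - edgesIn G C * (losses ∣ C ∣)) ≡ balance (ι n) (ι (9 ℕ.+ t)) (# 3 + # 9 * y) q
      Σ-lower = trans (sum-- (λ C → gains ∣ C ∣) (λ C → edgesIn G C * (losses ∣ C ∣)) (subsets n))
        (cong₂ _-_
          (Σ-size-2 n gains (λ where (s≤s (s≤s {n = k} _)) → *-zeroʳ (W (suc (suc k)))))
          (trans (Σ-edgesIn G losses) (cong (m̂ *_)
            (Σ-size-4 (9 ℕ.+ t) (losses ∘ ℕ.suc ∘ ℕ.suc)
              (λ where (s≤s (s≤s (s≤s (s≤s {n = k} _)))) → *-zeroʳ (W (6 ℕ.+ k)))))))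

      -- Once the gain and q are multiples of y, every nonzero term carries y⁶. The factor M also
      -- comes out of the term for size 5, since T′ - 2 = M in its binomial coefficient.
      balance≡ : balance (ι n) (ι (9 ℕ.+ t)) (# 3 + # 9 * y) q ≡
        # 9 * ½ * ¼ * (y * y * y * (y * y * y)) * Q * M * (# 8 * (M * M * M) * (# 13 + T) * (# 11 + T) - m̂ * K)
      balance≡ = trans (cong₂ (λ v w → balance v w (# 3 + # 9 * y) q) n̂≡ (trans (ι-+ 9 t) (cong (_+ T) (ι≡ 9))))
        (trans (cong₂ (balance (# 11 + T) (# 9 + T)) gain≡ q≡My) (lemma (W 0) T y Q m̂))
        where
        lemma₁ : ∀ T y → # 3 * ((# 10 + T) * y) + # 9 * y ≡ # 3 * ((# 13 + T) * y)
        lemma₁ = solve-∀ ℚ-ring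
        gain≡ : # 3 + # 9 * y ≡ # 3 * ((# 13 + T) * y)
        gain≡ = trans (cong (_+ # 9 * y) (trans (sym (*-identityʳ (# 3))) (cong (# 3 *_) (sym Ny≡1)))) (lemma₁ T y)
        lemma : ∀ w T y Q m → let x = # 3 * y; M = # 7 + T; q = M * y; T′ = # 9 + T in
          w * 0ℚ + (# 11 + T) * (x * 1ℚ * (q * (q * (q * (q * Q)))) * (# 3 * ((# 13 + T) * y)))
          - m * (x * (x * 1ℚ) * (q * (q * (q * Q))) * ((1ℚ + T) * y)
            + T′ * (x * (x * (x * 1ℚ)) * (q * (q * Q)) * (# 3 * ½ * (M * y)))
            + ½ * (T′ * (T′ - 1ℚ)) * (x * (x * (x * (x * 1ℚ))) * (q * Q) * (M * y))
            + ½ * ⅓ * (T′ * (T′ - 1ℚ) * (T′ - (1ℚ + 1ℚ))) * (x * (x * (x * (x * (x * 1ℚ)))) * Q * (¼ * ((1ℚ + T) * y))))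
          ≡ # 9 * ½ * ¼ * (y * y * y * (y * y * y)) * Q * M * (# 8 * (M * M * M) * (# 13 + T) * (# 11 + T)
            - m * (# 8 * (M * M) * (1ℚ + T) + # 36 * (# 9 + T) * (M * M) + # 36 * (# 9 + T) * (# 8 + T) * M
                   + # 9 * (# 9 + T) * (# 8 + T) * (1ℚ + T)))
        lemma = solve-∀ ℚ-ring

    positive-between : 0ℚ < ⟦ nRel″ G ⟧ x
    positive-between = pos-cancelˡ (scale-pos 0<x x<1) (<-≤-trans
      (<-≤-trans (*-pos (*-pos (*-pos (*-pos {# 9 * ½ * ¼} (positive⁻¹ (# 9 * ½ * ¼)) (*-pos 0<y³ 0<y³)) 0<Q) 0<M) dominates)
                 (≤-reflexive (sym (trans Σ-lower balance≡))))
      (≤-trans (sum-mono lower (subsets n)) (≤-reflexive (sym (scaled-nRel″ G x)))))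
      where
      0<y³ = *-pos (*-pos 0<y 0<y) 0<y
      0<Q : 0ℚ < Q
      0<Q = :^-pos 1-var {x} (6 ℕ.+ t) 0<q

open PositivePoint

-- Assembling the two inflection points.

open import Defs
open import Data.Nat using (ℕ; _^_)
open import Data.Integer using (+_)
open import Data.Rational using () renaming (_≤_ to _≤ℚ_; _*_ to _*ℚ_; _/_ to _/ℚ_)
open import Data.Product using (∃-syntax; _×_)

import Data.Nat as ℕ
import Data.Nat.Properties as ℕ
import Data.Rational as ℚ
import Data.Rational.Properties as ℚ
open import Data.Product using (_,_; proj₁; proj₂)
open import Data.Sum using (inj₁; inj₂)
open import Relation.Binary.PropositionalEquality
open import Relation.Nullary using (¬_; contradiction)
open import Relation.Nullary.Decidable using (toWitnessFalse)
open import Tactic.RingSolver using (solve-∀)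

<-trans-ℝ : ∀ x y z → x < y → y < z → x < z
<-trans-ℝ x y z (d , 0<d , M , x<y) (e , 0<e , N , y<z) = d , 0<d , M ℕ.⊔ N , λ i ≤i →
  ℚ.≤-trans (x<y i (ℕ.m⊔n≤o⇒m≤o M N ≤i))
    (ℚ.≤-trans (≤-offset refl (ℚ.<⇒≤ 0<e)) (y<z i (ℕ.m⊔n≤o⇒n≤o M N ≤i)))

fromℚ-mono : ∀ {p q} → p ℚ.< q → fromℚ p < fromℚ q
fromℚ-mono {p} {q} p<q = q ℚ.- p , 0<q-p p<q , 0 , λ _ _ → ℚ.≤-reflexive (lemma p q)
  where
  lemma : ∀ p q → p ℚ.+ (q ℚ.- p) ≡ q
  lemma = solve-∀ ℚ-ring

-- A connected graph has too many edges when 3 ≤ n ≤ 10.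
eleven-vertices : ∀ n m → 2 ℕ.< n → n ℕ.≤ ℕ.suc m →
  (+ m /ℚ 1) ≤ℚ (+ 851 /ℚ 10000) *ℚ (+ (n ^ 2) /ℚ 1) → ∃[ t ] 11 ℕ.+ t ≡ n
eleven-vertices n m 2<n n≤1+m sparse = large n 2<n (ℚ.≤-trans
  (ℚ.≤-trans (ℚ.≤-reflexive (sym (ι≡ (n ℕ.∸ 1))))
    (ℚ.≤-trans (ι-mono-≤ (ℕ.∸-monoˡ-≤ 1 n≤1+m)) (ℚ.≤-reflexive (ι≡ m)))) sparse)
  where
  Sparse : ℕ → Set
  Sparse n = (+ (n ℕ.∸ 1) /ℚ 1) ≤ℚ (+ 851 /ℚ 10000) *ℚ (+ (n ^ 2) /ℚ 1)
  dense : ∀ n → {_ : ¬ Sparse n} → Sparse n → ∃[ t ] 11 ℕ.+ t ≡ n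
  dense n {¬s} s = contradiction s ¬s
  large : ∀ n → 2 ℕ.< n → Sparse n → ∃[ t ] 11 ℕ.+ t ≡ n
  large 0 () _
  large 1 (ℕ.s≤s ()) _
  large 2 (ℕ.s≤s (ℕ.s≤s ())) _
  -- Each refutation is computed by the decision procedure for rational comparison. The last one is
  -- 9 > 8.51 at n = 10; at n = 11 the bound 10 ≤ 10.2971 holds.
  large 3 _ = dense 3 {toWitnessFalse {a? = _ ℚ.≤? _} _}
  large 4 _ = dense 4 {toWitnessFalse {a? = _ ℚ.≤? _} _}
  large 5 _ = dense 5 {toWitnessFalse {a? = _ ℚ.≤? _} _}
  large 6 _ = dense 6 {toWitnessFalse {a? = _ ℚ.≤? _} _}
  large 7 _ = dense 7 {toWitnessFalse {a? = _ ℚ.≤? _} _}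
  large 8 _ = dense 8 {toWitnessFalse {a? = _ ℚ.≤? _} _}
  large 9 _ = dense 9 {toWitnessFalse {a? = _ ℚ.≤? _} _}
  large 10 _ = dense 10 {toWitnessFalse {a? = _ ℚ.≤? _} _}
  large (ℕ.suc (ℕ.suc (ℕ.suc (ℕ.suc (ℕ.suc (ℕ.suc (ℕ.suc (ℕ.suc (ℕ.suc (ℕ.suc (ℕ.suc n))))))))))) _ _ = n , refl

TwoInflectionPoints : ∀ {n} → Graph n → Set
TwoInflectionPoints G = ∃[ c₁ ] ∃[ c₂ ] c₁ # c₂ ×
    (0ℝ < c₁ × c₁ < 1ℝ × InflectionPoint (nRel G) c₁) ×
    (0ℝ < c₂ × c₂ < 1ℝ × InflectionPoint (nRel G) c₂)

module _ (t : ℕ) (G : Graph (11 ℕ.+ t))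
         (sparse : (+ size G /ℚ 1) ≤ℚ (+ 851 /ℚ 10000) *ℚ (+ ((11 ℕ.+ t) ^ 2) /ℚ 1)) (conn : KConnected 2 G) where

  private
    n = 11 ℕ.+ t
    T = ι t
    0<N : ℚ.0ℚ ℚ.< # 10 ℚ.+ T
    0<N = +-pos-nonNeg (ℚ.positive⁻¹ (# 10)) (0≤ι t)
    inverse = divide 0<N 0<1
    y = proj₁ inverse
    0<y = proj₁ (proj₂ inverse)
    Ny≡1 = proj₂ (proj₂ inverse)
    h = ℚ.½ ℚ.* y
    x = # 3 ℚ.* y
    0<h = ½-pos 0<y

    2Nh≡1 : (ℚ.1ℚ ℚ.+ ℚ.1ℚ) ℚ.* ι (10 ℕ.+ t) ℚ.* h ≡ ℚ.1ℚ
    2Nh≡1 = trans (cong (λ v → (ℚ.1ℚ ℚ.+ ℚ.1ℚ) ℚ.* v ℚ.* h) (trans (ι-+ 10 t) (cong (ℚ._+ T) (ι≡ 10))))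
                  (trans (lemma (# 10 ℚ.+ T) y) Ny≡1)
      where
      lemma : ∀ N y → (ℚ.1ℚ ℚ.+ ℚ.1ℚ) ℚ.* N ℚ.* (ℚ.½ ℚ.* y) ≡ N ℚ.* y
      lemma = solve-∀ ℚ-ring

    sparse′ : ι (size G) ℚ.≤ (+ 851 /ℚ 10000) ℚ.* (ι n ℚ.* ι n)
    sparse′ = ℚ.≤-trans (ℚ.≤-reflexive (ι≡ (size G))) (ℚ.≤-trans sparse (ℚ.≤-reflexive
      (cong ((+ 851 /ℚ 10000) ℚ.*_) (trans (sym (ι≡ (n ^ 2)))
        (trans (cong ι (cong (n ℕ.*_) (ℕ.*-identityʳ n))) (ι-* n n))))))

    h<x : h ℚ.< x
    h<x = <-offset (lemma y) (*-pos {# 2 ℚ.+ ℚ.½} (ℚ.positive⁻¹ (# 2 ℚ.+ ℚ.½)) 0<y)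
      where
      lemma : ∀ y → # 3 ℚ.* y ≡ ℚ.½ ℚ.* y ℚ.+ (# 2 ℚ.+ ℚ.½) ℚ.* y
      lemma = solve-∀ ℚ-ring

    x<1-h : x ℚ.< ℚ.1ℚ ℚ.- h
    x<1-h = <-offset (trans (cong (ℚ._- h) (sym Ny≡1)) (lemma T y))
      (*-pos (+-pos-nonNeg (ℚ.positive⁻¹ (# 6 ℚ.+ ℚ.½)) (0≤ι t)) 0<y)
      where
      lemma : ∀ T y → (# 10 ℚ.+ T) ℚ.* y ℚ.- ℚ.½ ℚ.* y ≡ # 3 ℚ.* y ℚ.+ (# 6 ℚ.+ ℚ.½ ℚ.+ T) ℚ.* y
      lemma = solve-∀ ℚ-ring

    x<1′ : x ℚ.< ℚ.1ℚ
    x<1′ = x<1 t G 0<y Ny≡1 sparse′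

    0<x = *-pos (ℚ.positive⁻¹ (# 3)) 0<y

    h<1 = ℚ.<-trans h<x x<1′

    f = nRel″ G
    at-h : ⟦ f ⟧ h ℚ.< ℚ.0ℚ
    at-h = negative-near-0 G 0<h h<1 2Nh≡1
    at-x : ℚ.0ℚ ℚ.< ⟦ f ⟧ x
    at-x = positive-between t G 0<y Ny≡1 sparse′
    at-1-h : ⟦ f ⟧ (ℚ.1ℚ ℚ.- h) ℚ.< ℚ.0ℚ
    at-1-h = negative-near-1 G 0<h h<1 2Nh≡1 conn

    1-h<1 : ℚ.1ℚ ℚ.- h ℚ.< ℚ.1ℚ
    1-h<1 = <-offset (lemma h) 0<h
      where
      lemma : ∀ h → ℚ.1ℚ ≡ ℚ.1ℚ ℚ.- h ℚ.+ h
      lemma = solve-∀ ℚ-ring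

    first = signChange⇒changesSignAt (derivative (derivative (nRel G))) (ℚ.<⇒≤ 0<h) (ℚ.<⇒≤ x<1′)
      (inj₁ (ℚ.<⇒≤ h<x , at-h , at-x))
    second = signChange⇒changesSignAt (derivative (derivative (nRel G))) (ℚ.<⇒≤ 0<x) (ℚ.<⇒≤ 1-h<1)
      (inj₂ (ℚ.<⇒≤ x<1-h , opp-neg x at-x , opp-pos (ℚ.1ℚ ℚ.- h) at-1-h))
      where
      opp-neg : ∀ z → ℚ.0ℚ ℚ.< ⟦ f ⟧ z → ⟦ opp f ⟧ z ℚ.< ℚ.0ℚ
      opp-neg z p = ℚ.≤-<-trans (ℚ.≤-reflexive (opp-eval f z)) (ℚ.neg-antimono-< p)
      opp-pos : ∀ z → ⟦ f ⟧ z ℚ.< ℚ.0ℚ → ℚ.0ℚ ℚ.< ⟦ opp f ⟧ z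
      opp-pos z p = ℚ.<-≤-trans (ℚ.neg-antimono-< p) (ℚ.≤-reflexive (sym (opp-eval f z)))

  two-inflections : TwoInflectionPoints G
  two-inflections = collect first second
    where
    f″ = derivative (derivative (nRel G))
    collect : ∃[ c ] fromℚ h < c × c < fromℚ x × ChangesSignAt f″ c →
              ∃[ c ] fromℚ x < c × c < fromℚ (ℚ.1ℚ ℚ.- h) × ChangesSignAt f″ c → TwoInflectionPoints G
    collect (c₁ , h<c₁ , c₁<x , inf₁) (c₂ , x<c₂ , c₂<1-h , inf₂) = c₁ , c₂
      -- Apartness comes from the rational point x, which lies strictly between the two.
      , inj₁ (<-trans-ℝ c₁ (fromℚ x) c₂ c₁<x x<c₂)
      , (<-trans-ℝ 0ℝ (fromℚ h) c₁ (fromℚ-mono 0<h) h<c₁ , <-trans-ℝ c₁ (fromℚ x) 1ℝ c₁<x (fromℚ-mono x<1′) , inf₁)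
      , (<-trans-ℝ 0ℝ (fromℚ x) c₂ (fromℚ-mono 0<x) x<c₂
        , <-trans-ℝ c₂ (fromℚ (ℚ.1ℚ ℚ.- h)) 1ℝ c₂<1-h (fromℚ-mono 1-h<1) , inf₂)

theorem3p4 : ∀ (n : ℕ) (G : Graph n) →
    (+ size G /ℚ 1) ≤ℚ (+ 851 /ℚ 10000) *ℚ (+ (n ^ 2) /ℚ 1) →
    KConnected 2 G →
    ∃[ c₁ ] ∃[ c₂ ] c₁ # c₂ ×
    (0ℝ < c₁ × c₁ < 1ℝ × InflectionPoint (nRel G) c₁) ×
    (0ℝ < c₂ × c₂ < 1ℝ × InflectionPoint (nRel G) c₂)
theorem3p4 n G sparse conn = go (eleven-vertices n (size G) (proj₁ conn) (order≤1+size G conn) sparse) G sparse conn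
  where
  -- The order is generalised so that 11 + t ≡ n can be matched with `refl`.
  go : ∀ {n} → ∃[ t ] 11 ℕ.+ t ≡ n → (G : Graph n) →
    (+ size G /ℚ 1) ≤ℚ (+ 851 /ℚ 10000) *ℚ (+ (n ^ 2) /ℚ 1) → KConnected 2 G → TwoInflectionPoints G
  go (t , refl) = two-inflections t
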